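{- (1) The following are equivalent: (a) $\mathrm{SCP}$. (b) Every $*$-operationally closed poset is $\omega_2$-strategically closed. (c) $\mathbb{P}_{\mathrm{SCP}}$ is $\omega_2$-strategically closed. (d) $\mathrm{MA}_{\omega_2}(\text{$*$-operationally closed})$. (e) $\mathrm{MA}_{\omega_2}(\mathbb{P}_{\mathrm{SCP}})$. (2) The following are equivalent: (a) $\mathrm{SCP}^-$. (b) Every $*$-tactically closed poset is $\omega_2$-strategically closed. (c) $\mathbb{P}_{\mathrm{SCP}^- }$ is $\omega_2$-strategically closed. (d) $\mathrm{MA}_{\omega_2}(\text{$*$-tactically closed})$. (e) $\mathrm{MA}_{\omega_2}(\mathbb{P}_{\mathrm{SCP}^- })$.
   Context: Posets $\mathbb{P}$ are reflexive, transitive and separative (not necessarily antisymmetric), with a specified greatest element $1_{\mathbb{P}}$; smaller conditions are stronger. $\mathcal{B}(\mathbb{P})$ is the Boolean completion, and $\bigwedge A$ is computed in $\mathcal{B}(\mathbb{P})$. $\mathrm{Lim}$ is the class of nonzero limit ordinals. $S^2_i=\{\alpha<\omega_2\mid\mathrm{cf}\,\alpha=\omega_i\}$ for $i=0,1$; o.t. denotes order type. $\mathrm{MA}_{\omega_2}(\Gamma)$, for a class $\Gamma$ of posets (or a single poset), says: for every $\mathbb{P}\in\Gamma$ and every family of at most $\aleph_2$ dense subsets of $\mathbb{P}$ there is a filter on $\mathbb{P}$ meeting all of them. Strategic closedness. In the game $G_\alpha(\mathbb{P})$ Players I and II alternately choose conditions, each move being stronger than (i.e. $\le$) all preceding moves;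 turns are indexed by ordinals $\gamma<\alpha$; at turn $\gamma=0$ or $\gamma$ successor I plays $a_\gamma$ and then II plays $b_\gamma$, while at limit turns $\gamma$ I skips and II plays $b_\gamma$. II wins if she is able to take her turns $\alpha$ times without getting stuck. A strategy for II gives her move as a function of the sequence of preceding moves of I. $\mathbb{P}$ is $\alpha$-strategically closed if II has a winning strategy in $G_\alpha(\mathbb{P})$. The game $G^*(\mathbb{P})$: At each turn $\gamma\in\omega_1\setminus\mathrm{Lim}$ Player I plays a nonempty countable set $A_\gamma\subseteq\mathbb{P}$, and then II plays $b_\gamma\in\mathbb{P}$; at turns $\gamma\in\omega_1\cap\mathrm{Lim}$ Player I skips and II plays $b_\gamma\in\mathbb{P}$. For limit $\gamma$ put $A_\gamma=\bigcup\{A_\xi\mid \xi\in\gamma\setminus\mathrm{Lim}\}$. Player I must ensure: $\langle A_\gamma\mid\gamma\in\omega_1\setminus\mathrm{Lim}\rangle$ is $\subseteq$-increasing; each $A_\gamma$ ($\gamma\in\omega_1\setminus\mathrm{Lim}$) has a common extension in $\mathbb{P}$; and $\bigwedge A_{\gamma+1}\le_{\mathcal{B}(\mathbb{P})}b_\gamma$ for each $\gamma<\omega_1$. Player II must ensure that $b_\gamma$ is a common extension of $A_\gamma$ for every $\gamma<\omega_1$. Player II wins if she is able to make all her moves up to and including her $\omega_1$-th move (i.e. she never gets stuck, and finally $\bigcup\{A_\xi\mid\xi\in\omega_1\setminus\mathrm{Lim}\}$ has a common extension). $[\mathbb{P}]^{\le\aleph_0}_+$ is the set of nonempty countable $A\subseteq\mathbb{P}$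 having a common extension in $\mathbb{P}$. A $*$-operation is a function $\tau:\omega_1\times[\mathbb{P}]^{\le\aleph_0}_+\to\mathbb{P}$; II plays according to $\tau$ if for each $\delta<\omega_1$ she chooses $\tau(\delta,A_\delta)$ as her $\delta$-th move as long as it is legal (an illegal prescription counts as a loss for her); $\tau$ is winning if II wins every play in which she plays according to $\tau$. A $*$-tactic is a $*$-operation whose values do not depend on the first argument. $\mathbb{P}$ is $*$-operationally (resp. $*$-tactically) closed if there is a winning $*$-operation (resp. $*$-tactic) for $G^*(\mathbb{P})$. $\mathrm{SCP}$: there exist a sequence $\langle z_\alpha\mid\alpha\in S^2_0\rangle$ and a function $f:\omega_2\to\omega_1$ such that each $z_\alpha$ is a countable cofinal subset of $\alpha$ and, for each $\beta\in S^2_1$, there is a club subset $C$ of $\beta\cap S^2_0$ (i.e. $C\subseteq S^2_0$ is closed unbounded in $\beta$) with $\mathrm{o.t.}\,C=\omega_1$ such that (i) $\langle z_\alpha\mid\alpha\in C\rangle$ is increasing and continuous with respect to inclusion, and (ii) $f(\alpha)=\mathrm{o.t.}(C\cap\alpha)$ for each $\alpha\in C$. $\mathrm{SCP}^-$ is the statement obtained by removing all references to $f$ (in particular (ii)). $\mathbb{P}_{\mathrm{SCP}}$: conditions (besides a greatest, empty condition) are $p=\langle\langle z^p_\alpha\mid\alpha\in S^2_0,\ \alpha\le\beta^p\rangle,f^p\rangle$ where $\beta^p\in S^2_0$; $f^p:\beta^p+1\to\omega_1$; each $z^p_\alpha$ is a countable cofinal subset of $\alpha$; and for each $\beta\in\beta^p\cap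 S^2_1$ there is a club subset $C$ of $\beta\cap S^2_0$ with $\mathrm{o.t.}\,C=\omega_1$ such that $\langle z^p_\alpha\mid\alpha\in C\rangle$ is increasing and continuous with respect to inclusion and $f^p(\alpha)=\mathrm{o.t.}(C\cap\alpha)$ for each $\alpha\in C$. $p\le q$ iff $p$ end-extends $q$: $\vec z^{\,q}=\vec z^{\,p}\restriction(\beta^q+1)$ and $f^q=f^p\restriction(\beta^q+1)$. $\mathbb{P}_{\mathrm{SCP}^- }$ is defined in the same way with $f^p$ and all requirements about it removed, ordered by end-extension. -}

module Defs where

open import Level using (0ℓ)
open import Data.Bool using (Bool; T)
open import Data.Maybe using (Maybe; just; nothing)
open import Data.Nat using (ℕ)
import Data.Nat as ℕ using (_<_)
import Data.Nat.Induction as ℕ using (<-wellFounded)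
import Data.Nat.Properties as ℕ using (<-isStrictTotalOrder)
open import Data.Product using (Σ; _×_; _,_; ∃)
open import Data.Sum using (_⊎_; inj₁; inj₂)
open import Data.Unit using (⊤; tt)
open import Data.Empty using (⊥)
open import Function.Bundles using (_⇔_; _↣_)
open import Induction.WellFounded using (WellFounded)
open import Relation.Binary.Core using (Rel)
open import Relation.Binary.Definitions using (Maximum)
open import Relation.Binary.PropositionalEquality
  using (_≡_; refl; trans; isEquivalence)
open import Relation.Binary.Structures using (IsStrictTotalOrder; IsPreorder)
open import Relation.Nullary using (¬_)
open import Relation.Unary using (Pred; U; _∩_)

-- The mathematics takes place in ZFC.  The universe Set plays the role of
-- the universe of sets; excluded middle and function extensionality are
-- to be assumed by the theorem (choice for Σ-types holds outright).  Under
-- these assumptions X → Bool is the full power set of X, it is again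
-- small, and two subsets with the same elements are equal.

𝒫 : Set → Set
𝒫 X = X → Bool

infix 4 _∈_ _⊆_

_∈_ : {X : Set} → X → 𝒫 X → Set
x ∈ A = T (A x)

_⊆_ : {X : Set} → 𝒫 X → 𝒫 X → Set
A ⊆ B = ∀ x → x ∈ A → x ∈ B

-- The part A of X injects into Y.  (As below, a map defined on a part of
-- X is given by a function on all of X whose other values are ignored.)

Injects : {X : Set} → Pred X 0ℓ → Set → Set
Injects {X} A Y =
  Σ (X → Y) λ e → ∀ x x′ → A x → A x′ → e x ≡ e x′ → x ≡ x′

Countable : {X : Set} → Pred X 0ℓ → Set
Countable A = Injects A ℕ

-- Well-orders, as presentations of ordinals: the elements of W are the
-- ordinals below W.

record WellOrder : Set₁ where
  infix 4 _<_ _≤_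
  field
    Carrier            : Set
    _<_                : Rel Carrier 0ℓ
    isStrictTotalOrder : IsStrictTotalOrder _≡_ _<_
    wellFounded        : WellFounded _<_

  _≤_ : Rel Carrier 0ℓ
  ξ ≤ η = ξ < η ⊎ ξ ≡ η

  Lim : Pred Carrier 0ℓ
  Lim γ = (∃ λ ξ → ξ < γ) × (∀ ξ → ξ < γ → ∃ λ η → ξ < η × η < γ)

  -- η = ξ + 1
  _IsSuccessorOf_ : Rel Carrier 0ℓ
  η IsSuccessorOf ξ = ξ < η × (∀ ζ → ξ < ζ → η ≤ ζ)

open WellOrder using () renaming (Carrier to ∣_∣)

ω : WellOrder
ω = record
  { Carrier            = ℕ
  ; _<_                = ℕ._<_
  ; isStrictTotalOrder = ℕ.<-isStrictTotalOrder
  ; wellFounded        = ℕ.<-wellFounded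
  }

-- L is the least ordinal that does not inject into K.  For K an infinite
-- cardinal this says L = K⁺, and it determines L up to isomorphism.

IsCardinalSuccessor : WellOrder → WellOrder → Set
IsCardinalSuccessor K L =
  ¬ Injects {∣ L ∣} U ∣ K ∣ × (∀ γ → Injects (_< γ) ∣ K ∣)
  where open WellOrder L

-- A and B, with the orders inherited from V and W, have the same order
-- type; a strictly increasing surjection between linear orders is an
-- isomorphism.

SameOrderType : (V W : WellOrder) → Pred ∣ V ∣ 0ℓ → Pred ∣ W ∣ 0ℓ → Set
SameOrderType V W A B =
  Σ (∣ V ∣ → ∣ W ∣) λ e →
      (∀ v → A v → B (e v))
    × (∀ v v′ → A v → A v′ → v V.< v′ → e v W.< e v′)
    × (∀ w → B w → ∃ λ v → A v × e v ≡ w)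
  where
    module V = WellOrder V
    module W = WellOrder W

-- cf α = D : D is the least ordinal from which there is a cofinal map
-- to α.

module _ (W D : WellOrder) where
  private
    module W = WellOrder W
    module D = WellOrder D

  CofinalMap : Pred ∣ D ∣ 0ℓ → ∣ W ∣ → Set
  CofinalMap I α =
    Σ (∣ D ∣ → ∣ W ∣) λ g →
        (∀ i → I i → g i W.< α)
      × (∀ ξ → ξ W.< α → ∃ λ i → I i × ξ W.≤ g i)

  HasCofinality : ∣ W ∣ → Set
  HasCofinality α = CofinalMap U α × (∀ δ → ¬ CofinalMap (D._< δ) α)

-- Separativity is kept apart from the record, as a hypothesis wherever
-- posets are quantified over.

record Poset : Set₁ where
  infix 4 _⊑_
  field
    Carrier    : Set
    _⊑_        : Rel Carrier 0ℓ
    isPreorder : IsPreorder _≡_ _⊑_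
    𝟙          : Carrier
    𝟙-greatest : Maximum _⊑_ 𝟙

  open IsPreorder isPreorder public
    using () renaming (refl to ⊑-refl; trans to ⊑-trans)

  Compatible : Rel Carrier 0ℓ
  Compatible p q = ∃ λ r → r ⊑ p × r ⊑ q

  CommonExtension : Carrier → Pred Carrier 0ℓ → Set
  CommonExtension q A = ∀ p → A p → q ⊑ p

  Dense : 𝒫 Carrier → Set
  Dense D = ∀ p → ∃ λ q → q ⊑ p × q ∈ D

  record IsFilter (F : 𝒫 Carrier) : Set where
    field
      nonempty : ∃ λ p → p ∈ F
      upward   : ∀ p q → p ∈ F → p ⊑ q → q ∈ F
      directed : ∀ p q → p ∈ F → q ∈ F → ∃ λ r → r ∈ F × r ⊑ p × r ⊑ q

open Poset using () renaming (Carrier to ⟨_⟩)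

Separative : Poset → Set
Separative P = ∀ p q → ¬ p ⊑ q → ∃ λ r → r ⊑ p × ¬ Compatible r q
  where open Poset P

-- The Boolean completion 𝓑(P), realised as the algebra of regular open
-- subsets of P (for the topology whose open sets are the downward closed
-- ones) ordered by inclusion.

module _ (P : Poset) where
  open Poset P

  record 𝓑 : Set₁ where
    field
      elements : Pred ⟨ P ⟩ 0ℓ
      downward : ∀ p q → elements p → q ⊑ p → elements q
      regular  : ∀ p → (∀ q → q ⊑ p → ∃ λ r → r ⊑ q × elements r) → elements p

  open 𝓑

  infix 4 _≤𝓑_
  _≤𝓑_ : 𝓑 → 𝓑 → Set
  b ≤𝓑 c = ∀ p → elements b p → elements c p

  -- The canonical map P → 𝓑(P): the interior of the closure of the cone
  -- below p.
  ι : ⟨ P ⟩ → 𝓑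
  ι p = record
    { elements = λ q → ∀ r → r ⊑ q → Compatible r p
    ; downward = λ q q′ h q′⊑q r r⊑q′ → h r (⊑-trans r⊑q′ q′⊑q)
    ; regular  = λ q h r r⊑q →
        let s , s⊑r , hs = h r r⊑q
            t , t⊑s , t⊑p = hs s ⊑-refl
        in t , ⊑-trans t⊑s s⊑r , t⊑p
    }

  ⋀ : 𝒫 ⟨ P ⟩ → 𝓑
  ⋀ A = record
    { elements = λ q → ∀ a → a ∈ A → elements (ι a) q
    ; downward = λ q q′ h q′⊑q a a∈A → downward (ι a) q q′ (h a a∈A) q′⊑q
    ; regular  = λ q h a a∈A → regular (ι a) q λ r r⊑q →
        let s , s⊑r , hs = h r r⊑q in s , s⊑r , hs a a∈A
    }

  ⋀-lower : ∀ A a → a ∈ A → ⋀ A ≤𝓑 ι a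
  ⋀-lower A a a∈A q h = h a a∈A

  ⋀-greatest : ∀ A b → (∀ a → a ∈ A → b ≤𝓑 ι a) → b ≤𝓑 ⋀ A
  ⋀-greatest A b h q q∈b a a∈A = h a a∈A q q∈b

module _ (α : WellOrder) (P : Poset) where
  open WellOrder α
  open Poset P using (_⊑_)

  -- Player I moves at non-limit turns only: the values of a at limits are
  -- ignored.  Causality says that the answer at turn γ is a function of
  -- the moves of I made so far, including the one at turn γ.
  record Strategy : Set where
    field
      answer : ∣ α ∣ → (∣ α ∣ → ⟨ P ⟩) → ⟨ P ⟩
      causal : ∀ γ a a′ → (∀ ξ → ξ ≤ γ → ¬ Lim ξ → a ξ ≡ a′ ξ) →
               answer γ a ≡ answer γ a′

  module _ (a b : ∣ α ∣ → ⟨ P ⟩) where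

    LegalI : ∣ α ∣ → Set
    LegalI γ = ∀ ξ → ξ < γ → (¬ Lim ξ → a γ ⊑ a ξ) × a γ ⊑ b ξ

    LegalII : ∣ α ∣ → Set
    LegalII γ = (∀ ξ → ξ ≤ γ → ¬ Lim ξ → b γ ⊑ a ξ)
              × (∀ ξ → ξ < γ → b γ ⊑ b ξ)

  WinningStrategy : Strategy → Set
  WinningStrategy σ = ∀ a → let b = λ γ → answer γ a in
    ∀ γ → (∀ ξ → ξ ≤ γ → ¬ Lim ξ → LegalI a b ξ) → LegalII a b γ
    where open Strategy σ

  StrategicallyClosed : Set
  StrategicallyClosed = ∃ WinningStrategy

module _ (ω₁ : WellOrder) (P : Poset) where
  open WellOrder ω₁
  open Poset P using (_⊑_; CommonExtension)

  -- The values of τ at sets that are not nonempty, countable and bounded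
  -- below are irrelevant: in a play they are either never asked for, or
  -- cannot be a legal move.
  *-Operation : Set
  *-Operation = ∣ ω₁ ∣ → 𝒫 ⟨ P ⟩ → ⟨ P ⟩

  IsTactic : *-Operation → Set
  IsTactic τ = ∀ δ δ′ A → τ δ A ≡ τ δ′ A

  -- At limit turns A γ is not a move, but stands for the union of the
  -- preceding moves.
  UnionsAtLimits : (∣ ω₁ ∣ → 𝒫 ⟨ P ⟩) → Set
  UnionsAtLimits A = ∀ γ → Lim γ → ∀ p →
    p ∈ A γ ⇔ (∃ λ ξ → ξ < γ × ¬ Lim ξ × p ∈ A ξ)

  module _ (A : ∣ ω₁ ∣ → 𝒫 ⟨ P ⟩) (b : ∣ ω₁ ∣ → ⟨ P ⟩) where

    record *-LegalI (γ : ∣ ω₁ ∣) : Set where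
      field
        nonempty   : ∃ λ p → p ∈ A γ
        countable  : Countable (_∈ A γ)
        bounded    : ∃ λ q → CommonExtension q (_∈ A γ)
        increasing : ∀ ξ → ξ < γ → ¬ Lim ξ → A ξ ⊆ A γ
        below      : ∀ δ → γ IsSuccessorOf δ → _≤𝓑_ P (⋀ P (A γ)) (ι P (b δ))

    *-LegalII : ∣ ω₁ ∣ → Set
    *-LegalII γ = CommonExtension (b γ) (_∈ A γ)

    -- the existence of II's ω₁-th move
    FinalMove : Set
    FinalMove = ∃ λ q → CommonExtension q (λ p → ∃ λ ξ → ¬ Lim ξ × p ∈ A ξ)

  Winning* : *-Operation → Set
  Winning* τ = ∀ A → let b = λ γ → τ γ (A γ) in UnionsAtLimits A →
      (∀ γ → (∀ ξ → ξ ≤ γ → ¬ Lim ξ → *-LegalI A b ξ) → *-LegalII A b γ)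
    × ((∀ ξ → ¬ Lim ξ → *-LegalI A b ξ) → FinalMove A b)

  *-OperationallyClosed : Set
  *-OperationallyClosed = ∃ Winning*

  *-TacticallyClosed : Set
  *-TacticallyClosed = ∃ λ τ → IsTactic τ × Winning* τ

module _ (ω₂ : WellOrder) where

  MA-for : Poset → Set₁
  MA-for P = (I : Set) → I ↣ ∣ ω₂ ∣ →
    (D : I → 𝒫 ⟨ P ⟩) → (∀ i → Dense (D i)) →
    ∃ λ F → IsFilter F × (∀ i → ∃ λ p → p ∈ F × p ∈ D i)
    where open Poset P

  MA : (Poset → Set) → Set₁
  MA Γ = (P : Poset) → Separative P → Γ P → MA-for P

module _ (ω₁ ω₂ : WellOrder) where
  open WellOrder ω₂

  S²₀ S²₁ : Pred ∣ ω₂ ∣ 0ℓ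
  S²₀ = HasCofinality ω₂ ω
  S²₁ = HasCofinality ω₂ ω₁

  Unbounded : 𝒫 ∣ ω₂ ∣ → ∣ ω₂ ∣ → Set
  Unbounded C β = ∀ ξ → ξ < β → ∃ λ η → η ∈ C × η < β × ξ ≤ η

  CountableCofinal : 𝒫 ∣ ω₂ ∣ → ∣ ω₂ ∣ → Set
  CountableCofinal z α =
    Countable (_∈ z) × (∀ ξ → ξ ∈ z → ξ < α) × Unbounded z α

  record IsClub (β : ∣ ω₂ ∣) (C : 𝒫 ∣ ω₂ ∣) : Set where
    field
      subset    : ∀ α → α ∈ C → α < β × S²₀ α
      unbounded : Unbounded C β
      closed    : ∀ δ → δ < β → Lim δ → Unbounded C δ → δ ∈ C

  Sequence : Set
  Sequence = ∣ ω₂ ∣ → 𝒫 ∣ ω₂ ∣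

  Increasing : 𝒫 ∣ ω₂ ∣ → Sequence → Set
  Increasing C z = ∀ α α′ → α ∈ C → α′ ∈ C → α < α′ → z α ⊆ z α′

  -- Continuity concerns those α ∈ C for which C ∩ α has limit order type.
  Continuous : 𝒫 ∣ ω₂ ∣ → Sequence → Set
  Continuous C z = ∀ α → α ∈ C →
    (∃ λ ξ → ξ ∈ C × ξ < α) →
    (∀ ξ → ξ ∈ C → ξ < α → ∃ λ η → η ∈ C × ξ < η × η < α) →
    ∀ x → x ∈ z α ⇔ (∃ λ ξ → ξ ∈ C × ξ < α × x ∈ z ξ)

  record CoherentClub⁻ (z : Sequence) (β : ∣ ω₂ ∣) (C : 𝒫 ∣ ω₂ ∣) : Set where
    field
      isClub     : IsClub β C
      orderType  : SameOrderType ω₁ ω₂ U (_∈ C)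
      increasing : Increasing C z
      continuous : Continuous C z

  record CoherentClub (z : Sequence) (f : ∣ ω₂ ∣ → ∣ ω₁ ∣)
                      (β : ∣ ω₂ ∣) (C : 𝒫 ∣ ω₂ ∣) : Set where
    field
      coherent⁻ : CoherentClub⁻ z β C
      -- f α = o.t.(C ∩ α)
      index     : ∀ α → α ∈ C →
        SameOrderType ω₁ ω₂ (λ i → WellOrder._<_ ω₁ i (f α)) ((_∈ C) ∩ (_< α))

  -- z is indexed by S²₀; its values elsewhere are ignored.

  SCP : Set
  SCP = Σ Sequence λ z → Σ (∣ ω₂ ∣ → ∣ ω₁ ∣) λ f →
      (∀ α → S²₀ α → CountableCofinal (z α) α)
    × (∀ β → S²₁ β → ∃ (CoherentClub z f β))

  SCP⁻ : Set
  SCP⁻ = Σ Sequence λ z →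
      (∀ α → S²₀ α → CountableCofinal (z α) α)
    × (∀ β → S²₁ β → ∃ (CoherentClub⁻ z β))

  -- Only z α for α ∈ S²₀, α ≤ β, and f α for α ≤ β belong to the
  -- condition.  Conditions agreeing there are below each other in the
  -- (non-antisymmetric) order _≼_, hence are identified up to equivalence.

  record Condition : Set where
    field
      β        : ∣ ω₂ ∣
      z        : Sequence
      f        : ∣ ω₂ ∣ → ∣ ω₁ ∣
      β∈S²₀    : S²₀ β
      cofinal  : ∀ α → S²₀ α → α ≤ β → CountableCofinal (z α) α
      coherent : ∀ γ → S²₁ γ → γ < β → ∃ (CoherentClub z f γ)

  record Condition⁻ : Set where
    field
      β        : ∣ ω₂ ∣
      z        : Sequence
      β∈S²₀    : S²₀ β
      cofinal  : ∀ α → S²₀ α → α ≤ β → CountableCofinal (z α) α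
      coherent : ∀ γ → S²₁ γ → γ < β → ∃ (CoherentClub⁻ z γ)

  infix 4 _≼_ _≼⁻_

  _≼_ : Rel Condition 0ℓ
  p ≼ q = q.β ≤ p.β
        × (∀ α → S²₀ α → α ≤ q.β → q.z α ≡ p.z α)
        × (∀ α → α ≤ q.β → q.f α ≡ p.f α)
    where
      module p = Condition p
      module q = Condition q

  _≼⁻_ : Rel Condition⁻ 0ℓ
  p ≼⁻ q = q.β ≤ p.β × (∀ α → S²₀ α → α ≤ q.β → q.z α ≡ p.z α)
    where
      module p = Condition⁻ p
      module q = Condition⁻ q

  private
    ≤-trans : ∀ {ξ η ζ} → ξ ≤ η → η ≤ ζ → ξ ≤ ζ
    ≤-trans (inj₁ h)    (inj₁ k)    =
      inj₁ (IsStrictTotalOrder.trans isStrictTotalOrder h k)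
    ≤-trans (inj₁ h)    (inj₂ refl) = inj₁ h
    ≤-trans (inj₂ refl) k           = k

  ≼-refl : ∀ p → p ≼ p
  ≼-refl p = inj₂ refl , (λ _ _ _ → refl) , (λ _ _ → refl)

  ≼-trans : ∀ p q r → p ≼ q → q ≼ r → p ≼ r
  ≼-trans p q r (l , hz , hf) (m , kz , kf) =
      ≤-trans m l
    , (λ α s h → trans (kz α s h) (hz α s (≤-trans h m)))
    , (λ α h → trans (kf α h) (hf α (≤-trans h m)))

  ≼⁻-refl : ∀ p → p ≼⁻ p
  ≼⁻-refl p = inj₂ refl , (λ _ _ _ → refl)

  ≼⁻-trans : ∀ p q r → p ≼⁻ q → q ≼⁻ r → p ≼⁻ r
  ≼⁻-trans p q r (l , hz) (m , kz) =
      ≤-trans m l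
    , (λ α s h → trans (kz α s h) (hz α s (≤-trans h m)))

module _ {X : Set} (_≲_ : Rel X 0ℓ) where

  Below⊤ : Rel (Maybe X) 0ℓ
  Below⊤ _        nothing  = ⊤
  Below⊤ nothing  (just q) = ⊥
  Below⊤ (just p) (just q) = p ≲ q

  withTop : (∀ p → p ≲ p) → (∀ p q r → p ≲ q → q ≲ r → p ≲ r) → Poset
  withTop rfl trn = record
    { Carrier    = Maybe X
    ; _⊑_        = Below⊤
    ; isPreorder = record
        { isEquivalence = isEquivalence
        ; reflexive     = λ { {p} refl → reflexive p }
        ; trans         = λ {p} {q} {r} → transitive p q r
        }
    ; 𝟙          = nothing
    ; 𝟙-greatest = λ _ → tt
    }
    where
      reflexive : ∀ p → Below⊤ p p
      reflexive nothing  = tt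
      reflexive (just p) = rfl p

      transitive : ∀ p q r → Below⊤ p q → Below⊤ q r → Below⊤ p r
      transitive _        _        nothing  _ _ = tt
      transitive (just p) (just q) (just r) h k = trn p q r h k

ℙ-SCP : (ω₁ ω₂ : WellOrder) → Poset
ℙ-SCP ω₁ ω₂ = withTop (_≼_ ω₁ ω₂) (≼-refl ω₁ ω₂) (≼-trans ω₁ ω₂)

ℙ-SCP⁻ : (ω₁ ω₂ : WellOrder) → Poset
ℙ-SCP⁻ ω₁ ω₂ = withTop (_≼⁻_ ω₁ ω₂) (≼⁻-refl ω₁ ω₂) (≼⁻-trans ω₁ ω₂)

{-# OPTIONS --safe #-}

-- SCP ⇒ strategic closure.  Let τ be a winning *-operation.  At β ∈ S²₁ the
-- play survives because II answers each limit turn α by τ (f α) of the set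
-- {a (ξ + 1) | ξ ∈ z α}: along a coherent club C of β these sets form a
-- play of G*.  Limits γ ∈ S²₀ outside such clubs are reached through a
-- tree-like system of ladders: at a non-limit turn α there is at most one
-- finite chain s₀ < … < sₙ = α, and II answers τ n {a s₀, …, a sₙ}; so when γ
-- is the supremum of an infinite chain, the moves of I along it are the
-- first ω turns of a play of G*.
--
-- A strategically closed poset satisfies MA, and MA for ℙ-SCP yields SCP, as
-- the conditions of length ≥ ξ are dense.  ℙ-SCP is *-operationally closed:
-- II answers A by a condition p whose length is the supremum of β q + ω for
-- q ∈ A, and takes for z p (β p) the union of the intervals [β q , β q + ω);
-- the lengths of her answers are then a coherent club of their supremum.  All
-- this applies to SCP⁻, where f is dropped and τ is a *-tactic.

module Submission where

open import Level using (0ℓ)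
open import Data.Bool using (Bool; true; false; T)
open import Data.Empty using (⊥-elim)
open import Data.Maybe using (Maybe; just; nothing)
open import Data.Maybe.Properties using (just-injective)
open import Data.Nat using (ℕ)
import Data.Nat as ℕ
import Data.Nat.Induction as ℕ using (<-wellFounded)
import Data.Nat.Properties as ℕ
open import Data.Product using (Σ; _×_; _,_; ∃; ∃₂; proj₁; proj₂)
open import Data.Product.Relation.Binary.Lex.Strict using (×-Lex; ×-wellFounded)
open import Data.Sum using (_⊎_; inj₁; inj₂; [_,_]′)
open import Data.Unit using (⊤; tt)
open import Axiom.ExcludedMiddle using (ExcludedMiddle)
open import Axiom.Extensionality.Propositional using (Extensionality)
open import Function.Base using (_∘_; id)
open import Function.Bundles using (_⇔_; mk⇔; mk↣; module Equivalence; module Injection)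
open import Induction.WellFounded using (WellFounded; Acc; acc)
open import Relation.Binary.Core using (Rel)
open import Relation.Binary.Definitions using (tri<; tri≈; tri>)
open import Relation.Binary.PropositionalEquality
  using (_≡_; _≢_; refl; sym; trans; cong; cong₂; subst)
open import Relation.Binary.Structures using (IsStrictTotalOrder)
open import Relation.Nullary using (¬_; Dec; yes; no; contradiction)
open import Relation.Nullary.Decidable using (⌊_⌋; toWitness; fromWitness; decidable-stable)
open import Relation.Unary using (Pred; U)

open import Defs
open WellOrder using () renaming (Carrier to ∣_∣)
open Poset using () renaming (Carrier to ⟨_⟩)

-- A turn of the long game lies on many sequences that could be read as plays of G*, but II answers
-- it only once. So each non-limit turn may serve a single chain, which forces unique predecessors,
-- while each γ of cofinality ω still needs a cofinal chain. Both are possible because ω₂ splits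
-- into blocks of length ω₁. An ordinal of the same block is continued from its own place on; an
-- ordinal ξ below the start μ of the block is continued once the image of ξ under an injection of μ
-- into the block has been passed. Each interval [m, m + ω) then has only countably many ordinals to
-- continue, and has room for continuing each of them infinitely often.
--
-- In the game on ℙ-SCP the tails [β q , β q + ω) make the length and the top set of II's answer
-- functions of A alone, increasing and continuous under unions of moves. The turn number enters
-- only through the value of f at the top, so without f the operation is a tactic. That long
-- conditions are dense is itself a consequence of the winning operation: it allows ω₁ many dense
-- requirements to be met below one condition.

-- Coding pairs of natural numbers, and injections

pair : ℕ → ℕ → ℕ
pair ℕ.zero    n = ℕ.suc (2 ℕ.* n)
pair (ℕ.suc m) n = 2 ℕ.* pair m n

-- `pair m n` is `2^m (2 n + 1)`: parity decides whether the exponent is zero, and otherwise a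
-- factor 2 cancels.
pair-injective : ∀ m n m′ n′ → pair m n ≡ pair m′ n′ → m ≡ m′ × n ≡ n′
pair-injective ℕ.zero n ℕ.zero n′ eq =
  refl , ℕ.*-cancelˡ-≡ n n′ 2 (ℕ.suc-injective eq)
pair-injective ℕ.zero n (ℕ.suc m′) n′ eq =
  ⊥-elim (ℕ.even≢odd (pair m′ n′) n (sym eq))
pair-injective (ℕ.suc m) n ℕ.zero n′ eq =
  ⊥-elim (ℕ.even≢odd (pair m n) n′ eq)
pair-injective (ℕ.suc m) n (ℕ.suc m′) n′ eq
  with refl , n≡n′ ← pair-injective m n m′ n′
                       (ℕ.*-cancelˡ-≡ (pair m n) (pair m′ n′) 2 eq)
  = refl , n≡n′

-- With the first component fixed the codes are unbounded, so each first component recurs cofinally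
-- in every interval `[m , m + ω)`; this lets one ordinal be continued infinitely often there.
pair-> : ∀ m n → n ℕ.< pair m n
pair-> ℕ.zero    n = ℕ.s≤s (ℕ.m≤n*m n 2)
pair-> (ℕ.suc m) n = ℕ.≤-trans (pair-> m n) (ℕ.m≤n*m (pair m n) 2)

Injects-⊆ : {X Y : Set} {A B : Pred X 0ℓ} →
            (∀ x → A x → B x) → Injects B Y → Injects A Y
Injects-⊆ A⊆B (e , e-inj) = e , λ x x′ a a′ → e-inj x x′ (A⊆B x a) (A⊆B x′ a′)

Injects-∘ : {X Y Z : Set} {A : Pred X 0ℓ} {B : Pred Y 0ℓ} (g : X → Y) →
            (∀ x → A x → B (g x)) →
            (∀ x x′ → A x → A x′ → g x ≡ g x′ → x ≡ x′) →
            Injects B Z → Injects A Z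
Injects-∘ g g∈B g-inj (e , e-inj) = e ∘ g , λ x x′ a a′ eq →
  g-inj x x′ a a′ (e-inj (g x) (g x′) (g∈B x a) (g∈B x′ a′) eq)

abstract
  ℕ×ℕ-countable : Injects {ℕ × ℕ} U ℕ
  ℕ×ℕ-countable = (λ (m , n) → pair m n) , λ (m , n) (m′ , n′) _ _ eq →
    let m≡m′ , n≡n′ = pair-injective m n m′ n′ eq in cong₂ _,_ m≡m′ n≡n′

-- Classical subsets, well-founded recursion and cardinal arithmetic

module Classical (em : ∀ ℓ → ExcludedMiddle ℓ) (ext : ∀ a b → Extensionality a b) where

  dec : (A : Set) → Dec A
  dec A = em 0ℓ

  dne : {A : Set} → ¬ ¬ A → A
  dne = decidable-stable (dec _)

  ⟦_⟧ : {X : Set} → Pred X 0ℓ → 𝒫 X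
  ⟦ A ⟧ x = ⌊ dec (A x) ⌋

  ∈⁺ : {X : Set} (A : Pred X 0ℓ) {x : X} → A x → x ∈ ⟦ A ⟧
  ∈⁺ A {x} a = fromWitness {a? = dec (A x)} a

  ∈⁻ : {X : Set} (A : Pred X 0ℓ) {x : X} → x ∈ ⟦ A ⟧ → A x
  ∈⁻ A {x} = toWitness {a? = dec (A x)}

  𝒫-ext : {X : Set} {A B : 𝒫 X} → A ⊆ B → B ⊆ A → A ≡ B
  𝒫-ext A⊆B B⊆A = ext 0ℓ 0ℓ λ x → T-ext _ _ (A⊆B x) (B⊆A x)
    where
    T-ext : (a b : Bool) → (T a → T b) → (T b → T a) → a ≡ b
    T-ext false false _ _ = refl
    T-ext false true  _ g = ⊥-elim (g tt)
    T-ext true  false f _ = ⊥-elim (f tt)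
    T-ext true  true  _ _ = refl

  ⟦⟧-cong : {X : Set} {A B : Pred X 0ℓ} →
            (∀ x → A x → B x) → (∀ x → B x → A x) → ⟦ A ⟧ ≡ ⟦ B ⟧
  ⟦⟧-cong {A = A} {B} A⊆B B⊆A =
    𝒫-ext (λ x a → ∈⁺ B (A⊆B x (∈⁻ A a))) (λ x b → ∈⁺ A (B⊆A x (∈⁻ B b)))

  module WfRecursion {V X : Set} {_<_ : Rel V 0ℓ} (wf : WellFounded _<_) (x₀ : X)
                     (F : V → (V → X) → X) where
    private
      -- `F` receives a total function, equal to `x₀` off the predecessors of `v`, so that step
      -- functions carry no proofs of `u < v` and cannot see later values.
      extend : (v : V) → (∀ u → u < v → X) → V → X
      extend v ih u with dec (u < v)
      ... | yes u<v = ih u u<v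
      ... | no _    = x₀

      rec-acc : ∀ v → Acc _<_ v → X
      rec-acc v (acc rs) = F v (extend v λ u u<v → rec-acc u (rs u<v))

      rec-acc-irrelevant : ∀ v (p q : Acc _<_ v) → rec-acc v p ≡ rec-acc v q
      rec-acc-irrelevant v (acc rs) (acc rs′) =
        cong (F v ∘ extend v) (ext 0ℓ 0ℓ λ u → ext 0ℓ 0ℓ λ u<v →
          rec-acc-irrelevant u (rs u<v) (rs′ u<v))

    rec : V → X
    rec v = rec-acc v (wf v)

    -- rec restricted to the predecessors of v
    cut : V → V → X
    cut v = extend v λ u _ → rec u

    cut-≡ : ∀ {u v} → u < v → cut v u ≡ rec u
    cut-≡ {u} {v} u<v with dec (u < v)
    ... | yes _   = refl
    ... | no u≮v  = contradiction u<v u≮v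

    unfold : ∀ v → rec v ≡ F v (cut v)
    unfold v with wf v
    ... | acc rs = cong (F v ∘ extend v) (ext 0ℓ 0ℓ λ u → ext 0ℓ 0ℓ λ u<v →
                     rec-acc-irrelevant u (rs u<v) (wf u))

  private
    FreshValue : {V X : Set} → Rel V 0ℓ → Pred X 0ℓ → V → (V → X) → X → Set
    FreshValue _<_ B v ih x = B x × (∀ u → u < v → ih u ≢ x)

  abstract
    -- `R` may relate `x` to many `y`; one of them is projected from `total`. As no `y` is shared by
    -- two elements of `A`, the choice is injective. `z₀` is the value off `A`.
    Injects-choice : {X Y Z : Set} {A : Pred X 0ℓ} {B : Pred Y 0ℓ} → Z →
                     (R : X → Y → Set) →
                     (∀ x → A x → ∃ λ y → B y × R x y) →
                     (∀ x x′ y → A x → A x′ → R x y → R x′ y → x ≡ x′) →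
                     Injects B Z → Injects A Z
    Injects-choice {X} {Y} {Z} {A} {B} z₀ R total functional (e , e-inj) = g , g-inj
      where
      g′ : ∀ x → Dec (A x) → Z
      g′ x (yes a) = e (proj₁ (total x a))
      g′ x (no _)  = z₀

      g : X → Z
      g x = g′ x (dec (A x))

      g-inj : ∀ x x′ → A x → A x′ → g x ≡ g x′ → x ≡ x′
      g-inj x x′ a a′ eq with dec (A x) | dec (A x′)
      ... | no ¬a  | _       = contradiction a ¬a
      ... | yes _  | no ¬a′  = contradiction a′ ¬a′
      ... | yes a₁ | yes a₁′ =
        let y , b , r = total x a₁ ; y′ , b′ , r′ = total x′ a₁′
        in functional x x′ y a a′ r (subst (R x′) (sym (e-inj y y′ b b′ eq)) r′)

    -- An element lying in several `A i` has several codes, each made of a code of `i` and a code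
    -- within `A i`; `R` admits them all and `Injects-choice` keeps one.
    Injects-⋃ : {I X K : Set} {J : Pred I 0ℓ} {A : I → Pred X 0ℓ} →
                K → Injects {K × K} U K →
                Injects J K → (∀ i → J i → Injects (A i) K) →
                Injects (λ x → ∃ λ i → J i × A i x) K
    Injects-⋃ {I} {X} {K} {J} {A} k₀ pairing (e , e-inj) inj =
      Injects-choice {B = U} k₀ R
        (λ x (i , j , a) → (e i , g i x) , tt , i , j , a , refl)
        (λ where
          x x′ _ _ _ (i , j , a , refl) (i′ , j′ , a′ , eq) → inj-R x x′ i i′ j j′ a a′ eq)
        pairing
      where
      inj′ : ∀ i → Injects (λ x → J i × A i x) K
      inj′ i with dec (J i)
      ... | yes j = Injects-⊆ (λ _ → proj₂) (inj i j)
      ... | no ¬j = (λ _ → k₀) , λ _ _ (j , _) → contradiction j ¬j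

      g : I → X → K
      g i = proj₁ (inj′ i)

      R : X → K × K → Set
      R x k = ∃ λ i → J i × A i x × k ≡ (e i , g i x)

      inj-R : ∀ x x′ i i′ → J i → J i′ → A i x → A i′ x′ →
              (e i , g i x) ≡ (e i′ , g i′ x′) → x ≡ x′
      inj-R x x′ i i′ j j′ a a′ eq with e-inj i i′ j j′ (cong proj₁ eq)
      ... | refl = proj₂ (inj′ i) x x′ (j , a) (j , a′) (cong proj₂ eq)

    -- Each `v` takes an element of `B` that is not yet taken. Were none left, sending every element
    -- of `B` to a stage that took it would inject `B` below `v`, against `large`.
    greedy-injection : {V X : Set} {_<_ : Rel V 0ℓ} → WellFounded _<_ →
      (∀ u v → u ≢ v → u < v ⊎ v < u) → (B : Pred X 0ℓ) → ∃ B →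
      (∀ v → ¬ Σ (X → V) λ h →
        (∀ x → B x → h x < v) × (∀ x x′ → B x → B x′ → h x ≡ h x′ → x ≡ x′)) →
      Σ (V → X) λ g → (∀ v → B (g v)) × (∀ u v → g u ≡ g v → u ≡ v)
    greedy-injection {V} {X} {_<_} wf connected B (x₀ , _) large =
      g , (λ v → proj₁ (g-new v)) , g-inj
      where
      new : ∀ v ih → ∃ (FreshValue _<_ B v ih)
      new v ih = dne λ ∄x → large v (h ∄x , (λ x b → proj₁ (spec ∄x x b)) ,
        λ x x′ b b′ eq → trans (sym (proj₂ (spec ∄x x b)))
                           (trans (cong ih eq) (proj₂ (spec ∄x x′ b′))))
        where
        module _ (∄x : ¬ ∃ (FreshValue _<_ B v ih)) where
          hit : ∀ x → B x → ∃ λ u → u < v × ih u ≡ x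
          hit x b = dne λ ¬hit → ∄x (x , b , λ u u<v eq → ¬hit (u , u<v , eq))

          h′ : ∀ x → Dec (B x) → V
          h′ x (yes b) = proj₁ (hit x b)
          h′ x (no _)  = v

          h : X → V
          h x = h′ x (dec (B x))

          spec : ∀ x → B x → h x < v × ih (h x) ≡ x
          spec x b with dec (B x)
          ... | yes b′ = proj₂ (hit x b′)
          ... | no ¬b  = contradiction b ¬b

      open WfRecursion wf x₀ (λ v ih → proj₁ (new v ih)) renaming (rec to g)

      g-new : ∀ v → FreshValue _<_ B v g (g v)
      g-new v with b , fresh ← subst (FreshValue _<_ B v (cut v)) (sym (unfold v)) (proj₂ (new v (cut v)))
        = b , λ u u<v eq → fresh u u<v (trans (cut-≡ u<v) eq)

      g-inj : ∀ u v → g u ≡ g v → u ≡ v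
      g-inj u v eq with dec (u ≡ v)
      ... | yes u≡v = u≡v
      ... | no u≢v with connected u v u≢v
      ... | inj₁ u<v = ⊥-elim (proj₂ (g-new v) u u<v eq)
      ... | inj₂ v<u = ⊥-elim (proj₂ (g-new u) v v<u (sym eq))

  module Order (W : WellOrder) where
    open WellOrder W public
    open IsStrictTotalOrder isStrictTotalOrder public
      using (compare) renaming (trans to <-trans)

    wf-induction : (P : Pred ∣ W ∣ 0ℓ) → (∀ x → (∀ y → y < x → P y) → P x) → ∀ x → P x
    wf-induction P step x = go x (wellFounded x)
      where
      go : ∀ x → Acc _<_ x → P x
      go x (acc rs) = step x λ y y<x → go y (rs y<x)

    <-irrefl : ∀ {x} → ¬ x < x
    <-irrefl = IsStrictTotalOrder.irrefl isStrictTotalOrder refl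

    ≤-refl : ∀ {x} → x ≤ x
    ≤-refl = inj₂ refl

    <-≤-trans : ∀ {x y z} → x < y → y ≤ z → x < z
    <-≤-trans x<y (inj₁ y<z)  = <-trans x<y y<z
    <-≤-trans x<y (inj₂ refl) = x<y

    ≤-<-trans : ∀ {x y z} → x ≤ y → y < z → x < z
    ≤-<-trans (inj₁ x<y)  y<z = <-trans x<y y<z
    ≤-<-trans (inj₂ refl) y<z = y<z

    ≤-trans : ∀ {x y z} → x ≤ y → y ≤ z → x ≤ z
    ≤-trans x≤y (inj₁ y<z)  = inj₁ (≤-<-trans x≤y y<z)
    ≤-trans x≤y (inj₂ refl) = x≤y

    ≤⇒≯ : ∀ {x y} → x ≤ y → ¬ y < x
    ≤⇒≯ x≤y y<x = <-irrefl (≤-<-trans x≤y y<x)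

    ≤-antisym : ∀ {x y} → x ≤ y → y ≤ x → x ≡ y
    ≤-antisym (inj₂ x≡y) _   = x≡y
    ≤-antisym (inj₁ x<y) y≤x = contradiction x<y (≤⇒≯ y≤x)

    <-or-≥ : ∀ x y → x < y ⊎ y ≤ x
    <-or-≥ x y with compare x y
    ... | tri< x<y _ _ = inj₁ x<y
    ... | tri≈ _ x≡y _ = inj₂ (inj₂ (sym x≡y))
    ... | tri> _ _ y<x = inj₂ (inj₁ y<x)

    ≤-Lim⇒< : ∀ {x y} → ¬ Lim x → Lim y → x ≤ y → x < y
    ≤-Lim⇒< ¬lim lim (inj₁ x<y)  = x<y
    ≤-Lim⇒< ¬lim lim (inj₂ refl) = contradiction lim ¬lim

    ≮⇒≥ : ∀ {x y} → ¬ x < y → y ≤ x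
    ≮⇒≥ {x} {y} x≮y = [ (λ x<y → contradiction x<y x≮y) , id ]′ (<-or-≥ x y)

    <-connected : ∀ x y → x ≢ y → x < y ⊎ y < x
    <-connected x y x≢y with compare x y
    ... | tri< x<y _ _ = inj₁ x<y
    ... | tri≈ _ x≡y _ = contradiction x≡y x≢y
    ... | tri> _ _ y<x = inj₂ y<x

    abstract
      upper-bound : ∀ x y → ∃ λ z → x ≤ z × y ≤ z × (z ≡ x ⊎ z ≡ y)
      upper-bound x y with <-or-≥ x y
      ... | inj₁ x<y = y , inj₁ x<y , ≤-refl , inj₂ refl
      ... | inj₂ y≤x = x , ≤-refl , y≤x , inj₁ refl

    abstract
      least : (P : Pred ∣ W ∣ 0ℓ) → ∃ P → ∃ λ x → P x × (∀ y → P y → x ≤ y)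
      least P (x , p) = dne λ ∄least → wf-induction (λ x → ¬ P x)
        (λ x ih p → ∄least (x , p , λ y q → ≮⇒≥ λ y<x → ih y y<x q)) x p

  -- L = K⁺ for an infinite set K.
  module CardinalSuccessor (K : Set) (pairing : Injects {K × K} U K)
    {k₀ k₁ : K} (k₀≢k₁ : k₀ ≢ k₁) (L : WellOrder)
    (large : ¬ Injects {∣ L ∣} U K)
    (small : ∀ γ → Injects (λ ξ → WellOrder._<_ L ξ γ) K) where

    open Order L public

    inhabited : ∣ L ∣
    inhabited = dne λ empty →
      large ((λ x → ⊥-elim (empty x)) , λ x → ⊥-elim (empty x))

    abstract
      -- If `x` were the maximum, `L` would be the segment below `x` plus one point; this injects
      -- into `K × K`, the second coordinate `k₀` or `k₁` telling the two pieces apart.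
      no-maximum : ∀ x → ∃ (x <_)
      no-maximum x = dne λ x-max → large (Injects-choice {B = U} k₀
        (λ y k → (y < x × k ≡ (proj₁ (small x) y , k₀)) ⊎ (y ≡ x × k ≡ (k₀ , k₁)))
        (λ y _ → total y (≮⇒≥ λ x<y → x-max (y , x<y)))
        (λ where
          y y′ _ _ _ (inj₁ (y<x , refl)) (inj₁ (y′<x , eq)) →
            proj₂ (small x) y y′ y<x y′<x (cong proj₁ eq)
          _ _ _ _ _ (inj₁ (_ , refl)) (inj₂ (_ , eq)) → contradiction (cong proj₂ eq) k₀≢k₁
          _ _ _ _ _ (inj₂ (_ , refl)) (inj₁ (_ , eq)) → contradiction (sym (cong proj₂ eq)) k₀≢k₁
          _ _ _ _ _ (inj₂ (refl , _)) (inj₂ (refl , _)) → refl)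
        pairing)
        where
        total : ∀ y → y ≤ x → ∃ λ k → ⊤ ×
          ((y < x × k ≡ (proj₁ (small x) y , k₀)) ⊎ (y ≡ x × k ≡ (k₀ , k₁)))
        total y (inj₁ y<x)  = _ , tt , inj₁ (y<x , refl)
        total y (inj₂ y≡x) = _ , tt , inj₂ (y≡x , refl)

    abstract
      suc : ∣ L ∣ → ∣ L ∣
      suc x = proj₁ (least (x <_) (no-maximum x))

      <suc : ∀ {x} → x < suc x
      <suc {x} = proj₁ (proj₂ (least (x <_) (no-maximum x)))

      suc-least : ∀ {x y} → x < y → suc x ≤ y
      suc-least {x} {y} = proj₂ (proj₂ (least (x <_) (no-maximum x))) y

    <suc⇒≤ : ∀ {x y} → y < suc x → y ≤ x
    <suc⇒≤ y<sx = ≮⇒≥ λ x<y → ≤⇒≯ (suc-least x<y) y<sx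

    suc-injective : ∀ {x y} → suc x ≡ suc y → x ≡ y
    suc-injective {x} {y} eq = ≤-antisym
      (<suc⇒≤ (subst (x <_) eq <suc)) (<suc⇒≤ (subst (y <_) (sym eq) <suc))

    abstract
      -- Regularity of `K⁺`: if the values `g x` were unbounded, the segments below `suc (g x)`
      -- would cover `L`, a union of at most `K` many sets that each inject into `K`.
      bounded : {X : Set} {A : Pred X 0ℓ} → Injects A K → (g : X → ∣ L ∣) →
                ∃ λ b → ∀ x → A x → g x < b
      bounded {A = A} inj g = dne λ ∄b → large (Injects-⊆
        (λ y _ → dne λ y-bounds → ∄b (y , λ x a → dne λ gx≮y →
          y-bounds (x , a , ≤-<-trans (≮⇒≥ gx≮y) <suc)))
        (Injects-⋃ k₀ pairing inj (λ x _ → small (suc (g x)))))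

    module _ {X : Set} {A : Pred X 0ℓ} (inj : Injects A K) (g : X → ∣ L ∣) where
      private
        least-bound = least (λ b → ∀ x → A x → g x < b) (bounded inj g)

      abstract
        sup : ∣ L ∣
        sup = proj₁ least-bound

        <sup : ∀ x → A x → g x < sup
        <sup = proj₁ (proj₂ least-bound)

        sup-least : ∀ b → (∀ x → A x → g x < b) → sup ≤ b
        sup-least = proj₂ (proj₂ least-bound)

      <sup⇒≤ : ∀ {b} → b < sup → ∃ λ x → A x × b ≤ g x
      <sup⇒≤ {b} b<sup = dne λ ∄x → ≤⇒≯
        (sup-least b (λ x a → dne λ gx≮b → ∄x (x , a , ≮⇒≥ gx≮b))) b<sup

    abstract
      zero : ∣ L ∣
      zero = proj₁ (least U (inhabited , tt))

      zero-≤ : ∀ {x} → zero ≤ x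
      zero-≤ {x} = proj₂ (proj₂ (least U (inhabited , tt))) x tt

    iter : ℕ → ∣ L ∣ → ∣ L ∣
    iter ℕ.zero    x = x
    iter (ℕ.suc n) x = suc (iter n x)

    ≤-iter : ∀ n {x} → x ≤ iter n x
    ≤-iter ℕ.zero    = ≤-refl
    ≤-iter (ℕ.suc n) = inj₁ (≤-<-trans (≤-iter n) <suc)

    iter-mono-< : ∀ {m n} x → m ℕ.< n → iter m x < iter n x
    iter-mono-< {m} {ℕ.suc n} x (ℕ.s≤s m≤n) with ℕ.m≤n⇒m<n∨m≡n m≤n
    ... | inj₁ m<n  = <-trans (iter-mono-< x m<n) <suc
    ... | inj₂ refl = <suc

    iter-mono-≤ : ∀ {m n} x → m ℕ.≤ n → iter m x ≤ iter n x
    iter-mono-≤ x m≤n with ℕ.m≤n⇒m<n∨m≡n m≤n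
    ... | inj₁ m<n  = inj₁ (iter-mono-< x m<n)
    ... | inj₂ refl = ≤-refl

    iter-reflect-≤ : ∀ {m n} x → iter m x ≤ iter n x → m ℕ.≤ n
    iter-reflect-≤ x h = ℕ.≮⇒≥ λ n<m → ≤⇒≯ h (iter-mono-< x n<m)

    ¬Lim-zero : ¬ Lim zero
    ¬Lim-zero ((x , x<0) , _) = ≤⇒≯ zero-≤ x<0

    ¬Lim-suc : ∀ {x} → ¬ Lim (suc x)
    ¬Lim-suc {x} (_ , dense) =
      let y , x<y , y<sx = dense x <suc in ≤⇒≯ (suc-least x<y) y<sx

    Lim-suc : ∀ {x y} → Lim y → x < y → suc x < y
    Lim-suc {x} (_ , dense) x<y =
      let z , x<z , z<y = dense x x<y in ≤-<-trans (suc-least x<z) z<y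

    Lim-iter : ∀ n {x y} → Lim y → x < y → iter n x < y
    Lim-iter ℕ.zero    y-lim x<y = x<y
    Lim-iter (ℕ.suc n) y-lim x<y = Lim-suc y-lim (Lim-iter n y-lim x<y)

    suc-IsSuccessorOf : ∀ {x} → suc x IsSuccessorOf x
    suc-IsSuccessorOf = <suc , λ y → suc-least

    IsSuccessorOf⇒≡ : ∀ {x y} → y IsSuccessorOf x → y ≡ suc x
    IsSuccessorOf⇒≡ (x<y , y-least) = ≤-antisym (y-least _ <suc) (suc-least x<y)

    data Kind : ∣ L ∣ → Set where
      is-zero : Kind zero
      is-suc  : ∀ x → Kind (suc x)
      is-lim  : ∀ {x} → Lim x → Kind x

    kind : ∀ x → Kind x
    kind x with dec (x ≡ zero)
    ... | yes refl = is-zero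
    ... | no x≢0 with dec (∃ λ y → x ≡ suc y)
    ...   | yes (y , refl) = is-suc y
    ...   | no x≢suc = is-lim ((zero , 0<x) , λ y y<x → suc y , <suc , suc< y y<x)
      where
      0<x : zero < x
      0<x = [ id , (λ eq → contradiction (sym eq) x≢0) ]′ zero-≤

      suc< : ∀ y → y < x → suc y < x
      suc< y y<x = [ id , (λ eq → contradiction (y , sym eq) x≢suc) ]′ (suc-least y<x)

-- The ordinals below ω₂ and their cofinalities

module Ordinals (em : ∀ ℓ → ExcludedMiddle ℓ) (ext : ∀ a b → Extensionality a b)
                (ω₁ ω₂ : WellOrder)
                (ω₁-succ : IsCardinalSuccessor ω ω₁)
                (ω₂-succ : IsCardinalSuccessor ω₁ ω₂) where

  open Classical em ext

  module O₁ = CardinalSuccessor ℕ ℕ×ℕ-countable {0} {1} (λ ()) ω₁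
                (proj₁ ω₁-succ) (proj₂ ω₁-succ)

  ν : ℕ → ∣ ω₁ ∣
  ν n = O₁.iter n O₁.zero

  ¬Lim-ν : ∀ n → ¬ O₁.Lim (ν n)
  ¬Lim-ν ℕ.zero    = O₁.¬Lim-zero
  ¬Lim-ν (ℕ.suc n) = O₁.¬Lim-suc

  ν-injective : ∀ {m n} → ν m ≡ ν n → m ≡ n
  ν-injective eq = ℕ.≤-antisym (O₁.iter-reflect-≤ O₁.zero (inj₂ eq))
                               (O₁.iter-reflect-≤ O₁.zero (inj₂ (sym eq)))

  ≤ν⇒ν : ∀ n {i} → i O₁.≤ ν n → ∃ λ m → m ℕ.≤ n × i ≡ ν m
  ≤ν⇒ν ℕ.zero    i≤0 = 0 , ℕ.z≤n , O₁.≤-antisym i≤0 O₁.zero-≤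
  ≤ν⇒ν (ℕ.suc n) (inj₂ i≡) = ℕ.suc n , ℕ.≤-refl , i≡
  ≤ν⇒ν (ℕ.suc n) (inj₁ i<) with m , m≤n , i≡ ← ≤ν⇒ν n (O₁.<suc⇒≤ i<)
    = m , ℕ.m≤n⇒m≤1+n m≤n , i≡

  private
    _<ₗ_ : Rel (∣ ω₁ ∣ × ℕ) 0ℓ
    _<ₗ_ = ×-Lex _≡_ O₁._<_ ℕ._<_

    <ₗ-connected : ∀ u v → u ≢ v → u <ₗ v ⊎ v <ₗ u
    <ₗ-connected (i , m) (j , n) ≢ with O₁.compare i j | ℕ.<-cmp m n
    ... | tri< i<j _ _  | _               = inj₁ (inj₁ i<j)
    ... | tri> _ _ j<i  | _               = inj₂ (inj₁ j<i)
    ... | tri≈ _ refl _ | tri< m<n _ _    = inj₁ (inj₂ (refl , m<n))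
    ... | tri≈ _ refl _ | tri≈ _ refl _   = contradiction refl ≢
    ... | tri≈ _ refl _ | tri> _ _ n<m    = inj₂ (inj₂ (refl , n<m))

    -- In the lexicographic order the predecessors of `(i , n)` lie in `(i + 1) × ℕ`, which is
    -- countable, so the greedy choice of values in the uncountable `ω₁` never gets stuck.
    ω₁×ℕ↣ω₁ : Σ (∣ ω₁ ∣ × ℕ → ∣ ω₁ ∣) λ g →
              (∀ v → U (g v)) × (∀ u v → g u ≡ g v → u ≡ v)
    ω₁×ℕ↣ω₁ = greedy-injection (×-wellFounded O₁.wellFounded ℕ.<-wellFounded)
      <ₗ-connected U (O₁.zero , tt) λ (i , n) (h , h< , h-inj) →
        proj₁ ω₁-succ (Injects-∘ {B = λ (j , _) → j O₁.< O₁.suc i} h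
          (λ x _ → below i n (h x) (h< x tt)) h-inj
          (Injects-∘ {B = U} (λ (j , m) → proj₁ (proj₂ ω₁-succ (O₁.suc i)) j , m) _
            (λ (j , m) (j′ , m′) j< j′< eq → cong₂ _,_
              (proj₂ (proj₂ ω₁-succ (O₁.suc i)) j j′ j< j′< (cong proj₁ eq))
              (cong proj₂ eq))
            ℕ×ℕ-countable))
      where
      below : ∀ i n v → v <ₗ (i , n) → proj₁ v O₁.< O₁.suc i
      below i n v (inj₁ j<i)        = O₁.<-trans j<i O₁.<suc
      below i n v (inj₂ (refl , _)) = O₁.<suc

  -- A pair of ordinals is coded by its maximum m and two natural numbers
  -- indexing its entries in an enumeration of m + 1.
  abstract
    ω₁×ω₁↣ω₁ : Injects {∣ ω₁ ∣ × ∣ ω₁ ∣} U ∣ ω₁ ∣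
    ω₁×ω₁↣ω₁ = code , λ (i , j) (i′ , j′) _ _ eq → decode i j i′ j′ (proj₂ (proj₂ ω₁×ℕ↣ω₁) _ _ eq)
      where
      max : ∣ ω₁ ∣ → ∣ ω₁ ∣ → ∣ ω₁ ∣
      max i j = proj₁ (O₁.upper-bound i j)

      e : ∣ ω₁ ∣ → ∣ ω₁ ∣ → ℕ
      e m = proj₁ (proj₂ ω₁-succ (O₁.suc m))

      e-injective : ∀ m i j → i O₁.≤ m → j O₁.≤ m → e m i ≡ e m j → i ≡ j
      e-injective m i j i≤m j≤m =
        proj₂ (proj₂ ω₁-succ (O₁.suc m)) i j (O₁.≤-<-trans i≤m O₁.<suc) (O₁.≤-<-trans j≤m O₁.<suc)

      code′ : ∣ ω₁ ∣ × ∣ ω₁ ∣ → ∣ ω₁ ∣ × ℕ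
      code′ (i , j) = max i j , pair (e (max i j) i) (e (max i j) j)

      code : ∣ ω₁ ∣ × ∣ ω₁ ∣ → ∣ ω₁ ∣
      code p = proj₁ ω₁×ℕ↣ω₁ (code′ p)

      decode : ∀ i j i′ j′ → code′ (i , j) ≡ code′ (i′ , j′) → (i , j) ≡ (i′ , j′)
      decode i j i′ j′ eq
        with O₁.upper-bound i j | O₁.upper-bound i′ j′
      ... | m , i≤m , j≤m , _ | m′ , i′≤m′ , j′≤m′ , _
        with refl ← cong proj₁ eq
        with eqᵢ , eqⱼ ← pair-injective _ _ _ _ (cong proj₂ eq)
        = cong₂ _,_ (e-injective m i i′ i≤m i′≤m′ eqᵢ) (e-injective m j j′ j≤m j′≤m′ eqⱼ)

  abstract
    O₁-zero≢one : O₁.zero ≢ O₁.suc O₁.zero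
    O₁-zero≢one eq = O₁.<-irrefl (subst (O₁.zero O₁.<_) (sym eq) O₁.<suc)

  module O₂ = CardinalSuccessor ∣ ω₁ ∣ ω₁×ω₁↣ω₁ {O₁.zero} {O₁.suc O₁.zero}
                O₁-zero≢one
                ω₂ (proj₁ ω₂-succ) (proj₂ ω₂-succ)

  ℕ↣ω₁ : Injects {ℕ} U ∣ ω₁ ∣
  ℕ↣ω₁ = ν , λ _ _ _ _ → ν-injective

  Countable⇒small : {X : Set} {A : Pred X 0ℓ} → Countable A → Injects A ∣ ω₁ ∣
  Countable⇒small (e , e-inj) = Injects-∘ e _ e-inj ℕ↣ω₁

  abstract
    Countable-⋃ : {I X : Set} {J : Pred I 0ℓ} {A : I → Pred X 0ℓ} → Countable J →
                  (∀ i → J i → Countable (A i)) → Countable (λ x → ∃ λ i → J i × A i x)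
    Countable-⋃ = Injects-⋃ 0 ℕ×ℕ-countable

  Countable-ℕ : Countable {ℕ} U
  Countable-ℕ = id , λ _ _ _ _ → id

  abstract
    Countable-image : {X Y : Set} {A : Pred X 0ℓ} (g : X → Y) → Countable A →
                      Countable (λ y → ∃ λ x → A x × y ≡ g x)
    Countable-image g A-ctble = Countable-⋃ A-ctble λ x _ →
      (λ _ → 0) , λ where _ _ refl refl _ → refl

    Countable-∪ : {X : Set} {A B : Pred X 0ℓ} → Countable A → Countable B →
                  Countable (λ x → A x ⊎ B x)
    Countable-∪ {X} {A} {B} A-ctble B-ctble = Injects-⊆
      (λ where
        x (inj₁ a) → 0 , tt , a
        x (inj₂ b) → 1 , tt , b)
      (Countable-⋃ {J = U} {A = piece} Countable-ℕ λ where
        ℕ.zero    _ → A-ctble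
        (ℕ.suc _) _ → B-ctble)
      where
      piece : ℕ → Pred X 0ℓ
      piece ℕ.zero    = A
      piece (ℕ.suc _) = B

  -- next x = x + ω
  abstract
    next : ∣ ω₂ ∣ → ∣ ω₂ ∣
    next x = O₂.sup ℕ↣ω₁ (λ n → O₂.iter n x)

    iter<next : ∀ n {x} → O₂.iter n x O₂.< next x
    iter<next n = O₂.<sup ℕ↣ω₁ _ n tt

    <next : ∀ {x} → x O₂.< next x
    <next = iter<next 0

    <next⇒≤iter : ∀ {x y} → y O₂.< next x → ∃ λ n → y O₂.≤ O₂.iter n x
    <next⇒≤iter y< = let n , _ , y≤ = O₂.<sup⇒≤ ℕ↣ω₁ _ y< in n , y≤

    Lim-next : ∀ {x} → O₂.Lim (next x)
    Lim-next {x} = (x , <next) , λ y y< → let n , y≤ = <next⇒≤iter y< in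
      O₂.iter (ℕ.suc n) x , O₂.≤-<-trans y≤ O₂.<suc , iter<next (ℕ.suc n)

    next-least : ∀ {x y} → O₂.Lim y → x O₂.< y → next x O₂.≤ y
    next-least y-lim x<y = O₂.sup-least ℕ↣ω₁ _ _ λ n _ → O₂.Lim-iter n y-lim x<y

  -- There is no limit strictly between `x` and `x + ω`. Hence a condition lengthened by ω has new
  -- obligations only at its top.
  Lim-<next⇒≤ : ∀ {x y} → O₂.Lim y → y O₂.< next x → y O₂.≤ x
  Lim-<next⇒≤ y-lim y<next = O₂.≮⇒≥ λ x<y → O₂.≤⇒≯ (next-least y-lim x<y) y<next

  S₀ S₁ : Pred ∣ ω₂ ∣ 0ℓ
  S₀ = S²₀ ω₁ ω₂
  S₁ = S²₁ ω₁ ω₂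

  private
    -- If some `ξ` were greatest below `α`, the constant map with value `ξ` on the nonempty segment
    -- below `δ` would be cofinal, against the minimality of `D`.
    cofinality⇒Lim : ∀ D {i δ} → WellOrder._<_ D i δ →
                     ∀ {α} → HasCofinality ω₂ D α → O₂.Lim α
    cofinality⇒Lim D {i} {δ} i<δ {α} ((g , g< , _) , minimal) =
      (g i , g< i tt) , λ ξ ξ<α → dne λ ξ-max → minimal δ
        ((λ _ → ξ) , (λ _ _ → ξ<α) ,
          λ η η<α → i , i<δ , O₂.≮⇒≥ λ ξ<η → ξ-max (η , ξ<η , η<α))

  S₀⇒Lim : ∀ {α} → S₀ α → O₂.Lim α
  S₀⇒Lim = cofinality⇒Lim ω {0} {1} ℕ.≤-refl

  S₁⇒Lim : ∀ {α} → S₁ α → O₂.Lim α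
  S₁⇒Lim = cofinality⇒Lim ω₁ {O₁.zero} O₁.<suc

  abstract
    Injects⇒enumeration : {X Y : Set} {A : Pred X 0ℓ} → ∃ A → Injects A Y →
      Σ (Y → X) λ g → (∀ y → A (g y)) × (∀ x → A x → ∃ λ y → g y ≡ x)
    Injects⇒enumeration {X} {Y} {A} (x₀ , a₀) (e , e-inj) =
      (λ y → proj₁ (pick y)) , (λ y → proj₁ (proj₂ (pick y))) ,
      λ x a → e x , e-inj _ _ (proj₁ (proj₂ (pick (e x)))) a (proj₂ (proj₂ (pick (e x))) (x , a , refl))
      where
      pick : ∀ y → ∃ λ x → A x × ((∃ λ x′ → A x′ × e x′ ≡ y) → e x ≡ y)
      pick y with dec (∃ λ x → A x × e x ≡ y)
      ... | yes (x , a , eq) = x , a , λ _ → eq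
      ... | no ∄x            = x₀ , a₀ , λ ∃x → contradiction ∃x ∄x

  private
    finite-bounded : ∀ {γ} → O₂.Lim γ → (h : ℕ → ∣ ω₂ ∣) → ∀ n →
                     (∀ i → i ℕ.< n → h i O₂.< γ) →
                     ∃ λ b → b O₂.< γ × (∀ i → i ℕ.< n → h i O₂.< b)
    finite-bounded ((b , b<γ) , _) h ℕ.zero _ = b , b<γ , λ _ ()
    finite-bounded γ-lim h (ℕ.suc n) h<
      with b , b<γ , <b ← finite-bounded γ-lim h n (λ i i<n → h< i (ℕ.m<n⇒m<1+n i<n))
      with m , b≤m , hn≤m , m≡ ← O₂.upper-bound b (h n)
      = O₂.suc m
      , O₂.Lim-suc γ-lim ([ (λ { refl → b<γ }) , (λ { refl → h< n ℕ.≤-refl }) ]′ m≡)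
      , λ i i<1+n → O₂.≤-<-trans (below i (ℕ.m≤n⇒m<n∨m≡n (ℕ.≤-pred i<1+n))) O₂.<suc
      where
      below : ∀ i → i ℕ.< n ⊎ i ≡ n → h i O₂.≤ m
      below i (inj₁ i<n)  = O₂.≤-trans (inj₁ (<b i i<n)) b≤m
      below i (inj₂ refl) = hn≤m

  abstract
    -- An enumeration of `A` is a cofinal map from ω, and no finite `n` can replace ω, since
    -- finitely many ordinals below a limit are bounded below it.
    S₀-intro : ∀ {γ} → O₂.Lim γ → {A : Pred ∣ ω₂ ∣ 0ℓ} → Countable A →
               (∀ x → A x → x O₂.< γ) → (∀ ξ → ξ O₂.< γ → ∃ λ x → A x × ξ O₂.≤ x) → S₀ γ
    S₀-intro γ-lim@((x₀ , x₀<γ) , _) A-ctble A< A-unb =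
        (let g , g∈A , g-onto = Injects⇒enumeration (let x , a , _ = A-unb x₀ x₀<γ in x , a) A-ctble
         in g , (λ i _ → A< (g i) (g∈A i)) , λ ξ ξ<γ →
              let x , a , ξ≤x = A-unb ξ ξ<γ ; i , eq = g-onto x a
              in i , tt , subst (ξ O₂.≤_) (sym eq) ξ≤x)
      , λ n (h , h< , h-unb) →
          let b , b<γ , <b = finite-bounded γ-lim h n h<
              i , i<n , b≤hi = h-unb b b<γ
          in O₂.≤⇒≯ b≤hi (<b i i<n)

  S₀-next : ∀ {x} → S₀ (next x)
  S₀-next {x} = S₀-intro Lim-next
    (Countable-image {A = U} (λ n → O₂.iter n x) Countable-ℕ)
    (λ where _ (n , _ , refl) → iter<next n)
    λ ξ ξ< → let n , ξ≤ = <next⇒≤iter ξ< in O₂.iter n x , (n , tt , refl) , ξ≤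

  -- The supremum of the `ν n` is ω as an element of `ω₁`. A cofinal ω-sequence, moved to the
  -- segment below it, contradicts the minimality of `ω₁`.
  S₀-S₁-disjoint : ∀ {γ} → S₀ γ → ¬ S₁ γ
  S₀-S₁-disjoint {γ} ((g , g< , g-unb) , _) (_ , minimal) =
    minimal (O₁.sup {A = U} Countable-ℕ ν) (g′ , (λ i _ → g′<  i (dec _)) , λ ξ ξ<γ →
      let n , _ , ξ≤gn = g-unb ξ ξ<γ
      in ν n , O₁.<sup Countable-ℕ ν n tt , subst (ξ O₂.≤_) (sym (g′-ν n (dec _))) ξ≤gn)
    where
    pick : ∀ i → Dec (∃ λ n → i ≡ ν n) → ∣ ω₂ ∣
    pick i (yes (n , _)) = g n
    pick i (no _)        = g 0

    g′ : ∣ ω₁ ∣ → ∣ ω₂ ∣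
    g′ i = pick i (dec (∃ λ n → i ≡ ν n))

    g′< : ∀ i d → pick i d O₂.< γ
    g′< i (yes (n , _)) = g< n tt
    g′< i (no _)        = g< 0 tt

    g′-ν : ∀ n d → pick (ν n) d ≡ g n
    g′-ν n (yes (m , eq)) = cong g (sym (ν-injective eq))
    g′-ν n (no ∄n)        = contradiction (n , refl) ∄n

  -- An enumeration of `γ` by `ω₁` is a cofinal map. A cofinal map from some `δ < ω₁` would have a
  -- countable image and thus put `γ` into `S₀`.
  Lim⇒S₀⊎S₁ : ∀ {γ} → O₂.Lim γ → S₀ γ ⊎ S₁ γ
  Lim⇒S₀⊎S₁ {γ} γ-lim with dec (S₀ γ)
  ... | yes s₀ = inj₁ s₀
  ... | no ¬s₀ = inj₂
    ( (let g , g< , g-onto = Injects⇒enumeration (proj₁ γ-lim) (proj₂ ω₂-succ γ)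
       in g , (λ i _ → g< i) , λ ξ ξ<γ →
            let i , eq = g-onto ξ ξ<γ in i , tt , inj₂ (sym eq))
    , λ δ (h , h< , h-unb) → ¬s₀ (S₀-intro γ-lim
        (Countable-image h (proj₂ ω₁-succ δ))
        (λ where _ (i , i<δ , refl) → h< i i<δ)
        λ ξ ξ<γ → let i , i<δ , ξ≤ = h-unb ξ ξ<γ in h i , (i , i<δ , refl) , ξ≤))

  -- Regularity of `ω₁`: the values of a map `h` from `δ < ω₁` are dominated by `c (j i)` for
  -- indices `j i` with a common bound `b`, so `h` never reaches `c b`.
  S₁-intro : ∀ {β} (c : ∣ ω₁ ∣ → ∣ ω₂ ∣) → (∀ i j → i O₁.< j → c i O₂.< c j) →
             (∀ i → c i O₂.< β) → (∀ ξ → ξ O₂.< β → ∃ λ i → ξ O₂.≤ c i) → S₁ β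
  S₁-intro c c-mono c< c-unb =
      (c , (λ i _ → c< i) , λ ξ ξ<β → let i , ξ≤ = c-unb ξ ξ<β in i , tt , ξ≤)
    , λ δ (h , h< , h-unb) →
        let j = λ i → dom (h i) (dec _)
            b , <b = O₁.bounded (proj₂ ω₁-succ δ) j
            i , i<δ , cb≤hi = h-unb (c b) (c< b)
        in O₂.<-irrefl (O₂.≤-<-trans (O₂.≤-trans cb≤hi (dom-spec (h i) (dec _) (c-unb _ (h< i i<δ))))
                          (c-mono (j i) b (<b i i<δ)))
    where
    dom : ∀ ξ → Dec (∃ λ i → ξ O₂.≤ c i) → ∣ ω₁ ∣
    dom ξ (yes (i , _)) = i
    dom ξ (no _)        = O₁.zero

    dom-spec : ∀ ξ d → (∃ λ i → ξ O₂.≤ c i) → ξ O₂.≤ c (dom ξ d)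
    dom-spec ξ (yes (_ , ξ≤)) _  = ξ≤
    dom-spec ξ (no ∄i)        ∃i = contradiction ∃i ∄i

  module Enumeration {C : 𝒫 ∣ ω₂ ∣} (iso : SameOrderType ω₁ ω₂ U (_∈ C)) where

    e : ∣ ω₁ ∣ → ∣ ω₂ ∣
    e = proj₁ iso

    e∈ : ∀ i → e i ∈ C
    e∈ i = proj₁ (proj₂ iso) i tt

    e-mono : ∀ {i j} → i O₁.< j → e i O₂.< e j
    e-mono {i} {j} = proj₁ (proj₂ (proj₂ iso)) i j tt tt

    e-onto : ∀ α → α ∈ C → ∃ λ i → e i ≡ α
    e-onto α α∈ = let i , _ , eq = proj₂ (proj₂ (proj₂ iso)) α α∈ in i , eq

    e-reflect : ∀ {i j} → e i O₂.< e j → i O₁.< j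
    e-reflect {i} {j} ei<ej with O₁.<-or-≥ i j
    ... | inj₁ i<j         = i<j
    ... | inj₂ (inj₁ j<i)  = contradiction (O₂.<-trans ei<ej (e-mono j<i)) O₂.<-irrefl
    ... | inj₂ (inj₂ refl) = contradiction ei<ej O₂.<-irrefl

  S₀⇒cofinal-set : ∀ {γ} → S₀ γ → ∃ λ y → CountableCofinal ω₁ ω₂ y γ
  S₀⇒cofinal-set {γ} ((g , g< , g-unb) , _) = ⟦ A ⟧ ,
      Injects-⊆ (λ _ → ∈⁻ A) (Countable-image {A = U} g Countable-ℕ)
    , (λ ξ ξ∈ → let n , _ , eq = ∈⁻ A ξ∈ in subst (O₂._< γ) (sym eq) (g< n tt))
    , λ ξ ξ<γ → let n , _ , ξ≤ = g-unb ξ ξ<γ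
                in g n , ∈⁺ A (n , tt , refl) , g< n tt , ξ≤
    where
    A : Pred ∣ ω₂ ∣ 0ℓ
    A x = ∃ λ n → ⊤ × x ≡ g n

  -- Membership of 0 can be changed without affecting cofinality.
  S₀⇒another-cofinal-set : ∀ {γ} → S₀ γ → ∀ w → ∃ λ y → CountableCofinal ω₁ ω₂ y γ × y ≢ w
  S₀⇒another-cofinal-set {γ} s₀ w
    with y , y-ctble , y< , y-unb ← S₀⇒cofinal-set s₀ with dec (O₂.zero ∈ w)
  ... | yes 0∈w = ⟦ A ⟧
      , ( Injects-⊆ (λ x → proj₁ ∘ ∈⁻ A) y-ctble
        , (λ x → y< x ∘ proj₁ ∘ ∈⁻ A)
        , λ ξ ξ<γ → let sξ<γ = O₂.Lim-suc (S₀⇒Lim s₀) ξ<γ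
                        η , η∈ , η<γ , sξ≤η = y-unb (O₂.suc ξ) sξ<γ
                        ξ<η = O₂.<-≤-trans O₂.<suc sξ≤η
                    in η , ∈⁺ A (η∈ , λ eq → O₂.≤⇒≯ O₂.zero-≤ (subst (ξ O₂.<_) eq ξ<η))
                         , η<γ , inj₁ ξ<η )
      , λ { refl → proj₂ (∈⁻ A 0∈w) refl }
    where
    A : Pred ∣ ω₂ ∣ 0ℓ
    A x = x ∈ y × x ≢ O₂.zero
  ... | no 0∉w = ⟦ A ⟧
      , ( Injects-⊆ (λ x → ∈⁻ A) (Countable-∪ y-ctble ((λ _ → 0) , λ where _ _ refl refl _ → refl))
        , (λ x x∈ → [ y< x , (λ { refl → 0<γ }) ]′ (∈⁻ A x∈))
        , λ ξ ξ<γ → let η , η∈ , rest = y-unb ξ ξ<γ in η , ∈⁺ A (inj₁ η∈) , rest )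
      , λ { refl → 0∉w (∈⁺ A (inj₂ refl)) }
    where
    A : Pred ∣ ω₂ ∣ 0ℓ
    A x = x ∈ y ⊎ x ≡ O₂.zero

    0<γ : O₂.zero O₂.< γ
    0<γ = let (x , x<γ) , _ = S₀⇒Lim s₀ in O₂.≤-<-trans O₂.zero-≤ x<γ

-- A system of ladders on S²₀ in which every non-limit ordinal has at most
-- one predecessor.  Two ladders therefore agree below any common rung.

module Ladders (em : ∀ ℓ → ExcludedMiddle ℓ) (ext : ∀ a b → Extensionality a b)
               (ω₁ ω₂ : WellOrder)
               (ω₁-succ : IsCardinalSuccessor ω ω₁)
               (ω₂-succ : IsCardinalSuccessor ω₁ ω₂) where

  open Classical em ext
  open Ordinals em ext ω₁ ω₂ ω₁-succ ω₂-succ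
  open O₂

  NonSuc : Pred ∣ ω₂ ∣ 0ℓ
  NonSuc m = ∀ x → m ≢ suc x

  Lim⇒NonSuc : ∀ {m} → Lim m → NonSuc m
  Lim⇒NonSuc m-lim x refl = ¬Lim-suc m-lim

  iter-decompose : ∀ α → ∃₂ λ m k → NonSuc m × α ≡ iter k m
  iter-decompose = wf-induction _ λ α ih → go α ih (kind α)
    where
    go : ∀ α → (∀ x → x < α → ∃₂ λ m k → NonSuc m × x ≡ iter k m) → Kind α →
         ∃₂ λ m k → NonSuc m × α ≡ iter k m
    go _ ih is-zero = zero , 0 ,
      (λ x eq → ≤⇒≯ zero-≤ (subst (x <_) (sym eq) <suc)) , refl
    go α ih (is-lim α-lim) = α , 0 , Lim⇒NonSuc α-lim , refl
    go _ ih (is-suc x) =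
      let m , k , m-nonsuc , eq = ih x <suc in m , ℕ.suc k , m-nonsuc , cong suc eq

  iter-unique : ∀ k k′ {m m′} → NonSuc m → NonSuc m′ → iter k m ≡ iter k′ m′ →
                k ≡ k′ × m ≡ m′
  iter-unique ℕ.zero    ℕ.zero     _  _   eq = refl , eq
  iter-unique ℕ.zero    (ℕ.suc k′) ns _   eq = contradiction eq (ns _)
  iter-unique (ℕ.suc k) ℕ.zero     _  ns′ eq = contradiction (sym eq) (ns′ _)
  iter-unique (ℕ.suc k) (ℕ.suc k′) ns ns′ eq
    with refl , m≡m′ ← iter-unique k k′ ns ns′ (suc-injective eq) = refl , m≡m′

  ¬Lim-iter : ∀ {k} m → 0 ℕ.< k → ¬ Lim (iter k m)
  ¬Lim-iter {ℕ.suc k} m _ = ¬Lim-suc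

  -- The blocks of length ω₁, and predecessors

  infix 4 _~_
  _~_ : Rel ∣ ω₂ ∣ 0ℓ
  ξ ~ α = Countable (λ η → ξ ≤ η × η < α)

  ~-refl : ∀ {α} → α ~ α
  ~-refl = (λ _ → 0) , λ _ _ (α≤x , x<α) → contradiction x<α (≤⇒≯ α≤x)

  ~-shrink : ∀ {ξ ξ′ α α′} → ξ ≤ ξ′ → α′ ≤ α → ξ ~ α → ξ′ ~ α′
  ~-shrink ξ≤ξ′ α′≤α = Injects-⊆ λ η (ξ′≤η , η<α′) → ≤-trans ξ≤ξ′ ξ′≤η , <-≤-trans η<α′ α′≤α

  abstract
    ~-trans : ∀ {ξ η α} → ξ ~ η → η ~ α → ξ ~ α
    ~-trans {η = η} c c′ = Injects-⊆
      (λ x (ξ≤x , x<α) → [ (λ x<η → inj₁ (ξ≤x , x<η)) , (λ η≤x → inj₂ (η≤x , x<α)) ]′ (<-or-≥ x η))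
      (Countable-∪ c c′)

  ~-suc : ∀ {ξ α} → ξ ~ α → ξ ~ suc α
  ~-suc c = ~-trans c ((λ _ → 0) , λ x y (α≤x , x<) (α≤y , y<) _ →
    trans (≤-antisym (<suc⇒≤ x<) α≤x) (≤-antisym α≤y (<suc⇒≤ y<)))

  ~-ω-limit : ∀ {ξ γ} (g : ℕ → ∣ ω₂ ∣) → (∀ n → ξ ~ suc (g n)) →
              (∀ η → η < γ → ∃ λ n → η ≤ g n) → ξ ~ γ
  ~-ω-limit g c unb = Injects-⊆
    (λ η (ξ≤η , η<γ) → let n , η≤ = unb η η<γ in n , tt , ξ≤η , ≤-<-trans η≤ <suc)
    (Countable-⋃ {J = U} Countable-ℕ λ n _ → c n)

  ~-next : ∀ {ξ α} → ξ ~ α → ξ ~ next α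
  ~-next {ξ} {α} c = ~-ω-limit (λ n → iter n α) (λ n → ~-suc (c-iter n)) λ _ → <next⇒≤iter
    where
    c-iter : ∀ n → ξ ~ iter n α
    c-iter ℕ.zero    = c
    c-iter (ℕ.suc n) = ~-suc (c-iter n)

  abstract
    -- This is the greatest multiple of ω₁ that is at most `α`, in other words the left end of the
    -- block containing `α`.
    start : ∣ ω₂ ∣ → ∣ ω₂ ∣
    start α = proj₁ (least (_~ α) (α , ~-refl))

    start-~ : ∀ {α} → start α ~ α
    start-~ {α} = proj₁ (proj₂ (least (_~ α) (α , ~-refl)))

    start-least : ∀ {α ξ} → ξ ~ α → start α ≤ ξ
    start-least {α} {ξ} = proj₂ (proj₂ (least (_~ α) (α , ~-refl))) ξ

  start-≤ : ∀ {α} → start α ≤ α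
  start-≤ = start-least ~-refl

  Block : ∣ ω₂ ∣ → Pred ∣ ω₂ ∣ 0ℓ
  Block μ ξ = μ ≤ ξ × μ ~ ξ

  -- If the block were countable, it would be bounded. The least ordinal `α ≥ μ` outside it would
  -- have `[μ , α)` inside the block, hence countable, and would so belong to the block.
  Block-uncountable : ∀ μ → ¬ Countable (Block μ)
  Block-uncountable μ ctble
    with b , <b ← bounded (Countable⇒small ctble) id
    with α , (μ≤α , α∉) , α-least ← least (λ α → μ ≤ α × ¬ Block μ α)
           (b , inj₁ (<b μ (≤-refl , ~-refl)) , λ b∈ → <-irrefl (<b b b∈))
    = α∉ (μ≤α , Injects-⊆ (λ η (μ≤η , η<α) → dne λ η∉ → ≤⇒≯ (α-least η (μ≤η , η∉)) η<α) ctble)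

  abstract
    -- `μ` injects into `ω₁`, and `ω₁` injects greedily into the uncountable block. The image of `ξ`
    -- fixes the moment in the block from which `ξ` is served; before any given moment only
    -- countably many images have been passed.
    spread : ∀ μ → Σ (∣ ω₂ ∣ → ∣ ω₂ ∣) λ h → (∀ ξ → ξ < μ → Block μ (h ξ)) ×
             (∀ ξ ξ′ → ξ < μ → ξ′ < μ → h ξ ≡ h ξ′ → ξ ≡ ξ′)
    spread μ
      with g , g∈ , g-inj ← greedy-injection O₁.wellFounded O₁.<-connected (Block μ)
             (μ , ≤-refl , ~-refl) (λ v (h , h< , h-inj) →
               Block-uncountable μ (Injects-∘ h h< h-inj (proj₂ ω₁-succ v)))
      with e , e-inj ← proj₂ ω₂-succ μ
      = (λ ξ → g (e ξ)) , (λ ξ _ → g∈ (e ξ)) ,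
        λ ξ ξ′ ξ< ξ′< eq → e-inj ξ ξ′ ξ< ξ′< (g-inj _ _ eq)

  h : ∣ ω₂ ∣ → ∣ ω₂ ∣ → ∣ ω₂ ∣
  h μ = proj₁ (spread μ)

  -- the countable set of ordinals to be continued infinitely often in [m, m + ω)
  Served : ∣ ω₂ ∣ → Pred ∣ ω₂ ∣ 0ℓ
  Served m ξ = (start m ≤ ξ × ξ < next m) ⊎ (ξ < start m × h (start m) ξ < m)

  abstract
    Served-countable : ∀ m → Countable (Served m)
    Served-countable m = Countable-∪ (~-next start-~) (Injects-∘ (h (start m))
      (λ ξ (ξ<μ , h<m) → proj₁ (proj₁ (proj₂ (spread (start m))) ξ ξ<μ) , h<m)
      (λ ξ ξ′ (ξ<μ , _) (ξ′<μ , _) → proj₂ (proj₂ (spread (start m))) ξ ξ′ ξ<μ ξ′<μ)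
      start-~)

  code : ∣ ω₂ ∣ → ∣ ω₂ ∣ → ℕ
  code m = proj₁ (Served-countable m)

  -- Every ordinal is `m + k` with `m` not a successor, and the exponent of 2 in `k` names the
  -- served ordinal that is continued. Codes are shifted by one to reserve exponent zero for roots.
  Pred-of : ∣ ω₂ ∣ → ∣ ω₂ ∣ → Set
  Pred-of α ξ = ¬ Lim ξ × ξ < α × ∃₂ λ m b →
    NonSuc m × Served m ξ × α ≡ iter (pair (ℕ.suc (code m ξ)) b) m

  Pred-of-unique : ∀ {α ξ ξ′} → Pred-of α ξ → Pred-of α ξ′ → ξ ≡ ξ′
  Pred-of-unique (_ , _ , m , b , ns , s , eq) (_ , _ , m′ , b′ , ns′ , s′ , eq′)
    with k≡k′ , refl ← iter-unique (pair (ℕ.suc (code m _)) b) (pair (ℕ.suc (code m′ _)) b′)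
                         ns ns′ (trans (sym eq) eq′)
    = proj₂ (Served-countable m) _ _ s s′
        (ℕ.suc-injective (proj₁ (pair-injective (ℕ.suc (code m _)) b _ b′ k≡k′)))

  π′ : ∀ α → Dec (∃ (Pred-of α)) → Maybe ∣ ω₂ ∣
  π′ α (yes (ξ , _)) = just ξ
  π′ α (no _)        = nothing

  π : ∣ ω₂ ∣ → Maybe ∣ ω₂ ∣
  π α = π′ α (dec _)

  π⇒Pred-of : ∀ {α ξ} → π α ≡ just ξ → Pred-of α ξ
  π⇒Pred-of {α} eq with dec (∃ (Pred-of α))
  π⇒Pred-of {α} refl | yes (_ , p) = p

  Pred-of⇒π : ∀ {α ξ} → Pred-of α ξ → π α ≡ just ξ
  Pred-of⇒π {α} {ξ} p with dec (∃ (Pred-of α))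
  ... | yes (ξ′ , p′) = cong just (Pred-of-unique p′ p)
  ... | no ∄ξ         = contradiction (ξ , p) ∄ξ

  π-< : ∀ {α ξ} → π α ≡ just ξ → ξ < α
  π-< eq = proj₁ (proj₂ (π⇒Pred-of eq))

  π-¬Lim : ∀ {α ξ} → π α ≡ just ξ → ¬ Lim ξ
  π-¬Lim eq = proj₁ (π⇒Pred-of eq)

  π-root : ∀ {m} → NonSuc m → ∀ b → π (iter (pair 0 b) m) ≡ nothing
  π-root {m} ns b with dec (∃ (Pred-of (iter (pair 0 b) m)))
  ... | no _ = refl
  ... | yes (ξ , _ , _ , m′ , b′ , ns′ , _ , eq)
    with () ← proj₁ (pair-injective 0 b (ℕ.suc (code m′ ξ)) b′
                (proj₁ (iter-unique (pair 0 b) (pair (ℕ.suc (code m′ ξ)) b′) ns ns′ eq)))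

  -- A cofinal infinite chain below each γ of cofinality ω

  module _ {γ : ∣ ω₂ ∣} (s₀ : S₀ γ) where
    private
      γ-lim : Lim γ
      γ-lim = S₀⇒Lim s₀

      Serving : ∣ ω₂ ∣ → ∣ ω₂ ∣ → Set
      Serving ξ η = ∃ λ m → NonSuc m × Served m ξ × ξ < next m × η < next m × next m ≤ γ

      -- Either γ lies inside a block, or blocks of type ω₁ are cofinal in γ.
      serving : ∃ λ ℓ → ℓ < γ × (∀ ξ η → ℓ ≤ ξ → ξ < γ → η < γ → Serving ξ η)
      serving with dec (∃ λ ℓ → ℓ < γ × ℓ ~ γ)
      ... | yes (ℓ , ℓ<γ , ℓ~γ) = ℓ , ℓ<γ , serve
        where
        serve : ∀ ξ η → ℓ ≤ ξ → ξ < γ → η < γ → Serving ξ η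
        serve ξ η ℓ≤ξ ξ<γ η<γ
          with μ , ξ≤μ , η≤μ , μ≡ ← upper-bound ξ η
          with m , k , ns , refl ← iter-decompose μ
          = m , ns , inj₁ (start≤ξ , ξ<) , ξ< , ≤-<-trans η≤μ (iter<next k) ,
            next-least γ-lim (≤-<-trans (≤-iter k) μ<γ)
          where
          μ<γ : iter k m < γ
          μ<γ = [ (λ eq → subst (_< γ) (sym eq) ξ<γ) , (λ eq → subst (_< γ) (sym eq) η<γ) ]′ μ≡

          ξ< : ξ < next m
          ξ< = ≤-<-trans ξ≤μ (iter<next k)

          start≤ξ : start m ≤ ξ
          start≤ξ with <-or-≥ m ℓ
          ... | inj₁ m<ℓ = inj₁ (<-≤-trans (≤-<-trans start-≤ m<ℓ) ℓ≤ξ)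
          ... | inj₂ ℓ≤m = ≤-trans
            (start-least (~-shrink ≤-refl (inj₁ (≤-<-trans (≤-iter k) μ<γ)) ℓ~γ)) ℓ≤ξ
      ... | no ¬~γ = zero , ≤-<-trans zero-≤ (proj₂ (proj₁ γ-lim)) , λ ξ η _ → serve ξ η
        where
        inside : ∀ {μ α} → μ < γ → μ ~ α → α < γ
        inside {μ} {α} μ<γ μ~α with <-or-≥ α γ
        ... | inj₁ α<γ = α<γ
        ... | inj₂ γ≤α = contradiction (μ , μ<γ , ~-shrink ≤-refl γ≤α μ~α) ¬~γ

        serve : ∀ ξ η → ξ < γ → η < γ → Serving ξ η
        serve ξ η ξ<γ η<γ
          with ζ , ξ≤ζ , η≤ζ , ζ≡ ← upper-bound ξ η
          -- `μ` is where the block following that of `ζ` begins. There `ξ` is served at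
          -- `m = h μ ξ + ω`, just past its image; as no tail of `γ` is countable, the whole block
          -- at `μ` stays below `γ`.
          with μ , ¬ζ~μ , μ-least ← least (λ μ → ¬ ζ ~ μ) (γ , λ ζ~γ → ¬~γ (ζ ,
                 [ (λ { refl → ξ<γ }) , (λ { refl → η<γ }) ]′ ζ≡ , ζ~γ))
          = m , Lim⇒NonSuc Lim-next
          , inj₂ (subst (ξ <_) (sym start≡) ξ<μ ,
                  subst (λ μ → h μ ξ < m) (sym start≡) <next)
          , <-trans (≤-<-trans ξ≤ζ ζ<m) <next , <-trans (≤-<-trans η≤ζ ζ<m) <next
          , next-least γ-lim (inside μ<γ μ~m)
          where
          ζ<γ : ζ < γ
          ζ<γ = [ (λ eq → subst (_< γ) (sym eq) ξ<γ) , (λ eq → subst (_< γ) (sym eq) η<γ) ]′ ζ≡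

          ζ~ : ∀ {x} → x < μ → ζ ~ x
          ζ~ x<μ = dne λ ¬ζ~x → ≤⇒≯ (μ-least _ ¬ζ~x) x<μ

          ζ<μ : ζ < μ
          ζ<μ with <-or-≥ ζ μ
          ... | inj₁ ζ<μ = ζ<μ
          ... | inj₂ μ≤ζ = contradiction (~-shrink ≤-refl μ≤ζ ~-refl) ¬ζ~μ

          -- μ has uncountable cofinality, unlike γ
          μ<γ : μ < γ
          μ<γ with μ-least γ (λ ζ~γ → ¬~γ (ζ , ζ<γ , ζ~γ))
          ... | inj₁ μ<γ  = μ<γ
          ... | inj₂ refl = let (g , g< , g-unb) , _ = s₀ in contradiction
            (~-ω-limit g (λ n → ζ~ (Lim-suc γ-lim (g< n tt)))
              λ x x<γ → let n , _ , x≤ = g-unb x x<γ in n , x≤) ¬ζ~μ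

          ξ<μ : ξ < μ
          ξ<μ = ≤-<-trans ξ≤ζ ζ<μ

          m : ∣ ω₂ ∣
          m = next (h μ ξ)

          μ≤h : μ ≤ h μ ξ
          μ≤h = proj₁ (proj₁ (proj₂ (spread μ)) ξ ξ<μ)

          μ~m : μ ~ m
          μ~m = ~-next (proj₂ (proj₁ (proj₂ (spread μ)) ξ ξ<μ))

          μ<m : μ < m
          μ<m = ≤-<-trans μ≤h <next

          ζ<m : ζ < m
          ζ<m = <-trans ζ<μ μ<m

          start≡ : start m ≡ μ
          start≡ with start-least μ~m
          ... | inj₂ eq = eq
          ... | inj₁ start<μ = contradiction (start-~′ start<μ) ¬ζ~μ
            where
            start-~′ : start m < μ → ζ ~ μ
            start-~′ start<μ with <-or-≥ ζ (start m)
            ... | inj₁ ζ<start = ~-trans (ζ~ start<μ) (~-shrink ≤-refl (inj₁ μ<m) start-~)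
            ... | inj₂ start≤ζ = ~-shrink start≤ζ (inj₁ μ<m) start-~

      ℓ : ∣ ω₂ ∣
      ℓ = proj₁ serving

      ℓ<γ : ℓ < γ
      ℓ<γ = proj₁ (proj₂ serving)

      above : ∀ {ξ m} j → ξ < next m → ∃ λ b → ξ < iter (pair j b) m
      above {m = m} j ξ< = let n , ξ≤ = <next⇒≤iter ξ< in
        n , ≤-<-trans ξ≤ (iter-mono-< m (pair-> j n))

      root : ∃ λ α → ℓ ≤ α × α < γ × ¬ Lim α × π α ≡ nothing
      root =
        let m , ns , _ , ℓ< , _ , next≤γ = proj₂ (proj₂ serving) ℓ ℓ ≤-refl ℓ<γ ℓ<γ
            b , ℓ<α = above 0 ℓ<
        in iter (pair 0 b) m , inj₁ ℓ<α , <-≤-trans (iter<next (pair 0 b)) next≤γ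
           , ¬Lim-iter m (ℕ.≤-<-trans ℕ.z≤n (pair-> 0 b)) , π-root ns b

      -- In the code `pair j b` the component `j` names `ξ` while `b` is free; taking `b` large
      -- pushes `iter (pair j b) m` beyond both `ξ` and `η` without leaving `[m , m + ω)`.
      climb : ∀ ξ η → ℓ ≤ ξ → ξ < γ → ¬ Lim ξ → η < γ →
              ∃ λ α → (ℓ ≤ α × α < γ × ¬ Lim α) × η ≤ α × π α ≡ just ξ
      climb ξ η ℓ≤ξ ξ<γ ¬lim η<γ
        with m , ns , served , ξ< , η< , next≤γ ← proj₂ (proj₂ serving) ξ η ℓ≤ξ ξ<γ η<γ
        with n , ξ≤n ← <next⇒≤iter ξ< | n′ , η≤n′ ← <next⇒≤iter η<
        = iter k m
        , (inj₁ (≤-<-trans ℓ≤ξ ξ<α) , <-≤-trans (iter<next k) next≤γ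
          , ¬Lim-iter m (ℕ.≤-<-trans ℕ.z≤n (pair-> j b)))
        , inj₁ (≤-<-trans η≤n′ (iter-mono-< m (ℕ.≤-<-trans (ℕ.m≤n⊔m n n′) (pair-> j b))))
        , Pred-of⇒π (¬lim , ξ<α , m , b , ns , served , refl)
        where
        j = ℕ.suc (code m ξ)
        b = n ℕ.⊔ n′
        k = pair j b
        ξ<α : ξ < iter k m
        ξ<α = ≤-<-trans ξ≤n (iter-mono-< m (ℕ.≤-<-trans (ℕ.m≤m⊔n n n′) (pair-> j b)))

      g : ℕ → ∣ ω₂ ∣
      g = proj₁ (proj₁ s₀)

      rungs : ℕ → ∃ λ α → ℓ ≤ α × α < γ × ¬ Lim α
      rungs ℕ.zero    = let α , ℓ≤ , <γ , ¬lim , _ = root in α , ℓ≤ , <γ , ¬lim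
      rungs (ℕ.suc n) = let ξ , ℓ≤ , <γ , ¬lim = rungs n
                            α , p , _ = climb ξ (g n) ℓ≤ <γ ¬lim (proj₁ (proj₂ (proj₁ s₀)) n tt)
                        in α , p

    rung : ℕ → ∣ ω₂ ∣
    rung n = proj₁ (rungs n)

    rung<γ : ∀ n → rung n < γ
    rung<γ n = proj₁ (proj₂ (proj₂ (rungs n)))

    ¬Lim-rung : ∀ n → ¬ Lim (rung n)
    ¬Lim-rung n = proj₂ (proj₂ (proj₂ (rungs n)))

    π-rung-zero : π (rung 0) ≡ nothing
    π-rung-zero = proj₂ (proj₂ (proj₂ (proj₂ root)))

    π-rung-suc : ∀ n → π (rung (ℕ.suc n)) ≡ just (rung n)
    π-rung-suc n = let ξ , ℓ≤ , <γ , ¬lim = rungs n in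
      proj₂ (proj₂ (proj₂ (climb ξ (g n) ℓ≤ <γ ¬lim (proj₁ (proj₂ (proj₁ s₀)) n tt))))

    rung-cofinal : ∀ ξ → ξ < γ → ∃ λ n → ξ ≤ rung n
    rung-cofinal ξ ξ<γ =
      let n , _ , ξ≤gn = proj₂ (proj₂ (proj₁ s₀)) ξ ξ<γ
          x , ℓ≤ , <γ , ¬lim = rungs n
      in ℕ.suc n , ≤-trans ξ≤gn
           (proj₁ (proj₂ (proj₂ (climb x (g n) ℓ≤ <γ ¬lim (proj₁ (proj₂ (proj₁ s₀)) n tt)))))

-- Plays of G* of length ω and ω₁, and filters from strategies

module Games (em : ∀ ℓ → ExcludedMiddle ℓ) (ext : ∀ a b → Extensionality a b)
             (ω₁ ω₂ : WellOrder)
             (ω₁-succ : IsCardinalSuccessor ω ω₁)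
             (ω₂-succ : IsCardinalSuccessor ω₁ ω₂) where

  open Classical em ext
  open Ordinals em ext ω₁ ω₂ ω₁-succ ω₂-succ

  ι-mono : (P : Poset) → ∀ {p q} → Poset._⊑_ P p q → _≤𝓑_ P (ι P p) (ι P q)
  ι-mono P p⊑q x x∈ r r⊑x =
    let s , s⊑r , s⊑p = x∈ r r⊑x in s , s⊑r , Poset.⊑-trans P s⊑p p⊑q

  ⋀-below : (P : Poset) → ∀ {A a q} → a ∈ A → Poset._⊑_ P a q → _≤𝓑_ P (⋀ P A) (ι P q)
  ⋀-below P {A} {a} a∈A a⊑q x x∈ = ι-mono P a⊑q x (⋀-lower P A a a∈A x x∈)

  module _ (P : Poset) (τ : *-Operation ω₁ P) (win : Winning* ω₁ P τ) where
    open Poset P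

    initial : (ℕ → ⟨ P ⟩) → ℕ → 𝒫 ⟨ P ⟩
    initial p n = ⟦ (λ q → ∃ λ m → m ℕ.≤ n × q ≡ p m) ⟧

    response : (ℕ → ⟨ P ⟩) → ℕ → ⟨ P ⟩
    response p n = τ (ν n) (initial p n)

    module _ (p : ℕ → ⟨ P ⟩) where
      private
        -- `Winning*` speaks of sequences of length ω₁, so the sequence `p` is padded: from turn ω
        -- on the set of Player I no longer changes.
        Played : ∣ ω₁ ∣ → Pred ⟨ P ⟩ 0ℓ
        Played i q = ∃ λ m → ν m O₁.≤ i × q ≡ p m

        A : ∣ ω₁ ∣ → 𝒫 ⟨ P ⟩
        A i = ⟦ Played i ⟧

        b : ∣ ω₁ ∣ → ⟨ P ⟩
        b i = τ i (A i)

        A-ν : ∀ n → A (ν n) ≡ initial p n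
        A-ν n = ⟦⟧-cong
          (λ q (m , νm≤ , eq) → m , O₁.iter-reflect-≤ O₁.zero νm≤ , eq)
          (λ q (m , m≤n , eq) → m , O₁.iter-mono-≤ O₁.zero m≤n , eq)

        A-⊆ : ∀ {i j} → i O₁.≤ j → A i ⊆ A j
        A-⊆ {i} {j} i≤j q q∈ = let m , νm≤i , eq = ∈⁻ (Played i) q∈ in ∈⁺ (Played j) (m , O₁.≤-trans νm≤i i≤j , eq)

        unions : UnionsAtLimits ω₁ P A
        unions γ γ-lim q = mk⇔
          (λ q∈ → let m , νm≤γ , eq = ∈⁻ (Played γ) q∈ in
            ν m , O₁.≤-Lim⇒< (¬Lim-ν m) γ-lim νm≤γ
            , ¬Lim-ν m , ∈⁺ (Played (ν m)) (m , O₁.≤-refl , eq))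
          λ (ξ , ξ<γ , _ , q∈) → A-⊆ (inj₁ ξ<γ) q q∈

        Follows : ℕ → Set
        Follows n = ∀ m → m ℕ.< n → p (ℕ.suc m) ⊑ response p m

        Descends : ℕ → Set
        Descends n = ∀ m → m ℕ.≤ n → ∀ k → k ℕ.≤ m → p m ⊑ p k

        legal : ∀ n → Follows n → (∀ k → k ℕ.≤ n → p n ⊑ p k) → *-LegalI ω₁ P A b (ν n)
        legal n follows n-below = record
          { nonempty   = p 0 , ∈⁺ (Played (ν n)) (0 , O₁.zero-≤ , refl)
          ; countable  = Injects-⊆ (λ q q∈ → let m , _ , eq = ∈⁻ (Played (ν n)) q∈ in m , tt , eq)
                           (Countable-image {A = U} p Countable-ℕ)
          ; bounded    = p n , λ q q∈ → let m , νm≤ , eq = ∈⁻ (Played (ν n)) q∈ in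
                           subst (p n ⊑_) (sym eq)
                             (n-below m (O₁.iter-reflect-≤ O₁.zero νm≤))
          ; increasing = λ ξ ξ<γ _ → A-⊆ (inj₁ ξ<γ)
          ; below      = λ δ succ → below n follows δ (O₁.IsSuccessorOf⇒≡ succ)
          }
          where
          below : ∀ n → Follows n → ∀ δ → ν n ≡ O₁.suc δ → _≤𝓑_ P (⋀ P (A (ν n))) (ι P (b δ))
          below ℕ.zero    _ δ eq = ⊥-elim (O₁.≤⇒≯ O₁.zero-≤ (subst (δ O₁.<_) (sym eq) O₁.<suc))
          below (ℕ.suc m) follows δ eq with refl ← O₁.suc-injective eq =
            ⋀-below P (∈⁺ (Played (ν (ℕ.suc m))) (ℕ.suc m , O₁.≤-refl , refl))
              (subst (λ B → p (ℕ.suc m) ⊑ τ (ν m) B) (sym (A-ν m)) (follows m ℕ.≤-refl))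

        response-extends : ∀ n → Follows n → Descends n → ∀ k → k ℕ.≤ n → response p n ⊑ p k
        response-extends n follows descends k k≤n =
          subst (λ B → τ (ν n) B ⊑ p k) (A-ν n)
            (proj₁ (win A unions) (ν n)
              (λ ξ ξ≤ _ → let m , m≤n , eq = ≤ν⇒ν n ξ≤ in
                subst (*-LegalI ω₁ P A b) (sym eq)
                  (legal m (λ k k<m → follows k (ℕ.≤-trans k<m m≤n)) (descends m m≤n)))
              (p k) (∈⁺ (Played (ν n)) (k , O₁.iter-mono-≤ O₁.zero k≤n , refl)))

        -- `p` is not assumed to descend. Legality of the turns up to `n` makes II's answer a common
        -- extension of `p 0`, ..., `p n`, and `p (n + 1)` lies below that answer.
        descends : ∀ n → Follows n → Descends n
        descends ℕ.zero follows _ ℕ.z≤n _ ℕ.z≤n = ⊑-refl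
        descends (ℕ.suc n) follows m m≤1+n k k≤m
          with ℕ.m≤n⇒m<n∨m≡n m≤1+n | ℕ.m≤n⇒m<n∨m≡n k≤m
        ... | inj₁ m<1+n | _ =
          descends n (λ j j<n → follows j (ℕ.m<n⇒m<1+n j<n)) m (ℕ.≤-pred m<1+n) k k≤m
        ... | inj₂ refl | inj₂ refl = ⊑-refl
        ... | inj₂ refl | inj₁ k<1+n = ⊑-trans (follows n ℕ.≤-refl)
          (response-extends n follows′ (descends n follows′) k (ℕ.≤-pred k<1+n))
          where
          follows′ : Follows n
          follows′ j j<n = follows j (ℕ.m<n⇒m<1+n j<n)

      finite-play : ∀ n → (∀ m → m ℕ.< n → p (ℕ.suc m) ⊑ response p m) → response p n ⊑ p n
      finite-play n follows = response-extends n follows (descends n follows) n ℕ.≤-refl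

      -- The lower bound is II's own answer at turn ω, where her set is the union of the finite
      -- stages.
      infinite-play : (∀ m → p (ℕ.suc m) ⊑ response p m) → ∃ λ q → ∀ n → q ⊑ p n
      infinite-play follows = b δ , λ n → proj₁ (win A unions) δ δ-legal (p n)
          (∈⁺ (Played δ) (n , inj₁ (ν<δ n) , refl))
        where
        δ : ∣ ω₁ ∣
        δ = O₁.sup {A = U} Countable-ℕ ν

        ν<δ : ∀ n → ν n O₁.< δ
        ν<δ n = O₁.<sup Countable-ℕ ν n tt

        <δ⇒≤ν : ∀ {ξ} → ξ O₁.< δ → ∃ λ n → ξ O₁.≤ ν n
        <δ⇒≤ν ξ<δ = let n , _ , ξ≤ = O₁.<sup⇒≤ Countable-ℕ ν ξ<δ in n , ξ≤

        δ-lim : O₁.Lim δ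
        δ-lim = (ν 0 , ν<δ 0) , λ ξ ξ<δ → let n , ξ≤ = <δ⇒≤ν ξ<δ in
          ν (ℕ.suc n) , O₁.≤-<-trans ξ≤ O₁.<suc , ν<δ (ℕ.suc n)

        δ-legal : ∀ ξ → ξ O₁.≤ δ → ¬ O₁.Lim ξ → *-LegalI ω₁ P A b ξ
        δ-legal ξ (inj₂ refl) ¬lim = contradiction δ-lim ¬lim
        δ-legal ξ (inj₁ ξ<δ)  _
          with n , ξ≤ ← <δ⇒≤ν ξ<δ
          with m , _ , refl ← ≤ν⇒ν n ξ≤
          = legal m (λ k _ → follows k) (descends m (λ k _ → follows k) m ℕ.≤-refl)

    module _ (p₀ : ⟨ P ⟩) (E : ∣ ω₁ ∣ → Pred ⟨ P ⟩ 0ℓ)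
             (dense : ∀ i q → ∃ λ r → r ⊑ q × E i r) where
      private
        Played : (∣ ω₁ ∣ → ⟨ P ⟩) → ∣ ω₁ ∣ → Pred ⟨ P ⟩ 0ℓ
        Played x δ q = ∃ λ ξ → ξ O₁.≤ δ × ¬ O₁.Lim ξ × q ≡ x ξ

        moves : (∣ ω₁ ∣ → ⟨ P ⟩) → ∣ ω₁ ∣ → 𝒫 ⟨ P ⟩
        moves x δ = ⟦ Played x δ ⟧

        step : ∀ {γ} → (∣ ω₁ ∣ → ⟨ P ⟩) → O₁.Kind γ → ⟨ P ⟩
        step ih O₁.is-zero    = p₀
        step ih (O₁.is-suc δ) = proj₁ (dense δ (τ δ (moves ih δ)))
        -- Player I skips limit turns: this value never enters `moves`.
        step ih (O₁.is-lim _) = p₀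

        open WfRecursion O₁.wellFounded p₀ (λ γ ih → step ih (O₁.kind γ))
          renaming (rec to x)

        A : ∣ ω₁ ∣ → 𝒫 ⟨ P ⟩
        A = moves x

        b : ∣ ω₁ ∣ → ⟨ P ⟩
        b i = τ i (A i)

        x-zero : x O₁.zero ≡ p₀
        x-zero = trans (unfold O₁.zero) (go (O₁.kind O₁.zero) refl)
          where
          go : ∀ {γ ih} (k : O₁.Kind γ) → γ ≡ O₁.zero → step ih k ≡ p₀
          go O₁.is-zero    _  = refl
          go (O₁.is-suc δ) eq = ⊥-elim (O₁.≤⇒≯ O₁.zero-≤ (subst (δ O₁.<_) eq O₁.<suc))
          go (O₁.is-lim _) _  = refl

        x-suc : ∀ δ → x (O₁.suc δ) ≡ proj₁ (dense δ (b δ))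
        x-suc δ = trans (unfold (O₁.suc δ))
            (trans (go (O₁.kind (O₁.suc δ)) refl)
              (cong (λ B → proj₁ (dense δ (τ δ B))) (⟦⟧-cong
                (λ q (ξ , ξ≤δ , ¬lim , eq) → ξ , ξ≤δ , ¬lim , trans eq (cut-≡ (O₁.≤-<-trans ξ≤δ O₁.<suc)))
                (λ q (ξ , ξ≤δ , ¬lim , eq) → ξ , ξ≤δ , ¬lim , trans eq (sym (cut-≡ (O₁.≤-<-trans ξ≤δ O₁.<suc)))))))
          where
          go : ∀ {γ ih} (k : O₁.Kind γ) → γ ≡ O₁.suc δ →
               step ih k ≡ proj₁ (dense δ (τ δ (moves ih δ)))
          go O₁.is-zero eq = ⊥-elim (O₁.≤⇒≯ O₁.zero-≤ (subst (δ O₁.<_) (sym eq) O₁.<suc))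
          go (O₁.is-suc δ′) eq with refl ← O₁.suc-injective eq = refl
          go (O₁.is-lim lim) refl = contradiction lim O₁.¬Lim-suc

        A-⊆ : ∀ {i j} → i O₁.≤ j → A i ⊆ A j
        A-⊆ {i} {j} i≤j q q∈ = let ξ , ξ≤i , rest = ∈⁻ (Played x i) q∈ in ∈⁺ (Played x j) (ξ , O₁.≤-trans ξ≤i i≤j , rest)

        unions : UnionsAtLimits ω₁ P A
        unions γ γ-lim q = mk⇔
          (λ q∈ → let ξ , ξ≤γ , ¬lim , eq = ∈⁻ (Played x γ) q∈ in
            ξ , O₁.≤-Lim⇒< ¬lim γ-lim ξ≤γ
            , ¬lim , ∈⁺ (Played x ξ) (ξ , O₁.≤-refl , ¬lim , eq))
          λ (ξ , ξ<γ , _ , q∈) → A-⊆ (inj₁ ξ<γ) q q∈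

        legal : ∀ γ → ¬ O₁.Lim γ → *-LegalI ω₁ P A b γ
        legal = O₁.wf-induction _ λ γ ih ¬lim → record
          { nonempty   = x O₁.zero , ∈⁺ (Played x γ) (O₁.zero , O₁.zero-≤ , O₁.¬Lim-zero , refl)
          ; countable  = Injects-⊆ (λ q q∈ → let ξ , ξ≤ , _ , eq = ∈⁻ (Played x γ) q∈ in
                           ξ , O₁.≤-<-trans ξ≤ O₁.<suc , eq)
                           (Countable-image x (proj₂ ω₁-succ (O₁.suc γ)))
          ; bounded    = x γ , λ q q∈ → let ξ , ξ≤ , ξ-¬lim , eq = ∈⁻ (Played x γ) q∈ in
                           subst (x γ ⊑_) (sym eq) (x-below γ (O₁.kind γ) ih ¬lim ξ ξ≤ ξ-¬lim)
          ; increasing = λ ξ ξ<γ _ → A-⊆ (inj₁ ξ<γ)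
          ; below      = λ δ succ → subst (λ γ → _≤𝓑_ P (⋀ P (A γ)) (ι P (b δ)))
                           (sym (O₁.IsSuccessorOf⇒≡ succ))
                           (⋀-below P (∈⁺ (Played x (O₁.suc δ)) (O₁.suc δ , O₁.≤-refl , O₁.¬Lim-suc , refl)) (x-suc-below δ))
          }
          where
          x-suc-below : ∀ δ → x (O₁.suc δ) ⊑ b δ
          x-suc-below δ = subst (_⊑ b δ) (sym (x-suc δ)) (proj₁ (proj₂ (dense δ (b δ))))

          x-below : ∀ γ → O₁.Kind γ → (∀ δ → δ O₁.< γ → ¬ O₁.Lim δ → *-LegalI ω₁ P A b δ) →
                    ¬ O₁.Lim γ → ∀ ξ → ξ O₁.≤ γ → ¬ O₁.Lim ξ → x γ ⊑ x ξ
          x-below γ _ ih _ ξ (inj₂ refl) _ = ⊑-refl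
          x-below _ O₁.is-zero ih _ ξ (inj₁ ξ<0) _ = contradiction ξ<0 (O₁.≤⇒≯ O₁.zero-≤)
          x-below γ (O₁.is-lim lim) ih ¬lim _ _ _ = contradiction lim ¬lim
          x-below _ (O₁.is-suc δ) ih _ ξ (inj₁ ξ<) ξ-¬lim = ⊑-trans (x-suc-below δ)
            (proj₁ (win A unions) δ (λ η η≤δ → ih η (O₁.≤-<-trans η≤δ O₁.<suc)) (x ξ)
              (∈⁺ (Played x δ) (ξ , O₁.<suc⇒≤ ξ< , ξ-¬lim , refl)))

      -- At turn `i + 1` Player I adds a condition of `E i` below II's last answer, and `q` is II's
      -- ω₁-th move. `E i` need not be closed downwards, so it is asserted of some `r` above `q`.
      ω₁-distributive : ∃ λ q → q ⊑ p₀ × (∀ i → ∃ λ r → q ⊑ r × E i r)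
      ω₁-distributive with q , q-ext ← proj₂ (win A unions) legal
        = q
        , subst (q ⊑_) x-zero (q⊑x O₁.zero O₁.¬Lim-zero)
        , λ i → x (O₁.suc i) , q⊑x (O₁.suc i) O₁.¬Lim-suc
              , subst (E i) (sym (x-suc i)) (proj₂ (proj₂ (dense i (b i))))
        where
        q⊑x : ∀ ξ → ¬ O₁.Lim ξ → q ⊑ x ξ
        q⊑x ξ ¬lim = q-ext (x ξ) (ξ , ¬lim , ∈⁺ (Played x ξ) (ξ , O₁.≤-refl , ¬lim , refl))

  module _ (P : Poset) (closed : StrategicallyClosed ω₂ P) where
    open Poset P
    open Strategy (proj₁ closed)

    module _ (E : ∣ ω₂ ∣ → Pred ⟨ P ⟩ 0ℓ) (dense : ∀ i q → ∃ λ r → r ⊑ q × E i r) where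
      private
        step : ∀ {γ} → (∣ ω₂ ∣ → ⟨ P ⟩) → O₂.Kind γ → ⟨ P ⟩
        step ih O₂.is-zero    = 𝟙
        step ih (O₂.is-suc δ) = proj₁ (dense δ (answer δ ih))
        step ih (O₂.is-lim _) = 𝟙

        open WfRecursion O₂.wellFounded 𝟙 (λ γ ih → step ih (O₂.kind γ))
          renaming (rec to a)

        b : ∣ ω₂ ∣ → ⟨ P ⟩
        b γ = answer γ a

        a-suc : ∀ δ → a (O₂.suc δ) ≡ proj₁ (dense δ (b δ))
        a-suc δ = trans (unfold (O₂.suc δ))
            (trans (go (O₂.kind (O₂.suc δ)) refl)
              (cong (proj₁ ∘ dense δ)
                (causal δ _ _ λ ξ ξ≤δ _ → cut-≡ (O₂.≤-<-trans ξ≤δ O₂.<suc))))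
          where
          go : ∀ {γ ih} (k : O₂.Kind γ) → γ ≡ O₂.suc δ → step ih k ≡ proj₁ (dense δ (answer δ ih))
          go O₂.is-zero eq = ⊥-elim (O₂.≤⇒≯ O₂.zero-≤ (subst (δ O₂.<_) (sym eq) O₂.<suc))
          go (O₂.is-suc δ′) eq with refl ← O₂.suc-injective eq = refl
          go (O₂.is-lim lim) refl = contradiction lim O₂.¬Lim-suc

        legal : ∀ γ → ¬ O₂.Lim γ → LegalI ω₂ P a b γ
        legal = O₂.wf-induction _ λ γ ih → go γ (O₂.kind γ) ih
          where
          go : ∀ γ → O₂.Kind γ → (∀ δ → δ O₂.< γ → ¬ O₂.Lim δ → LegalI ω₂ P a b δ) →
               ¬ O₂.Lim γ → LegalI ω₂ P a b γ
          go _ O₂.is-zero      ih _    ξ ξ<0 = contradiction ξ<0 (O₂.≤⇒≯ O₂.zero-≤)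
          go γ (O₂.is-lim lim) ih ¬lim = contradiction lim ¬lim
          go _ (O₂.is-suc δ)   ih _    ξ ξ<
            with b⊑a , b⊑b ← proj₂ closed a δ (λ η η≤δ → ih η (O₂.≤-<-trans η≤δ O₂.<suc))
            = (λ ¬lim → ⊑-trans a⊑b (b⊑a ξ (O₂.<suc⇒≤ ξ<) ¬lim))
            , [ (λ ξ<δ → ⊑-trans a⊑b (b⊑b ξ ξ<δ)) , (λ { refl → a⊑b }) ]′ (O₂.<suc⇒≤ ξ<)
            where
            a⊑b : a (O₂.suc δ) ⊑ b δ
            a⊑b = subst (_⊑ b δ) (sym (a-suc δ)) (proj₁ (proj₂ (dense δ (b δ))))

        Passed : Pred ⟨ P ⟩ 0ℓ
        Passed p = ∃ λ γ → ¬ O₂.Lim γ × a γ ⊑ p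

        F : 𝒫 ⟨ P ⟩
        F = ⟦ Passed ⟧

        a-antitone : ∀ {γ δ} → γ O₂.≤ δ → ¬ O₂.Lim γ → ¬ O₂.Lim δ → a δ ⊑ a γ
        a-antitone (inj₂ refl) _     _     = ⊑-refl
        a-antitone (inj₁ γ<δ)  γ-¬lim δ-¬lim = proj₁ (legal _ δ-¬lim _ γ<δ) γ-¬lim

        a∈F : ∀ γ → ¬ O₂.Lim γ → a γ ∈ F
        a∈F γ ¬lim = ∈⁺ Passed (γ , ¬lim , ⊑-refl)

      -- Player I's move at turn `i + 1` enters `E i` below II's answer at turn `i`. Legal moves at
      -- non-limit turns descend, so their upward closure is a filter.
      generic-filter : ∃ λ F → IsFilter F × (∀ i → ∃ λ p → p ∈ F × E i p)
      generic-filter = F , record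
          { nonempty = a O₂.zero , a∈F O₂.zero O₂.¬Lim-zero
          ; upward   = λ p q p∈F p⊑q → let γ , ¬lim , a⊑p = ∈⁻ Passed p∈F in
                         ∈⁺ Passed (γ , ¬lim , ⊑-trans a⊑p p⊑q)
          ; directed = directed
          }
        , λ i → a (O₂.suc i) , a∈F (O₂.suc i) O₂.¬Lim-suc
              , subst (E i) (sym (a-suc i)) (proj₂ (proj₂ (dense i (b i))))
        where
        directed : ∀ p q → p ∈ F → q ∈ F → ∃ λ r → r ∈ F × r ⊑ p × r ⊑ q
        directed p q p∈F q∈F
          with γ , γ-¬lim , aγ⊑p ← ∈⁻ Passed p∈F | δ , δ-¬lim , aδ⊑q ← ∈⁻ Passed q∈F
          with O₂.<-or-≥ γ δ
        ... | inj₁ γ<δ = a δ , a∈F δ δ-¬lim , ⊑-trans (a-antitone (inj₁ γ<δ) γ-¬lim δ-¬lim) aγ⊑p , aδ⊑q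
        ... | inj₂ δ≤γ = a γ , a∈F γ γ-¬lim , aγ⊑p , ⊑-trans (a-antitone δ≤γ δ-¬lim γ-¬lim) aδ⊑q

    StrategicallyClosed⇒MA-for : MA-for ω₂ P
    StrategicallyClosed⇒MA-for I I↣ω₂ D D-dense =
      let F , F-filter , meets = generic-filter E E-dense
      in F , F-filter , λ i → let p , p∈F , p∈D = meets (to i) in p , p∈F , p∈D i refl
      where
      open Injection I↣ω₂ using (to; injective)

      -- The dense sets are distributed over the turns by the given injection; at a turn outside its
      -- range the demand is vacuous.
      E : ∣ ω₂ ∣ → Pred ⟨ P ⟩ 0ℓ
      E α p = ∀ i → to i ≡ α → p ∈ D i

      E-dense : ∀ α q → ∃ λ r → r ⊑ q × E α r
      E-dense α q with dec (∃ λ i → to i ≡ α)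
      ... | no ∄i = q , ⊑-refl , λ i eq → contradiction (i , eq) ∄i
      ... | yes (i , eq) = let r , r⊑q , r∈D = D-dense i q in
        r , r⊑q , λ j eq′ → subst (λ k → r ∈ D k) (injective (trans eq (sym eq′))) r∈D

-- Strategic closure from a coherent sequence

module Climbing (em : ∀ ℓ → ExcludedMiddle ℓ) (ext : ∀ a b → Extensionality a b)
                (ω₁ ω₂ : WellOrder)
                (ω₁-succ : IsCardinalSuccessor ω ω₁)
                (ω₂-succ : IsCardinalSuccessor ω₁ ω₂) where

  open Classical em ext
  open Ordinals em ext ω₁ ω₂ ω₁-succ ω₂-succ
  open Ladders em ext ω₁ ω₂ ω₁-succ ω₂-succ
  open Games em ext ω₁ ω₂ ω₁-succ ω₂-succ
  open O₂

  Chain : ℕ → (ℕ → ∣ ω₂ ∣) → Set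
  Chain n s = π (s 0) ≡ nothing × (∀ k → k ℕ.< n → π (s (ℕ.suc k)) ≡ just (s k))

  Chain-restrict : ∀ {m n s} → m ℕ.≤ n → Chain n s → Chain m s
  Chain-restrict m≤n (r , p) = r , λ k k<m → p k (ℕ.≤-trans k<m m≤n)

  -- `π` determines a chain downwards from its last element, and the chain can only stop where `π`
  -- is `nothing`; so the top fixes the length as well.
  Chain-unique : ∀ n n′ {s s′} → Chain n s → Chain n′ s′ → s n ≡ s′ n′ →
                 n ≡ n′ × (∀ m → m ℕ.≤ n → s m ≡ s′ m)
  Chain-unique ℕ.zero ℕ.zero _ _ eq = refl , λ where _ ℕ.z≤n → eq
  Chain-unique ℕ.zero (ℕ.suc n′) (r , _) (_ , p′) eq
    with () ← trans (sym r) (trans (cong π eq) (p′ n′ ℕ.≤-refl))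
  Chain-unique (ℕ.suc n) ℕ.zero (_ , p) (r′ , _) eq
    with () ← trans (sym r′) (trans (cong π (sym eq)) (p n ℕ.≤-refl))
  Chain-unique (ℕ.suc n) (ℕ.suc n′) {s} {s′} c@(_ , p) c′@(_ , p′) eq
    with refl , agree ← Chain-unique n n′ (Chain-restrict (ℕ.n≤1+n n) c)
           (Chain-restrict (ℕ.n≤1+n n′) c′)
           (just-injective (trans (sym (p n ℕ.≤-refl)) (trans (cong π eq) (p′ n′ ℕ.≤-refl))))
    = refl , λ m m≤ → [ (λ m< → agree m (ℕ.≤-pred m<)) , (λ { refl → eq }) ]′ (ℕ.m≤n⇒m<n∨m≡n m≤)

  Chain-≤ : ∀ n {s} → Chain n s → ∀ m → m ℕ.≤ n → s m ≤ s n
  Chain-≤ ℕ.zero    c         _ ℕ.z≤n = ≤-refl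
  Chain-≤ (ℕ.suc n) c@(_ , p) m m≤ with ℕ.m≤n⇒m<n∨m≡n m≤
  ... | inj₂ refl = ≤-refl
  ... | inj₁ m<   = inj₁ (≤-<-trans (Chain-≤ n (Chain-restrict (ℕ.n≤1+n n) c) m (ℕ.≤-pred m<))
                                     (π-< (p n ℕ.≤-refl)))

  Chain-¬Lim : ∀ n {s} → Chain n s → ¬ Lim (s n) → ∀ m → m ℕ.≤ n → ¬ Lim (s m)
  Chain-¬Lim n (_ , p) ¬lim m m≤n with ℕ.m≤n⇒m<n∨m≡n m≤n
  ... | inj₂ refl = ¬lim
  ... | inj₁ m<n  = π-¬Lim (p m m<n)

  module _ (P : Poset) {τ : *-Operation ω₁ P} (win : Winning* ω₁ P τ)
           (z : Sequence ω₁ ω₂) (f : ∣ ω₂ ∣ → ∣ ω₁ ∣)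
           (z-cofinal : ∀ α → S₀ α → CountableCofinal ω₁ ω₂ (z α) α)
           -- One hypothesis for both uses: either `f` recovers the turn `i` from the `i`-th point
           -- of the club, or `τ` does not depend on the turn.
           (coherent : ∀ β → S₁ β → ∃ λ C → Σ (CoherentClub⁻ ω₁ ω₂ z β C) λ coh →
             ∀ i A → τ (f (proj₁ (CoherentClub⁻.orderType coh) i)) A ≡ τ i A) where
    open Poset P

    private
      initial-cong : ∀ {p p′ : ℕ → ⟨ P ⟩} n → (∀ m → m ℕ.≤ n → p m ≡ p′ m) →
                     response P τ win p n ≡ response P τ win p′ n
      initial-cong n agree = cong (τ (ν n)) (⟦⟧-cong
        (λ q (m , m≤n , eq) → m , m≤n , trans eq (agree m m≤n))
        (λ q (m , m≤n , eq) → m , m≤n , trans eq (sym (agree m m≤n))))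

      LowerBound : ∣ ω₂ ∣ → (∣ ω₂ ∣ → ⟨ P ⟩) → Pred ⟨ P ⟩ 0ℓ
      LowerBound γ a q = ∀ ξ → ξ < γ → ¬ Lim ξ → q ⊑ a ξ

      -- Successors are taken because an element of `z γ` may be a limit, where Player I does not
      -- move, and because `a (suc ξ)` lies below II's answer at `ξ`, as the rules of G* require of
      -- the next set.
      Moves : ∣ ω₂ ∣ → (∣ ω₂ ∣ → ⟨ P ⟩) → Pred ⟨ P ⟩ 0ℓ
      Moves γ a q = ∃ λ ξ → ξ ∈ z γ × q ≡ a (suc ξ)

      guess : ∣ ω₂ ∣ → (∣ ω₂ ∣ → ⟨ P ⟩) → ⟨ P ⟩
      guess γ a = τ (f γ) ⟦ Moves γ a ⟧

      OnChain : ∣ ω₂ ∣ → Set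
      OnChain γ = ∃₂ λ n s → Chain n s × s n ≡ γ

      chain-answer : ∀ γ → (∣ ω₂ ∣ → ⟨ P ⟩) → Dec (OnChain γ) → ⟨ P ⟩
      chain-answer γ a (yes (n , s , _)) = response P τ win (a ∘ s) n
      chain-answer γ a (no _)            = a γ

      -- A limit need not lie on a coherent club, so the guess is played only if it is a lower
      -- bound, and otherwise any lower bound is taken. The last clause does not arise as long as
      -- Player I moves legally.
      limit-answer : ∀ γ a → Dec (LowerBound γ a (guess γ a)) → Dec (∃ (LowerBound γ a)) → ⟨ P ⟩
      limit-answer γ a (yes _) _             = guess γ a
      limit-answer γ a (no _)  (yes (q , _)) = q
      limit-answer γ a (no _)  (no _)        = 𝟙

      answer₀ : ∀ γ → (∣ ω₂ ∣ → ⟨ P ⟩) → Dec (Lim γ) → ⟨ P ⟩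
      answer₀ γ a (yes _) = limit-answer γ a (dec _) (dec _)
      answer₀ γ a (no _)  = chain-answer γ a (dec _)

      visible : ∀ γ → (∣ ω₂ ∣ → ⟨ P ⟩) → ∀ ξ → Dec (ξ ≤ γ × ¬ Lim ξ) → ⟨ P ⟩
      visible γ a ξ (yes _) = a ξ
      visible γ a ξ (no _)  = 𝟙

      -- Choices made by excluded middle are causal only if the moves of I
      -- that are not yet known are erased.
      history : ∣ ω₂ ∣ → (∣ ω₂ ∣ → ⟨ P ⟩) → ∣ ω₂ ∣ → ⟨ P ⟩
      history γ a ξ = visible γ a ξ (dec _)

      history-≡ : ∀ {γ} a {ξ} → ξ ≤ γ → ¬ Lim ξ → history γ a ξ ≡ a ξ
      history-≡ {γ} a {ξ} ξ≤γ ¬lim with dec (ξ ≤ γ × ¬ Lim ξ)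
      ... | yes _ = refl
      ... | no ¬p = contradiction (ξ≤γ , ¬lim) ¬p

      history-causal : ∀ γ a a′ → (∀ ξ → ξ ≤ γ → ¬ Lim ξ → a ξ ≡ a′ ξ) →
                       history γ a ≡ history γ a′
      history-causal γ a a′ agree = ext 0ℓ 0ℓ λ ξ → go ξ (dec _)
        where
        go : ∀ ξ d → visible γ a ξ d ≡ visible γ a′ ξ d
        go ξ (yes (ξ≤γ , ¬lim)) = agree ξ ξ≤γ ¬lim
        go ξ (no _)             = refl

    strategy : Strategy ω₂ P
    strategy = record
      { answer = λ γ a → answer₀ γ (history γ a) (dec _)
      ; causal = λ γ a a′ agree → cong (λ a → answer₀ γ a (dec _)) (history-causal γ a a′ agree)
      }

    open Strategy strategy

    private
      answer-chain : ∀ n s → Chain n s → ¬ Lim (s n) → ∀ a →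
                     answer (s n) a ≡ response P τ win (a ∘ s) n
      answer-chain n s chain ¬lim a with dec (Lim (s n))
      ... | yes lim = contradiction lim ¬lim
      ... | no _ with dec (OnChain (s n))
      ...   | no ∄chain = contradiction (n , s , chain , refl) ∄chain
      ...   | yes (n′ , s′ , chain′ , eq)
        with refl , agree ← Chain-unique n n′ chain chain′ (sym eq)
        = initial-cong n λ m m≤n → trans
            (history-≡ a (subst (_≤ s n) (agree m m≤n) (Chain-≤ n chain m m≤n))
              (subst (¬_ ∘ Lim) (agree m m≤n) (Chain-¬Lim n chain ¬lim m m≤n)))
            (cong a (sym (agree m m≤n)))

      answer-off-chain : ∀ γ → ¬ OnChain γ → ¬ Lim γ → ∀ a → answer γ a ≡ a γ
      answer-off-chain γ ∄chain ¬lim a with dec (Lim γ)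
      ... | yes lim = contradiction lim ¬lim
      ... | no _ with dec (OnChain γ)
      ...   | yes chain = contradiction chain ∄chain
      ...   | no _      = history-≡ a ≤-refl ¬lim

      LowerBound-history : ∀ {γ a q} → LowerBound γ (history γ a) q → LowerBound γ a q
      LowerBound-history {a = a} {q} lb ξ ξ<γ ¬lim =
        subst (q ⊑_) (history-≡ a (inj₁ ξ<γ) ¬lim) (lb ξ ξ<γ ¬lim)

      history-LowerBound : ∀ {γ a q} → LowerBound γ a q → LowerBound γ (history γ a) q
      history-LowerBound {a = a} {q} lb ξ ξ<γ ¬lim =
        subst (q ⊑_) (sym (history-≡ a (inj₁ ξ<γ) ¬lim)) (lb ξ ξ<γ ¬lim)

      answer-limit : ∀ γ → Lim γ → ∀ a → ∃ (LowerBound γ a) → LowerBound γ a (answer γ a)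
      answer-limit γ lim a (q , lb) with dec (Lim γ)
      ... | no ¬lim = contradiction lim ¬lim
      ... | yes _ with dec (LowerBound γ (history γ a) (guess γ (history γ a)))
                     | dec (∃ (LowerBound γ (history γ a)))
      ...   | yes lb′ | _            = LowerBound-history lb′
      ...   | no _    | yes (_ , lb′) = LowerBound-history lb′
      ...   | no _    | no ∄q        = contradiction (q , history-LowerBound lb) ∄q

      guess-history : ∀ γ → S₀ γ → ∀ a → guess γ (history γ a) ≡ guess γ a
      guess-history γ s₀ a = cong (τ (f γ)) (⟦⟧-cong
        (λ q (ξ , ξ∈z , eq) → ξ , ξ∈z , trans eq (known ξ ξ∈z))
        (λ q (ξ , ξ∈z , eq) → ξ , ξ∈z , trans eq (sym (known ξ ξ∈z))))
        where
        known : ∀ ξ → ξ ∈ z γ → history γ a (suc ξ) ≡ a (suc ξ)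
        known ξ ξ∈z = history-≡ a (suc-least (proj₁ (proj₂ (z-cofinal γ s₀)) ξ ξ∈z)) ¬Lim-suc

      answer-guess : ∀ γ → S₀ γ → ∀ a → LowerBound γ a (guess γ a) → answer γ a ≡ guess γ a
      answer-guess γ s₀ a lb with dec (Lim γ)
      ... | no ¬lim = contradiction (S₀⇒Lim s₀) ¬lim
      ... | yes _ with dec (LowerBound γ (history γ a) (guess γ (history γ a)))
      ...   | yes _  = guess-history γ s₀ a
      ...   | no ¬lb = contradiction
        (history-LowerBound (subst (LowerBound γ a) (sym (guess-history γ s₀ a)) lb)) ¬lb

      module _ (a : ∣ ω₂ ∣ → ⟨ P ⟩) where

        b : ∣ ω₂ ∣ → ⟨ P ⟩
        b γ = answer γ a

        LegalUpTo : ∣ ω₂ ∣ → Set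
        LegalUpTo γ = ∀ ξ → ξ ≤ γ → ¬ Lim ξ → LegalI ω₂ P a b ξ

        a-antitone : ∀ {γ} → LegalUpTo γ → ∀ {ξ η} → ξ ≤ η → η ≤ γ → ¬ Lim ξ → ¬ Lim η → a η ⊑ a ξ
        a-antitone legal (inj₂ refl) _   _      _      = ⊑-refl
        a-antitone legal (inj₁ ξ<η)  η≤γ ξ-¬lim η-¬lim = proj₁ (legal _ η≤γ η-¬lim _ ξ<η) ξ-¬lim

        follows : ∀ {γ} → LegalUpTo γ → ∀ n s → Chain (ℕ.suc n) s → s (ℕ.suc n) ≤ γ →
                  ¬ Lim (s (ℕ.suc n)) → a (s (ℕ.suc n)) ⊑ response P τ win (a ∘ s) n
        follows legal n s chain ≤γ ¬lim = subst (a (s (ℕ.suc n)) ⊑_)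
          (answer-chain n s (Chain-restrict (ℕ.n≤1+n n) chain)
            (Chain-¬Lim (ℕ.suc n) chain ¬lim n (ℕ.n≤1+n n)) a)
          (proj₂ (legal (s (ℕ.suc n)) ≤γ ¬lim (s n) (π-< (proj₂ chain n ℕ.≤-refl))))

        answer-⊑ : ∀ γ → LegalUpTo γ → ¬ Lim γ → b γ ⊑ a γ
        answer-⊑ γ legal ¬lim with dec (OnChain γ)
        ... | no ∄chain = subst (_⊑ a γ) (sym (answer-off-chain γ ∄chain ¬lim a)) ⊑-refl
        ... | yes (n , s , chain , refl) =
          subst (_⊑ a (s n)) (sym (answer-chain n s chain ¬lim a))
            (finite-play P τ win (a ∘ s) n λ m m<n →
              follows legal m s (Chain-restrict m<n chain) (Chain-≤ n chain (ℕ.suc m) m<n)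
                (Chain-¬Lim n chain ¬lim (ℕ.suc m) m<n))

        S₀-bound : ∀ γ → LegalUpTo γ → S₀ γ → ∃ (LowerBound γ a)
        S₀-bound γ legal s₀ =
          let q , q⊑ = infinite-play P τ win (a ∘ rung s₀) λ m →
                follows legal m (rung s₀) (π-rung-zero s₀ , λ k _ → π-rung-suc s₀ k)
                  (inj₁ (rung<γ s₀ (ℕ.suc m))) (¬Lim-rung s₀ (ℕ.suc m))
          in q , λ ξ ξ<γ ¬lim → let n , ξ≤ = rung-cofinal s₀ ξ ξ<γ in
               ⊑-trans (q⊑ n) (a-antitone legal ξ≤ (inj₁ (rung<γ s₀ n)) ¬lim (¬Lim-rung s₀ n))

        S₁-bound : ∀ β → LegalUpTo β → (∀ δ → δ < β → LegalII ω₂ P a b δ) → S₁ β →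
                   ∃ (LowerBound β a)
        S₁-bound β legal ih s₁
          with C , coh , τ-eq ← coherent β s₁
          = bound
          where
          open CoherentClub⁻ coh
          open IsClub isClub using (subset; unbounded)

          open Enumeration orderType renaming (e∈ to e∈C)

          e<β : ∀ i → e i < β
          e<β i = proj₁ (subset (e i) (e∈C i))

          e∈S₀ : ∀ i → S₀ (e i)
          e∈S₀ i = proj₂ (subset (e i) (e∈C i))

          A : ∣ ω₁ ∣ → 𝒫 ⟨ P ⟩
          A i = ⟦ Moves (e i) a ⟧

          b* : ∣ ω₁ ∣ → ⟨ P ⟩
          b* i = τ i (A i)

          A-⊆ : ∀ {i j} → i O₁.< j → A i ⊆ A j
          A-⊆ {i} {j} i<j q q∈ =
            let ξ , ξ∈ , eq = ∈⁻ (Moves (e i) a) q∈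
            in ∈⁺ (Moves (e j) a) (ξ , increasing _ _ (e∈C i) (e∈C j) (e-mono i<j) ξ ξ∈ , eq)

          unions : UnionsAtLimits ω₁ P A
          unions γ γ-lim@((i₀ , i₀<γ) , _) q = mk⇔
            (λ q∈ →
              let ξ , ξ∈ , eq = ∈⁻ (Moves (e γ) a) q∈
                  ζ , ζ∈C , ζ< , ξ∈zζ = Equivalence.to (continuous (e γ) (e∈C γ)
                    (e i₀ , e∈C i₀ , e-mono i₀<γ) C-no-maximum ξ) ξ∈
                  i , ei≡ζ = e-onto ζ ζ∈C
                  i<γ = e-reflect (subst (_< e γ) (sym ei≡ζ) ζ<)
              in O₁.suc i , O₁.Lim-suc γ-lim i<γ , O₁.¬Lim-suc ,
                 A-⊆ O₁.<suc q (∈⁺ (Moves (e i) a) (ξ , subst (λ ζ → ξ ∈ z ζ) (sym ei≡ζ) ξ∈zζ , eq)))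
            λ (ξ , ξ<γ , _ , q∈) → A-⊆ ξ<γ q q∈
            where
            C-no-maximum : ∀ ξ → ξ ∈ C → ξ < e γ → ∃ λ η → η ∈ C × ξ < η × η < e γ
            C-no-maximum ξ ξ∈C ξ< with i , refl ← e-onto ξ ξ∈C =
              e (O₁.suc i) , e∈C _ , e-mono O₁.<suc , e-mono (O₁.Lim-suc γ-lim (e-reflect ξ<))

          extends⇒bound : ∀ i {q} → CommonExtension q (_∈ A i) → LowerBound (e i) a q
          extends⇒bound i q-ext ξ ξ<e ¬lim =
            let η , η∈ , η<e , ξ≤η = proj₂ (proj₂ (z-cofinal (e i) (e∈S₀ i))) ξ ξ<e
            in ⊑-trans (q-ext (a (suc η)) (∈⁺ (Moves (e i) a) (η , η∈ , refl)))
                 (a-antitone legal (inj₁ (≤-<-trans ξ≤η <suc))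
                   (inj₁ (<-trans (Lim-suc (S₀⇒Lim (e∈S₀ i)) η<e) (e<β i))) ¬lim ¬Lim-suc)

          -- Legality is proved together with the fact that II really plays `τ` at the earlier
          -- points of the club: legality up to `j` makes `τ`'s answer extend `A j`, hence a lower
          -- bound at `e j`, hence the guess is what she plays.
          *-legal : ∀ i → ¬ O₁.Lim i → *-LegalI ω₁ P A b* i
          *-legal = O₁.wf-induction _ λ i ih* _ → record
            { nonempty   = let (x , x<) , _ = S₀⇒Lim (e∈S₀ i)
                               η , η∈ , _ = proj₂ (proj₂ (z-cofinal (e i) (e∈S₀ i))) x x<
                           in a (suc η) , ∈⁺ (Moves (e i) a) (η , η∈ , refl)
            ; countable  = Injects-⊆ (λ _ → ∈⁻ (Moves (e i) a))
                             (Countable-image (a ∘ suc) (proj₁ (z-cofinal (e i) (e∈S₀ i))))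
            ; bounded    = b (e i) , λ q q∈ →
                             let ξ , ξ∈ , eq = ∈⁻ (Moves (e i) a) q∈
                                 ξ<e = proj₁ (proj₂ (z-cofinal (e i) (e∈S₀ i))) ξ ξ∈
                             in subst (b (e i) ⊑_) (sym eq)
                                  (proj₁ (ih (e i) (e<β i)) (suc ξ) (suc-least ξ<e) ¬Lim-suc)
            ; increasing = λ j j<i _ → A-⊆ j<i
            -- `z (e i)` is cofinal in `e i`, so it contains some `η ≥ e j`; the move at `η + 1`
            -- comes after II's answer at `e j`.
            ; below      = λ j (j<i , _) →
                let η , η∈ , η<e , e≤η =
                      proj₂ (proj₂ (z-cofinal (e i) (e∈S₀ i))) (e j) (e-mono j<i)
                in ⋀-below P (∈⁺ (Moves (e i) a) (η , η∈ , refl))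
                     (subst (a (suc η) ⊑_) (b≡b* j λ k k≤j → ih* k (O₁.≤-<-trans k≤j j<i))
                       (proj₂ (legal (suc η)
                         (inj₁ (<-trans (Lim-suc (S₀⇒Lim (e∈S₀ i)) η<e) (e<β i))) ¬Lim-suc
                         (e j) (≤-<-trans e≤η <suc))))
            }
            where
            b≡b* : ∀ j → (∀ k → k O₁.≤ j → ¬ O₁.Lim k → *-LegalI ω₁ P A b* k) → b (e j) ≡ b* j
            b≡b* j legal* = trans (answer-guess (e j) (e∈S₀ j) a
              (subst (LowerBound (e j) a) (sym (τ-eq j (A j)))
                (extends⇒bound j (proj₁ (win A unions) j legal*)))) (τ-eq j (A j))

          bound : ∃ (LowerBound β a)
          bound with q , q-ext ← proj₂ (win A unions) *-legal = q , λ ξ ξ<β ¬lim →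
            let ζ , ζ∈C , _ , ξ≤ζ = unbounded ξ ξ<β
                i , ei≡ζ = e-onto ζ ζ∈C
            -- II's last move is only known to extend the sets of non-limit turns, whence `suc i` in
            -- place of `i`.
            in extends⇒bound (O₁.suc i) (λ p p∈ → q-ext p (O₁.suc i , O₁.¬Lim-suc , p∈)) ξ
                 (≤-<-trans ξ≤ζ (subst (_< e (O₁.suc i)) ei≡ζ (e-mono O₁.<suc))) ¬lim

        wins : ∀ γ → LegalUpTo γ → LegalII ω₂ P a b γ
        wins = wf-induction _ step
          where
          step : ∀ γ → (∀ δ → δ < γ → LegalUpTo δ → LegalII ω₂ P a b δ) →
                 LegalUpTo γ → LegalII ω₂ P a b γ
          step γ ih legal = go (dec (Lim γ))
            where
            module _ (¬lim : ¬ Lim γ) where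
              b⊑a : b γ ⊑ a γ
              b⊑a = answer-⊑ γ legal ¬lim

            module _ (lim : Lim γ) where
              ih′ : ∀ δ → δ < γ → LegalII ω₂ P a b δ
              ih′ δ δ<γ = ih δ δ<γ λ ξ ξ≤δ → legal ξ (≤-trans ξ≤δ (inj₁ δ<γ))

              b-bound : LowerBound γ a (b γ)
              b-bound = answer-limit γ lim a
                ([ S₀-bound γ legal , S₁-bound γ legal ih′ ]′ (Lim⇒S₀⊎S₁ lim))

            go : Dec (Lim γ) → LegalII ω₂ P a b γ
            go (no ¬lim) =
                (λ ξ ξ≤γ ξ-¬lim → ⊑-trans (b⊑a ¬lim) (a-antitone legal ξ≤γ ≤-refl ξ-¬lim ¬lim))
              , λ ξ ξ<γ → ⊑-trans (b⊑a ¬lim) (proj₂ (legal γ ≤-refl ¬lim ξ ξ<γ))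
            go (yes lim) =
                (λ ξ ξ≤γ ¬lim → b-bound lim ξ (≤-Lim⇒< ¬lim lim ξ≤γ) ¬lim)
              , λ ξ ξ<γ → ⊑-trans (b-bound lim (suc ξ) (Lim-suc lim ξ<γ) ¬Lim-suc)
                  (proj₂ (legal (suc ξ) (suc-least ξ<γ) ¬Lim-suc ξ <suc))

    coherence⇒StrategicallyClosed : StrategicallyClosed ω₂ P
    coherence⇒StrategicallyClosed = strategy , wins

-- The posets of conditions, treated uniformly in f

module ConditionPosets (em : ∀ ℓ → ExcludedMiddle ℓ) (ext : ∀ a b → Extensionality a b)
                       (ω₁ ω₂ : WellOrder)
                       (ω₁-succ : IsCardinalSuccessor ω ω₁)
                       (ω₂-succ : IsCardinalSuccessor ω₁ ω₂)
                       (F : Set) (index : ∣ ω₁ ∣ → F) where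

  open Classical em ext
  open Ordinals em ext ω₁ ω₂ ω₁-succ ω₂-succ
  open O₂

  -- F = ω₁ with the identity gives SCP, and the one-point set F gives SCP⁻.
  record Coherent (z : Sequence ω₁ ω₂) (f : ∣ ω₂ ∣ → F) (β : ∣ ω₂ ∣) (C : 𝒫 ∣ ω₂ ∣) : Set where
    field
      coherent⁻ : CoherentClub⁻ ω₁ ω₂ z β C
    open CoherentClub⁻ coherent⁻ public
    field
      f-index : ∀ i → f (proj₁ orderType i) ≡ index i

  Coherent-cong : ∀ {z z′ f f′ β C} → (∀ α → α < β → S₀ α → z α ≡ z′ α) →
                  (∀ α → α < β → f α ≡ f′ α) → Coherent z f β C → Coherent z′ f′ β C
  Coherent-cong {z} {z′} {f} {f′} {β} {C} z≡ f≡ coh = record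
    { coherent⁻ = record
        { isClub     = isClub
        ; orderType  = orderType
        ; increasing = λ α α′ α∈ α′∈ α<α′ x x∈ →
            subst (x ∈_) (z-≡ α′∈) (increasing α α′ α∈ α′∈ α<α′ x (subst (x ∈_) (sym (z-≡ α∈)) x∈))
        ; continuous = λ α α∈ nonempty no-max x →
            let open Equivalence (continuous α α∈ nonempty no-max x) in mk⇔
              (λ x∈ → let ξ , ξ∈ , ξ<α , x∈zξ = to (subst (x ∈_) (sym (z-≡ α∈)) x∈)
                      in ξ , ξ∈ , ξ<α , subst (x ∈_) (z-≡ ξ∈) x∈zξ)
              (λ (ξ , ξ∈ , ξ<α , x∈) →
                subst (x ∈_) (z-≡ α∈) (from (ξ , ξ∈ , ξ<α , subst (x ∈_) (sym (z-≡ ξ∈)) x∈)))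
        }
    ; f-index = λ i → trans
        (sym (f≡ _ (proj₁ (IsClub.subset isClub _ (proj₁ (proj₂ orderType) i tt))))) (f-index i)
    }
    where
    open Coherent coh
    z-≡ : ∀ {α} → α ∈ C → z α ≡ z′ α
    z-≡ {α} α∈ = let α<β , s₀ = IsClub.subset isClub α α∈ in z≡ α α<β s₀

  CoherentSequence : Set
  CoherentSequence = ∃₂ λ z f →
    (∀ α → S₀ α → CountableCofinal ω₁ ω₂ (z α) α) × (∀ β → S₁ β → ∃ (Coherent z f β))

  record ConditionPoset : Set₁ where
    infix 4 _⊴_
    field
      Condition′ : Set
      β : Condition′ → ∣ ω₂ ∣
      z : Condition′ → Sequence ω₁ ω₂
      f : Condition′ → ∣ ω₂ ∣ → F
      β∈S₀     : ∀ p → S₀ (β p)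
      cofinal  : ∀ p α → S₀ α → α ≤ β p → CountableCofinal ω₁ ω₂ (z p α) α
      coherent : ∀ p γ → S₁ γ → γ < β p → ∃ (Coherent (z p) (f p) γ)
      make     : ∀ b y g → S₀ b →
                 (∀ α → S₀ α → α ≤ b → CountableCofinal ω₁ ω₂ (y α) α) →
                 (∀ γ → S₁ γ → γ < b → ∃ (Coherent y g γ)) →
                 ∃ λ p → β p ≡ b × z p ≡ y × f p ≡ g
      _⊴_      : Rel Condition′ 0ℓ
      ⊴-refl   : ∀ p → p ⊴ p
      ⊴-trans  : ∀ p q r → p ⊴ q → q ⊴ r → p ⊴ r
      ⊴-intro  : ∀ {p q} → β q ≤ β p → (∀ α → S₀ α → α ≤ β q → z q α ≡ z p α) →
                 (∀ α → α ≤ β q → f q α ≡ f p α) → p ⊴ q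
      ⊴-β      : ∀ {p q} → p ⊴ q → β q ≤ β p
      ⊴-z      : ∀ {p q} → p ⊴ q → ∀ α → S₀ α → α ≤ β q → z q α ≡ z p α
      ⊴-f      : ∀ {p q} → p ⊴ q → ∀ α → α ≤ β q → f q α ≡ f p α

    poset : Poset
    poset = withTop _⊴_ ⊴-refl ⊴-trans

  module ConditionTheory (ℚ : ConditionPoset) where
    open ConditionPoset ℚ renaming (Condition′ to Cond)
    open Poset poset using (_⊑_; ⊑-refl; ⊑-trans; CommonExtension; Compatible)

    GoodBelow : ∣ ω₂ ∣ → Sequence ω₁ ω₂ → (∣ ω₂ ∣ → F) → Set
    GoodBelow c y g = (∀ α → S₀ α → α < c → CountableCofinal ω₁ ω₂ (y α) α)
                    × (∀ γ → S₁ γ → γ < c → ∃ (Coherent y g γ))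

    Agrees : Cond → Sequence ω₁ ω₂ → (∣ ω₂ ∣ → F) → Set
    Agrees p y g = (∀ α → S₀ α → α ≤ β p → z p α ≡ y α) × (∀ α → α ≤ β p → f p α ≡ g α)

    coherent-agrees : ∀ {p y g γ} → Agrees p y g → S₁ γ → γ < β p → ∃ (Coherent y g γ)
    coherent-agrees {p} {γ = γ} (z≡ , f≡) s₁ γ<β = let C , coh = coherent p γ s₁ γ<β in
      C , Coherent-cong (λ α α<γ s₀ → z≡ α s₀ (inj₁ (<-trans α<γ γ<β)))
                        (λ α α<γ → f≡ α (inj₁ (<-trans α<γ γ<β))) coh

    S₁-≤β⇒<β : ∀ {p γ} → S₁ γ → γ ≤ β p → γ < β p
    S₁-≤β⇒<β     s₁ (inj₁ γ<β)  = γ<β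
    S₁-≤β⇒<β {p} s₁ (inj₂ refl) = contradiction s₁ (S₀-S₁-disjoint (β∈S₀ p))

    -- Conditions are initial segments of their extensions, so the order is tree-like: below a
    -- common extension, length decides comparability.
    ⊴-both : ∀ {s p q} → s ⊴ p → s ⊴ q → β p ≤ β q → q ⊴ p
    ⊴-both s⊴p s⊴q βp≤βq = ⊴-intro βp≤βq
      (λ α s₀ α≤ → trans (⊴-z s⊴p α s₀ α≤) (sym (⊴-z s⊴q α s₀ (≤-trans α≤ βp≤βq))))
      (λ α α≤ → trans (⊴-f s⊴p α α≤) (sym (⊴-f s⊴q α (≤-trans α≤ βp≤βq))))

    private
      update : {A : Set} → ∣ ω₂ ∣ → A → (∣ ω₂ ∣ → A) → ∣ ω₂ ∣ → A
      update {A} c v g α = go (dec (α ≡ c))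
        where
        go : Dec (α ≡ c) → A
        go (yes _) = v
        go (no _)  = g α

      update-≡ : ∀ {A : Set} c (v : A) g → update c v g c ≡ v
      update-≡ c v g with dec (c ≡ c)
      ... | yes _  = refl
      ... | no c≢c = contradiction refl c≢c

      update-< : ∀ {A : Set} {c} (v : A) g {α} → α < c → g α ≡ update c v g α
      update-< {c = c} v g {α} α<c with dec (α ≡ c)
      ... | yes refl = contradiction α<c <-irrefl
      ... | no _     = refl

    abstract
      -- Only the values at `c` are new, and the club of a `γ < c` never reaches `c`; so `w` and `v`
      -- can be prescribed freely.
      cap : ∀ {c y g} → S₀ c → GoodBelow c y g → ∀ w → CountableCofinal ω₁ ω₂ w c → ∀ v →
            ∃ λ p → β p ≡ c × z p c ≡ w × f p c ≡ v ×
                    (∀ q → β q < c → Agrees q y g → p ⊴ q)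
      cap {c} {y} {g} s₀ (cof , coh) w w-cof v
        with p , refl , z≡ , f≡ ← make c (update c w y) (update c v g) s₀
               (λ where
                 α _  (inj₂ refl) → subst (λ w → CountableCofinal ω₁ ω₂ w c) (sym (update-≡ c w y)) w-cof
                 α sα (inj₁ α<c)  →
                   subst (λ w → CountableCofinal ω₁ ω₂ w α) (update-< w y α<c) (cof α sα α<c))
               (λ γ s₁ γ<c → let C , coh-C = coh γ s₁ γ<c in
                 C , Coherent-cong (λ α α<γ _ → update-< w y (<-trans α<γ γ<c))
                                   (λ α α<γ → update-< v g (<-trans α<γ γ<c)) coh-C)
        = p , refl , trans (cong (λ y → y c) z≡) (update-≡ c w y)
        , trans (cong (λ g → g c) f≡) (update-≡ c v g)
        , λ q βq<c (z-q , f-q) → ⊴-intro (inj₁ βq<c)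
            (λ α sα α≤ → trans (z-q α sα α≤)
              (trans (update-< w y (≤-<-trans α≤ βq<c)) (cong (λ y → y α) (sym z≡))))
            (λ α α≤ → trans (f-q α α≤)
              (trans (update-< v g (≤-<-trans α≤ βq<c)) (cong (λ g → g α) (sym f≡))))

    β̂ : Maybe Cond → ∣ ω₂ ∣
    β̂ (just p) = β p
    β̂ nothing  = zero

    ẑ : Maybe Cond → Sequence ω₁ ω₂
    ẑ (just p) = z p
    ẑ nothing  = λ _ _ → false

    f̂ : Maybe Cond → ∣ ω₂ ∣ → F
    f̂ (just p) = f p
    f̂ nothing  = λ _ → index O₁.zero

    β̂-antitone : ∀ {p q} → p ⊑ q → β̂ q ≤ β̂ p
    β̂-antitone {p}      {nothing} _   = zero-≤
    β̂-antitone {just p} {just q}  p⊴q = ⊴-β p⊴q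

    zero<β : ∀ p → zero < β p
    zero<β p = let (x , x<β) , _ = S₀⇒Lim (β∈S₀ p) in ≤-<-trans zero-≤ x<β

    extension : ∀ p w → CountableCofinal ω₁ ω₂ w (next (β̂ p)) →
                ∃ λ r → β r ≡ next (β̂ p) × z r (next (β̂ p)) ≡ w × just r ⊑ p
    extension nothing w w-cof =
      let r , β≡ , z≡ , _ = cap {y = ẑ nothing} {f̂ nothing} S₀-next
            ((λ α s₀ α< → ⊥-elim (not-zero (S₀⇒Lim s₀) α<)) ,
             (λ γ s₁ γ< → ⊥-elim (not-zero (S₁⇒Lim s₁) γ<)))
            w w-cof (index O₁.zero)
      in r , β≡ , z≡ , tt
      where
      not-zero : ∀ {α} → Lim α → ¬ α < next zero
      not-zero lim@((x , x<α) , _) α< =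
        ≤⇒≯ zero-≤ (<-≤-trans (≤-<-trans zero-≤ x<α) (Lim-<next⇒≤ lim α<))
    extension (just p) w w-cof =
      let r , β≡ , z≡ , _ , extends = cap {y = z p} {f p} S₀-next
            ((λ α s₀ α< → cofinal p α s₀ (Lim-<next⇒≤ (S₀⇒Lim s₀) α<)) ,
             (λ γ s₁ γ< → coherent p γ s₁ (S₁-≤β⇒<β s₁ (Lim-<next⇒≤ (S₁⇒Lim s₁) γ<))))
            w w-cof (index O₁.zero)
      in r , β≡ , z≡ , extends p <next ((λ _ _ _ → refl) , (λ _ _ → refl))

    different⇒incompatible : ∀ {p q c} → S₀ c → c ≤ β p → c ≤ β q → z p c ≢ z q c →
                             ¬ Compatible (just p) (just q)
    different⇒incompatible {c = c} s₀ c≤βp c≤βq z≢ (just s , s⊴p , s⊴q) =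
      z≢ (trans (⊴-z s⊴p c s₀ c≤βp) (sym (⊴-z s⊴q c s₀ c≤βq)))

    -- If `p` and `q` are compatible but `p` is not below `q`, then `p` is the shorter one. It
    -- extends to length `β̂ p + ω`, still at most `β q`, with a top set different from the one `q`
    -- has there.
    separative : Separative poset
    separative p nothing p⋢q = contradiction tt p⋢q
    separative p (just q) p⋢q with dec (Compatible p (just q))
    ... | no ¬compatible = p , ⊑-refl {p} , ¬compatible
    ... | yes compatible
      with w , w-cof , w≢ ← S₀⇒another-cofinal-set (S₀-next {β̂ p}) (z q (next (β̂ p)))
      with r , β≡ , z≡ , r⊑p ← extension p w w-cof
      = just r , r⊑p , different⇒incompatible S₀-next (inj₂ (sym β≡))
          (next-least (S₀⇒Lim (β∈S₀ q)) (p-shorter p p⋢q compatible)) λ eq → w≢ (trans (sym z≡) eq)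
      where
      p-shorter : ∀ p → ¬ p ⊑ just q → Compatible p (just q) → β̂ p < β q
      p-shorter nothing  _   _ = zero<β q
      p-shorter (just p) p⋢q (just s , s⊴p , s⊴q) with <-or-≥ (β p) (β q)
      ... | inj₁ βp<βq = βp<βq
      ... | inj₂ βq≤βp = contradiction (⊴-both s⊴q s⊴p βq≤βp) p⋢q

    module Glue (J : Pred Cond 0ℓ) (directed : ∀ p q → J p → J q → ∃ λ r → r ⊴ p × r ⊴ q) where

      Covered : ∣ ω₂ ∣ → Set
      Covered α = ∃ λ p → J p × α ≤ β p

      private
        source : ∀ α → Dec (Covered α) → Maybe Cond
        source α (yes (p , _)) = just p
        source α (no _)        = nothing

      abstract
        glue-z : Sequence ω₁ ω₂
        glue-z α = ẑ (source α (dec _)) α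

        glue-f : ∣ ω₂ ∣ → F
        glue-f α = f̂ (source α (dec _)) α

        agrees : ∀ p → J p → Agrees p glue-z glue-f
        agrees p Jp = z-agrees , f-agrees
          where
          z-agrees : ∀ α → S₀ α → α ≤ β p → z p α ≡ glue-z α
          z-agrees α s₀ α≤ with dec (Covered α)
          ... | no ¬cov = contradiction (p , Jp , α≤) ¬cov
          ... | yes (q , Jq , α≤βq) = let r , r⊴p , r⊴q = directed p q Jp Jq in
            trans (⊴-z r⊴p α s₀ α≤) (sym (⊴-z r⊴q α s₀ α≤βq))

          f-agrees : ∀ α → α ≤ β p → f p α ≡ glue-f α
          f-agrees α α≤ with dec (Covered α)
          ... | no ¬cov = contradiction (p , Jp , α≤) ¬cov
          ... | yes (q , Jq , α≤βq) = let r , r⊴p , r⊴q = directed p q Jp Jq in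
            trans (⊴-f r⊴p α α≤) (sym (⊴-f r⊴q α α≤βq))

        good : ∀ c → (∀ α → α < c → Covered α) → GoodBelow c glue-z glue-f
        good c cover =
            (λ α s₀ α<c → let p , Jp , α≤ = cover α α<c in
              subst (λ w → CountableCofinal ω₁ ω₂ w α) (proj₁ (agrees p Jp) α s₀ α≤)
                (cofinal p α s₀ α≤))
          , (λ γ s₁ γ<c → let p , Jp , γ≤ = cover γ γ<c in
              coherent-agrees (agrees p Jp) s₁ (S₁-≤β⇒<β s₁ γ≤))

-- The winning operation on the poset of conditions

module ConditionGame (em : ∀ ℓ → ExcludedMiddle ℓ) (ext : ∀ a b → Extensionality a b)
                     (ω₁ ω₂ : WellOrder)
                     (ω₁-succ : IsCardinalSuccessor ω ω₁)
                     (ω₂-succ : IsCardinalSuccessor ω₁ ω₂)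
                     (F : Set) (index : ∣ ω₁ ∣ → F)
                     (ℚ : ConditionPosets.ConditionPoset em ext ω₁ ω₂ ω₁-succ ω₂-succ F index) where

  open Classical em ext
  open Ordinals em ext ω₁ ω₂ ω₁-succ ω₂-succ
  open Games em ext ω₁ ω₂ ω₁-succ ω₂-succ
  open O₂
  open ConditionPosets em ext ω₁ ω₂ ω₁-succ ω₂-succ F index
  open ConditionPoset ℚ renaming (Condition′ to Cond)
  open ConditionTheory ℚ
  open Poset poset using (_⊑_; ⊑-refl; ⊑-trans; CommonExtension; Compatible)

  -- The ω steps after each length make the supremum a limit above all the lengths even if `A` has a
  -- longest member. Moreover `Tails` commutes with unions, the source of continuity along the club.
  Tails : 𝒫 (Maybe Cond) → Pred ∣ ω₂ ∣ 0ℓ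
  Tails A η = ∃ λ q → q ∈ A × ∃ λ n → η ≡ iter n (β̂ q)

  Tails-mono : ∀ {A B} → A ⊆ B → ∀ η → Tails A η → Tails B η
  Tails-mono A⊆B η (q , q∈ , n , eq) = q , A⊆B q q∈ , n , eq

  -- II answers A with a condition p extending A for which β p is the least
  -- strict upper bound of the set Tails A, and z p (β p) is this set.
  Answer : F → 𝒫 (Maybe Cond) → Pred Cond 0ℓ
  Answer v A p = (∀ η → Tails A η → η < β p)
               × (∀ b → (∀ η → Tails A η → η < b) → β p ≤ b)
               × z p (β p) ≡ ⟦ Tails A ⟧
               × f p (β p) ≡ v
               × CommonExtension (just p) (_∈ A)

  Ready : 𝒫 (Maybe Cond) → Set
  Ready A = (∃ λ q → q ∈ A) × Countable (_∈ A) × (∃ λ r → CommonExtension r (_∈ A))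

  module _ {A : 𝒫 (Maybe Cond)} (ready : Ready A) where
    private
      r : Maybe Cond
      r = proj₁ (proj₂ (proj₂ ready))

      r-ext : CommonExtension r (_∈ A)
      r-ext = proj₂ (proj₂ (proj₂ ready))

    abstract
      Tails-countable : Countable (Tails A)
      Tails-countable = Injects-⊆ (λ η (q , q∈ , n , eq) → q , q∈ , n , tt , eq)
        (Countable-⋃ (proj₁ (proj₂ ready)) λ q _ →
          Countable-image {A = U} (λ n → iter n (β̂ q)) Countable-ℕ)

      top : ∣ ω₂ ∣
      top = sup (Countable⇒small Tails-countable) id

      <top : ∀ η → Tails A η → η < top
      <top = <sup (Countable⇒small Tails-countable) id

      top-least : ∀ b → (∀ η → Tails A η → η < b) → top ≤ b
      top-least = sup-least (Countable⇒small Tails-countable) id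

      <top⇒ : ∀ {ξ} → ξ < top → ∃ λ q → q ∈ A × ∃ λ n → ξ ≤ iter n (β̂ q)
      <top⇒ ξ< with _ , (q , q∈ , n , refl) , ξ≤ ← <sup⇒≤ (Countable⇒small Tails-countable) id ξ<
        = q , q∈ , n , ξ≤

    Lim-top : Lim top
    Lim-top =
        (let q , q∈ = proj₁ ready in β̂ q , <top _ (q , q∈ , 0 , refl))
      , λ ξ ξ< → let q , q∈ , n , ξ≤ = <top⇒ ξ< in
          iter (ℕ.suc n) (β̂ q) , ≤-<-trans ξ≤ <suc , <top _ (q , q∈ , ℕ.suc n , refl)

    S₀-top : S₀ top
    S₀-top = S₀-intro Lim-top Tails-countable <top λ ξ ξ< →
      let q , q∈ , n , ξ≤ = <top⇒ ξ< in iter n (β̂ q) , (q , q∈ , n , refl) , ξ≤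

    Tails-cofinal : CountableCofinal ω₁ ω₂ ⟦ Tails A ⟧ top
    Tails-cofinal =
        Injects-⊆ (λ _ → ∈⁻ (Tails A)) Tails-countable
      , (λ η → <top η ∘ ∈⁻ (Tails A))
      , λ ξ ξ< → let q , q∈ , n , ξ≤ = <top⇒ ξ< in
          iter n (β̂ q) , ∈⁺ (Tails A) (q , q∈ , n , refl) , <top _ (q , q∈ , n , refl) , ξ≤

    private
      Lim-<top⇒ : ∀ {α} → Lim α → α < top → ∃ λ q → just q ∈ A × α ≤ β q
      Lim-<top⇒ {α} lim α< =
        let q , q∈ , n , α≤ = <top⇒ α< in go q q∈ (Lim-<next⇒≤ lim (≤-<-trans α≤ (iter<next n)))
        where
        go : ∀ q → q ∈ A → α ≤ β̂ q → ∃ λ q → just q ∈ A × α ≤ β q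
        go (just q) q∈ α≤ = q , q∈ , α≤
        go nothing  _  α≤ = let (x , x<α) , _ = lim in
          contradiction (<-≤-trans x<α α≤) (≤⇒≯ zero-≤)

      r-agrees : ∀ q → just q ∈ A → Agrees q (ẑ r) (f̂ r)
      r-agrees q q∈ = go r (r-ext (just q) q∈)
        where
        go : ∀ r → r ⊑ just q → Agrees q (ẑ r) (f̂ r)
        go (just r) r⊴q = ⊴-z r⊴q , ⊴-f r⊴q

      -- `r` may be shorter than `top`, and beyond its length `ẑ r` is arbitrary. But every limit
      -- below `top` is at most the length of a member of `A`, and there `r` agrees with that
      -- member.
      r-good : GoodBelow top (ẑ r) (f̂ r)
      r-good =
          (λ α s₀ α< → let q , q∈ , α≤ = Lim-<top⇒ (S₀⇒Lim s₀) α< in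
            subst (λ w → CountableCofinal ω₁ ω₂ w α) (proj₁ (r-agrees q q∈) α s₀ α≤)
              (cofinal q α s₀ α≤))
        , (λ γ s₁ γ< → let q , q∈ , γ≤ = Lim-<top⇒ (S₁⇒Lim s₁) γ< in
            coherent-agrees (r-agrees q q∈) s₁ (S₁-≤β⇒<β s₁ γ≤))

    cap-top : ∀ w → CountableCofinal ω₁ ω₂ w top → ∀ v →
              ∃ λ p → β p ≡ top × z p top ≡ w × f p top ≡ v × CommonExtension (just p) (_∈ A)
    cap-top w w-cof v =
      let p , β≡ , z≡ , f≡ , extends = cap S₀-top r-good w w-cof v
      in p , β≡ , z≡ , f≡ , λ where
           nothing  _  → tt
           (just q) q∈ → extends q (<top _ (just q , q∈ , 0 , refl)) (r-agrees q q∈)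

    answer-exists : ∀ v → ∃ (Answer v A)
    answer-exists v =
      let p , β≡ , z≡ , f≡ , p-ext = cap-top ⟦ Tails A ⟧ Tails-cofinal v
      in p , (λ η η∈ → subst (η <_) (sym β≡) (<top η η∈))
           , (λ b <b → subst (_≤ b) (sym β≡) (top-least b <b))
           , trans (cong (z p) β≡) z≡ , trans (cong (f p) β≡) f≡ , p-ext

  private
    choose : ∀ v A → Dec (∃ (Answer v A)) → Maybe Cond
    choose v A (yes (p , _)) = just p
    choose v A (no _)        = nothing

  answer : F → 𝒫 (Maybe Cond) → Maybe Cond
  answer v A = choose v A (dec _)

  answer-correct : ∀ {v A} → ∃ (Answer v A) → ∃ λ p → answer v A ≡ just p × Answer v A p
  answer-correct {v} {A} ∃p with dec (∃ (Answer v A))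
  ... | yes (p , spec) = p , refl , spec
  ... | no ∄p          = contradiction ∃p ∄p

  -- If all members of A were shorter than p, then some extension of A would
  -- disagree with p at top A, contrary to ⋀ A ≤ p.
  below⇒longer : ∀ {A p} → Ready A → _≤𝓑_ poset (⋀ poset A) (ι poset (just p)) →
                 ∃ λ q → just q ∈ A × q ⊴ p
  below⇒longer {A} {p} ready@((_ , _) , _ , r , r-ext) ⋀A≤p =
    let q , q∈ , βp≤βq = longer in q , q∈ , shortened r q q∈ (r-ext (just q) q∈) (compatible r-ext) βp≤βq
    where
    compatible : ∀ {r} → CommonExtension r (_∈ A) → Compatible r (just p)
    compatible {r} r-ext = ⋀A≤p r
      (λ a a∈ s s⊑r → s , ⊑-refl {s} , ⊑-trans {s} {r} {a} s⊑r (r-ext a a∈)) r (⊑-refl {r})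

    shortened : ∀ r q → just q ∈ A → r ⊑ just q → Compatible r (just p) → β p ≤ β q → q ⊴ p
    shortened (just r) q _ r⊴q (just s , s⊴r , s⊴p) βp≤βq =
      ⊴-both s⊴p (⊴-trans s r q s⊴r r⊴q) βp≤βq

    longer : ∃ λ q → just q ∈ A × β p ≤ β q
    longer = dne λ ∄q →
      let short : ∀ q → q ∈ A → β̂ q < β p
          short = λ where
            nothing  _  → zero<β p
            (just q) q∈ → [ id , (λ βp≤βq → contradiction (q , q∈ , βp≤βq) ∄q) ]′ (<-or-≥ (β q) (β p))
          top≤ = top-least ready (β p) λ where
            _ (q , q∈ , n , refl) → Lim-iter n (S₀⇒Lim (β∈S₀ p)) (short q q∈)
          w , w-cof , w≢ = S₀⇒another-cofinal-set (S₀-top ready) (z p (top ready))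
          r , β≡ , z≡ , _ , r-ext = cap-top ready w w-cof (index O₁.zero)
      in different⇒incompatible (S₀-top ready) (inj₂ (sym β≡)) top≤
           (λ eq → w≢ (trans (sym z≡) eq)) (compatible r-ext)

  τ : *-Operation ω₁ poset
  τ δ = answer (index δ)

  module _ {A : ∣ ω₁ ∣ → 𝒫 (Maybe Cond)} (unions : UnionsAtLimits ω₁ poset A) where
    private
      b : ∣ ω₁ ∣ → Maybe Cond
      b γ = τ γ (A γ)

      Legal : ∣ ω₁ ∣ → Set
      Legal γ = ¬ O₁.Lim γ → *-LegalI ω₁ poset A b γ

      LegalUpTo : ∣ ω₁ ∣ → Set
      LegalUpTo γ = ∀ ξ → ξ O₁.≤ γ → Legal ξ

      A-mono : ∀ {γ} → LegalUpTo γ → ∀ {ξ η} → ¬ O₁.Lim ξ → ξ O₁.≤ η → η O₁.≤ γ → A ξ ⊆ A η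
      A-mono legal _ (inj₂ refl) _ q q∈ = q∈
      A-mono legal {ξ} {η} ¬lim (inj₁ ξ<η) η≤γ q q∈ with dec (O₁.Lim η)
      ... | yes lim   = Equivalence.from (unions η lim q) (ξ , ξ<η , ¬lim , q∈)
      ... | no η-¬lim = *-LegalI.increasing (legal η η≤γ η-¬lim) ξ ξ<η ¬lim q q∈

      Answered : ∣ ω₁ ∣ → Cond → Set
      Answered γ p = b γ ≡ just p × Answer (index γ) (A γ) p

      Ready-legal : ∀ {γ} → *-LegalI ω₁ poset A b γ → Ready (A γ)
      Ready-legal legal = L.nonempty , L.countable , L.bounded
        where module L = *-LegalI legal

      -- The move at turn `ξ + 1` contains a condition extending the answer at `ξ`. The answer at
      -- `η` extends that condition and, by the tails, is strictly longer.
      link : ∀ {γ} → LegalUpTo γ → ∀ {ξ η p q} → ξ O₁.< η → η O₁.≤ γ →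
             Answered ξ p → Answered η q → q ⊴ p × β p < β q
      link legal {ξ} {η} {p} {q} ξ<η η≤γ (b≡ , _) (_ , <βq , _ , _ , _ , q-ext) =
        let sξ≤η = O₁.suc-least ξ<η
            legal⁺ = legal (O₁.suc ξ) (O₁.≤-trans sξ≤η η≤γ) O₁.¬Lim-suc
            r , r∈ , r⊴p = below⇒longer (Ready-legal legal⁺)
              (subst (λ x → _≤𝓑_ poset (⋀ poset (A (O₁.suc ξ))) (ι poset x)) b≡
                (*-LegalI.below legal⁺ ξ O₁.suc-IsSuccessorOf))
            r∈′ = A-mono legal O₁.¬Lim-suc sξ≤η η≤γ (just r) r∈
        in ⊴-trans q r p (q-ext (just r) r∈′) r⊴p
         , ≤-<-trans (⊴-β r⊴p) (<βq (β r) (just r , r∈′ , 0 , refl))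

      module Stage (γ : ∣ ω₁ ∣) (legal : LegalUpTo γ) (γ-lim : O₁.Lim γ)
                   (ih : ∀ ξ → ξ O₁.< γ → ∃ (Answered ξ)) where

        J : Pred Cond 0ℓ
        J q = ∃ λ ξ → ξ O₁.< γ × Answered ξ q

        linked : ∀ {ξ η p q} → ξ O₁.< η → η O₁.< γ → Answered ξ p → Answered η q →
                 q ⊴ p × β p < β q
        linked ξ<η η<γ = link legal ξ<η (inj₁ η<γ)

        directed : ∀ p q → J p → J q → ∃ λ r → r ⊴ p × r ⊴ q
        directed p q (ξ , ξ<γ , ap) (η , η<γ , aq) with O₁.compare ξ η
        ... | tri< ξ<η _ _  = q , proj₁ (linked ξ<η η<γ ap aq) , ⊴-refl q
        ... | tri> _ _ η<ξ  = p , ⊴-refl p , proj₁ (linked η<ξ ξ<γ aq ap)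
        ... | tri≈ _ refl _ with refl ← just-injective (trans (sym (proj₁ ap)) (proj₁ aq))
          = p , ⊴-refl p , ⊴-refl p

        open Glue J directed

        J-countable : Countable J
        J-countable = Injects-⊆ (λ q (ξ , ξ<γ , b≡ , _) → ξ , ξ<γ , b≡)
          (Countable-⋃ (proj₂ ω₁-succ γ) λ ξ _ → (λ _ → 0) , λ p q b≡p b≡q _ →
            just-injective (trans (sym b≡p) b≡q))

        c : ∣ ω₂ ∣
        c = sup (Countable⇒small J-countable) β

        β<c : ∀ q → J q → β q < c
        β<c = <sup (Countable⇒small J-countable) β

        cover : ∀ α → α < c → Covered α
        cover α α<c = <sup⇒≤ (Countable⇒small J-countable) β α<c

        c-lim : Lim c
        c-lim = (let (ξ , ξ<γ) , _ = γ-lim ; p , a = ih ξ ξ<γ in β p , β<c p (ξ , ξ<γ , a))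
              , λ α α<c → let p , (ξ , ξ<γ , a) , α≤ = cover α α<c
                              sξ<γ = O₁.Lim-suc γ-lim ξ<γ
                              p′ , a′ = ih (O₁.suc ξ) sξ<γ
                          in β p′ , ≤-<-trans α≤ (proj₂ (linked O₁.<suc sξ<γ a a′))
                           , β<c p′ (O₁.suc ξ , sξ<γ , a′)

        c∈S₀ : S₀ c
        c∈S₀ = S₀-intro c-lim (Countable-image β J-countable)
          (λ where _ (q , Jq , refl) → β<c q Jq)
          λ α α<c → let q , Jq , α≤ = cover α α<c in β q , (q , Jq , refl) , α≤

        -- At a limit turn the rules supply no common extension of `A γ`. The earlier answers form a
        -- chain whose lengths have a supremum of cofinality ω, where their union is capped. The
        -- cofinal set used there is arbitrary, as this condition is a bound and not II's answer.
        ready : Ready (A γ)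
        ready =
            (let q , q∈ = *-LegalI.nonempty (legal O₁.zero O₁.zero-≤ O₁.¬Lim-zero)
             in q , A-mono legal O₁.¬Lim-zero O₁.zero-≤ O₁.≤-refl q q∈)
          , Injects-⊆ (λ q q∈ → let ξ , ξ<γ , ¬lim , q∈ξ = Equivalence.to (unions γ γ-lim q) q∈
                                in ξ , (ξ<γ , ¬lim) , q∈ξ)
              (Countable-⋃ (Injects-⊆ (λ _ → proj₁) (proj₂ ω₁-succ γ)) λ ξ (ξ<γ , ¬lim) →
                *-LegalI.countable (legal ξ (inj₁ ξ<γ) ¬lim))
          , (let w , w-cof = S₀⇒cofinal-set c∈S₀
                 r , _ , _ , _ , extends = cap c∈S₀ (good c cover) w w-cof (index γ)
             in just r , λ q q∈ →
                  let ξ , ξ<γ , _ , q∈ξ = Equivalence.to (unions γ γ-lim q) q∈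
                      p , a = ih ξ ξ<γ
                      Jp = ξ , ξ<γ , a
                  in ⊑-trans {just r} {just p} {q} (extends p (β<c p Jp) (agrees p Jp))
                       (proj₂ (proj₂ (proj₂ (proj₂ (proj₂ a)))) q q∈ξ))

      abstract
        answered : ∀ γ → LegalUpTo γ → ∃ (Answered γ)
        answered = O₁.wf-induction _ λ γ ih legal →
          answer-correct (answer-exists (ready γ ih legal (dec (O₁.Lim γ))) (index γ))
          where
          ready : ∀ γ → (∀ ξ → ξ O₁.< γ → LegalUpTo ξ → ∃ (Answered ξ)) → LegalUpTo γ →
                  Dec (O₁.Lim γ) → Ready (A γ)
          ready γ ih legal (no ¬lim) = Ready-legal (legal γ O₁.≤-refl ¬lim)
          ready γ ih legal (yes lim) = Stage.ready γ legal lim λ ξ ξ<γ →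
            ih ξ ξ<γ λ η η≤ξ → legal η (O₁.≤-trans η≤ξ (inj₁ ξ<γ))

      module Final (legal : ∀ γ → Legal γ) where

        p : ∣ ω₁ ∣ → Cond
        p γ = proj₁ (answered γ λ ξ _ → legal ξ)

        p-answered : ∀ γ → Answered γ (p γ)
        p-answered γ = proj₂ (answered γ λ ξ _ → legal ξ)

        linked : ∀ {ξ η} → ξ O₁.< η → p η ⊴ p ξ × β (p ξ) < β (p η)
        linked {ξ} {η} ξ<η = link {η} (λ ξ _ → legal ξ) ξ<η O₁.≤-refl (p-answered ξ) (p-answered η)

        J : Pred Cond 0ℓ
        J q = ∃ λ ξ → q ≡ p ξ

        directed : ∀ q r → J q → J r → ∃ λ s → s ⊴ q × s ⊴ r
        directed _ _ (ξ , refl) (η , refl) with O₁.compare ξ η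
        ... | tri< ξ<η _ _  = p η , proj₁ (linked ξ<η) , ⊴-refl _
        ... | tri> _ _ η<ξ  = p ξ , ⊴-refl _ , proj₁ (linked η<ξ)
        ... | tri≈ _ refl _ = p ξ , ⊴-refl _ , ⊴-refl _

        open Glue J directed

        c : ∣ ω₁ ∣ → ∣ ω₂ ∣
        c ξ = β (p ξ)

        c-mono : ∀ {ξ η} → ξ O₁.< η → c ξ < c η
        c-mono ξ<η = proj₂ (linked ξ<η)

        c-mono-≤ : ∀ {ξ η} → ξ O₁.≤ η → c ξ ≤ c η
        c-mono-≤ (inj₁ ξ<η)  = inj₁ (c-mono ξ<η)
        c-mono-≤ (inj₂ refl) = ≤-refl

        c-reflect : ∀ {ξ η} → c ξ < c η → ξ O₁.< η
        c-reflect {ξ} {η} c< with O₁.compare ξ η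
        ... | tri< ξ<η _ _  = ξ<η
        ... | tri≈ _ refl _ = contradiction c< <-irrefl
        ... | tri> _ _ η<ξ  = contradiction (<-trans c< (c-mono η<ξ)) <-irrefl

        ω₁-small : Injects {∣ ω₁ ∣} U ∣ ω₁ ∣
        ω₁-small = id , λ _ _ _ _ → id

        β* : ∣ ω₂ ∣
        β* = sup ω₁-small c

        c<β* : ∀ ξ → c ξ < β*
        c<β* ξ = <sup ω₁-small c ξ tt

        <β*⇒ : ∀ α → α < β* → ∃ λ ξ → α ≤ c ξ
        <β*⇒ α α< = let ξ , _ , α≤ = <sup⇒≤ ω₁-small c α< in ξ , α≤

        β*∈S₁ : S₁ β*
        β*∈S₁ = S₁-intro c (λ _ _ → c-mono) c<β* <β*⇒

        cover : ∀ α → α < β* → Covered α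
        cover α α< = let ξ , α≤ = <β*⇒ α α< in p ξ , (ξ , refl) , α≤

        InC : Pred ∣ ω₂ ∣ 0ℓ
        InC α = ∃ λ ξ → α ≡ c ξ

        C : 𝒫 ∣ ω₂ ∣
        C = ⟦ InC ⟧

        c∈C : ∀ ξ → c ξ ∈ C
        c∈C ξ = ∈⁺ InC (ξ , refl)

        z-c : ∀ ξ → glue-z (c ξ) ≡ ⟦ Tails (A ξ) ⟧
        z-c ξ = let _ , _ , _ , z≡ , _ = p-answered ξ in
          trans (sym (proj₁ (agrees (p ξ) (ξ , refl)) (c ξ) (β∈S₀ (p ξ)) ≤-refl)) z≡

        Tails-⊆ : ∀ {ξ η} → ξ O₁.< η → ∀ x → Tails (A ξ) x → Tails (A η) x
        Tails-⊆ {ξ} {η} ξ<η x x∈ with dec (O₁.Lim ξ)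
        ... | no ¬lim = Tails-mono (A-mono {η} (λ ξ _ → legal ξ) ¬lim (inj₁ ξ<η) O₁.≤-refl) x x∈
        ... | yes lim with q , q∈ , rest ← x∈
          with ζ , ζ<ξ , ¬lim , q∈ζ ← Equivalence.to (unions ξ lim q) q∈
          = q , A-mono {η} (λ ξ _ → legal ξ) ¬lim (inj₁ (O₁.<-trans ζ<ξ ξ<η)) O₁.≤-refl q q∈ζ , rest

        Tails-continuous : ∀ ξ → O₁.Lim ξ → ∀ x → Tails (A ξ) x → ∃ λ ζ → ζ O₁.< ξ × Tails (A ζ) x
        Tails-continuous ξ lim x (q , q∈ , rest) =
          let ζ , ζ<ξ , _ , q∈ζ = Equivalence.to (unions ξ lim q) q∈ in ζ , ζ<ξ , q , q∈ζ , rest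

        -- The length of an answer is the least strict bound of its tails, and at a limit turn these
        -- are the union of the earlier tails; so the lengths are continuous.
        c-limit : ∀ ξ → O₁.Lim ξ → ∀ δ → (∀ ζ → ζ O₁.< ξ → c ζ < δ) → c ξ ≤ δ
        c-limit ξ lim δ c<δ = let _ , _ , c-least , _ = p-answered ξ in
          c-least δ λ x x∈ → let ζ , ζ<ξ , x∈ζ = Tails-continuous ξ lim x x∈
                                 _ , <c , _ = p-answered ζ
                             in <-trans (<c x x∈ζ) (c<δ ζ ζ<ξ)

        -- The least `c ξ` that reaches `δ` must equal `δ`: at limit `ξ` by continuity, and
        -- otherwise because `C` is unbounded in `δ`, which puts a length with index at least `ξ`
        -- below `δ`.
        C-closed : ∀ δ → δ < β* → Lim δ → Unbounded ω₁ ω₂ C δ → δ ∈ C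
        C-closed δ δ<β* δ-lim C-unb
          with ξ , δ≤c , ξ-least ← O₁.least (λ ξ → δ ≤ c ξ) (<β*⇒ δ δ<β*)
          = subst (_∈ C) (≤-antisym (c≤δ (O₁.kind ξ) ξ-least) δ≤c) (c∈C ξ)
          where
          InC-below : ∀ α → α < δ → ∃ λ ζ → c ζ < δ × α ≤ c ζ
          InC-below α α<δ with η , η∈ , η<δ , α≤η ← C-unb α α<δ
            with ζ , refl ← ∈⁻ InC η∈ = ζ , η<δ , α≤η

          c≤δ : ∀ {ξ} → O₁.Kind ξ → (∀ ζ → δ ≤ c ζ → ξ O₁.≤ ζ) → c ξ ≤ δ
          c≤δ {ξ} (O₁.is-lim lim) ξ-least = c-limit ξ lim δ λ ζ ζ<ξ →
            [ id , (λ δ≤ → contradiction ζ<ξ (O₁.≤⇒≯ (ξ-least ζ δ≤))) ]′ (<-or-≥ (c ζ) δ)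
          c≤δ O₁.is-zero _ = let (x , x<δ) , _ = δ-lim
                                 ζ , cζ<δ , _ = InC-below x x<δ
                             in ≤-trans (c-mono-≤ O₁.zero-≤) (inj₁ cζ<δ)
          c≤δ (O₁.is-suc ζ) ξ-least =
            let cζ<δ = [ id , (λ δ≤ → contradiction O₁.<suc (O₁.≤⇒≯ (ξ-least ζ δ≤))) ]′ (<-or-≥ (c ζ) δ)
                ζ′ , cζ′<δ , scζ≤ = InC-below (suc (c ζ)) (Lim-suc δ-lim cζ<δ)
                ζ<ζ′ = c-reflect (<-≤-trans <suc scζ≤)
            in inj₁ (≤-<-trans (c-mono-≤ (O₁.suc-least ζ<ζ′)) cζ′<δ)

        C-subset : ∀ α → InC α → α < β* × S₀ α
        C-subset _ (ξ , refl) = c<β* ξ , β∈S₀ (p ξ)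

        ∈glue-z⁺ : ∀ {ξ x} → Tails (A ξ) x → x ∈ glue-z (c ξ)
        ∈glue-z⁺ {ξ} {x} x∈ = subst (x ∈_) (sym (z-c ξ)) (∈⁺ (Tails (A ξ)) x∈)

        ∈glue-z⁻ : ∀ {ξ x} → x ∈ glue-z (c ξ) → Tails (A ξ) x
        ∈glue-z⁻ {ξ} {x} x∈ = ∈⁻ (Tails (A ξ)) (subst (x ∈_) (z-c ξ) x∈)

        C-increasing : ∀ {α α′} → InC α → InC α′ → α < α′ → glue-z α ⊆ glue-z α′
        C-increasing (ξ , refl) (η , refl) α<α′ x x∈ =
          ∈glue-z⁺ (Tails-⊆ (c-reflect α<α′) x (∈glue-z⁻ x∈))

        C-between : ∀ {ξ η α} → InC α → c ξ < α → α < c η → ∃ λ ζ → ξ O₁.< ζ × ζ O₁.< η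
        C-between (ζ , refl) cξ< <cη = ζ , c-reflect cξ< , c-reflect <cη

        C-lim : ∀ γ → (∃ λ α → α ∈ C × α < c γ) →
                (∀ α → α ∈ C → α < c γ → ∃ λ η → η ∈ C × α < η × η < c γ) → O₁.Lim γ
        C-lim γ (α , α∈ , α<) no-max = nonempty (∈⁻ InC α∈) α< , λ ξ ξ<γ →
          let η , η∈ , cξ<η , η< = no-max (c ξ) (c∈C ξ) (c-mono ξ<γ)
          in C-between (∈⁻ InC η∈) cξ<η η<
          where
          nonempty : ∀ {α} → InC α → α < c γ → ∃ λ ξ → ξ O₁.< γ
          nonempty (ξ , refl) cξ< = ξ , c-reflect cξ<

        C-continuous : ∀ α → InC α → (∃ λ ξ → ξ ∈ C × ξ < α) →
          (∀ ξ → ξ ∈ C → ξ < α → ∃ λ η → η ∈ C × ξ < η × η < α) →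
          ∀ x → x ∈ glue-z α ⇔ (∃ λ ξ → ξ ∈ C × ξ < α × x ∈ glue-z ξ)
        C-continuous _ (γ , refl) nonempty no-max x = mk⇔
          (λ x∈ → split (Tails-continuous γ (C-lim γ nonempty no-max) x (∈glue-z⁻ x∈)))
          (λ (ξ , ξ∈ , ξ< , x∈) → C-increasing (∈⁻ InC ξ∈) (γ , refl) ξ< x x∈)
          where
          split : (∃ λ ζ → ζ O₁.< γ × Tails (A ζ) x) → ∃ λ ξ → ξ ∈ C × ξ < c γ × x ∈ glue-z ξ
          split (ζ , ζ<γ , x∈ζ) = c ζ , c∈C ζ , c-mono ζ<γ , ∈glue-z⁺ x∈ζ

        C-coherent : Coherent glue-z glue-f β* C
        C-coherent = record
          { coherent⁻ = record
              { isClub     = record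
                  { subset    = λ α α∈ → C-subset α (∈⁻ InC α∈)
                  ; unbounded = λ α α< → let ξ , α≤ = <β*⇒ α α< in c ξ , c∈C ξ , c<β* ξ , α≤
                  ; closed    = C-closed
                  }
              ; orderType  = c , (λ ξ _ → c∈C ξ) , (λ _ _ _ _ → c-mono)
                           , λ α α∈ → let ξ , eq = ∈⁻ InC α∈ in ξ , tt , sym eq
              ; increasing = λ α α′ α∈ α′∈ → C-increasing (∈⁻ InC α∈) (∈⁻ InC α′∈)
              ; continuous = λ α α∈ → C-continuous α (∈⁻ InC α∈)
              }
          ; f-index = λ ξ → let _ , _ , _ , _ , f≡ , _ = p-answered ξ in
              trans (sym (proj₂ (agrees (p ξ) (ξ , refl)) (c ξ) ≤-refl)) f≡
          }

        good-next : GoodBelow (next β*) glue-z glue-f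
        good-next =
            (λ α s₀ α< → proj₁ (good β* cover) α s₀
              (strictly s₀ (Lim-<next⇒≤ (S₀⇒Lim s₀) α<)))
          , λ γ s₁ γ< → at-most γ s₁ (Lim-<next⇒≤ (S₁⇒Lim s₁) γ<)
          where
          strictly : ∀ {α} → S₀ α → α ≤ β* → α < β*
          strictly _  (inj₁ α<)   = α<
          strictly s₀ (inj₂ refl) = contradiction β*∈S₁ (S₀-S₁-disjoint s₀)

          at-most : ∀ γ → S₁ γ → γ ≤ β* → ∃ (Coherent glue-z glue-f γ)
          at-most γ s₁ (inj₁ γ<)   = proj₂ (good β* cover) γ s₁ γ<
          at-most _ _  (inj₂ refl) = C , C-coherent

        -- The supremum `β*` has cofinality ω₁, so no condition ends there. The union of the answers
        -- is capped at `β* + ω` instead, and the one new demand, a coherent club of `β*`, is met by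
        -- the lengths of the answers.
        final-move : FinalMove ω₁ poset A b
        final-move =
          let w , w-cof = S₀⇒cofinal-set (S₀-next {β*})
              r , _ , _ , _ , extends = cap S₀-next good-next w w-cof (index O₁.zero)
          in just r , λ q (ξ , _ , q∈) →
               ⊑-trans {just r} {just (p ξ)} {q}
                 (extends (p ξ) (<-trans (c<β* ξ) <next) (agrees (p ξ) (ξ , refl)))
                 (proj₂ (proj₂ (proj₂ (proj₂ (proj₂ (p-answered ξ))))) q q∈)

    legal-answers : ∀ γ → LegalUpTo γ → *-LegalII ω₁ poset A b γ
    legal-answers γ legal q q∈ =
      let p , b≡ , _ , _ , _ , _ , p-ext = answered γ legal
      in subst (_⊑ q) (sym b≡) (p-ext q q∈)

    final : (∀ γ → Legal γ) → FinalMove ω₁ poset A b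
    final = Final.final-move

  *-closed : Winning* ω₁ poset τ
  *-closed A unions = legal-answers unions , final unions

  private
    -- By induction each `η < ξ` can be passed. There are at most ω₁ many of them, indexed by `e`,
    -- so `ω₁-distributive` passes them all below one `q`; a further extension by ω is longer than
    -- each such `η`, so it has length at least `ξ`.
    dense-length : ∀ ξ p → ∃ λ r → just r ⊑ p × ξ ≤ β r
    dense-length = wf-induction _ λ ξ ih p →
      let e , e-inj = proj₂ ω₂-succ ξ
          q , q⊑p , q⊑ = ω₁-distributive poset τ *-closed p
            (λ i r → ∀ η → η < ξ → e η ≡ i → η ≤ β̂ r) (dense ξ ih e e-inj)
          w , w-cof = S₀⇒cofinal-set (S₀-next {β̂ q})
          r , β≡ , _ , r⊑q = extension q w w-cof
      in r , ⊑-trans {just r} {q} {p} r⊑q q⊑p , ≮⇒≥ λ βr<ξ →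
           let s , q⊑s , long = q⊑ (e (β r))
           in ≤⇒≯ (≤-trans (long (β r) βr<ξ refl) (β̂-antitone {q} {s} q⊑s))
                (subst (β̂ q <_) (sym β≡) <next)
      where
      dense : ∀ ξ → (∀ η → η < ξ → ∀ p → ∃ λ r → just r ⊑ p × η ≤ β r) →
              (e : ∣ ω₂ ∣ → ∣ ω₁ ∣) → (∀ η η′ → η < ξ → η′ < ξ → e η ≡ e η′ → η ≡ η′) →
              ∀ i q → ∃ λ r → r ⊑ q × (∀ η → η < ξ → e η ≡ i → η ≤ β̂ r)
      dense ξ ih e e-inj i q with dec (∃ λ η → η < ξ × e η ≡ i)
      ... | no ∄η = q , ⊑-refl {q} , λ η η<ξ eq → contradiction (η , η<ξ , eq) ∄η
      ... | yes (η , η<ξ , eη≡i) = let r , r⊑q , η≤ = ih η η<ξ q in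
        just r , r⊑q , λ η′ η′<ξ eη′≡i →
          subst (_≤ β r) (e-inj η η′ η<ξ η′<ξ (trans eη≡i (sym eη′≡i))) η≤

    Long : ∣ ω₂ ∣ → Pred (Maybe Cond) 0ℓ
    Long ξ p = ∃ λ q → p ≡ just q × ξ ≤ β q

    Long-dense : ∀ ξ → Poset.Dense poset ⟦ Long ξ ⟧
    Long-dense ξ p = let r , r⊑p , ξ≤ = dense-length ξ p in just r , r⊑p , ∈⁺ (Long ξ) (r , refl , ξ≤)

    module _ {G : 𝒫 (Maybe Cond)} (G-filter : Poset.IsFilter poset G)
             (meets : ∀ ξ → ∃ λ p → p ∈ G × p ∈ ⟦ Long ξ ⟧) where

      directed : ∀ p q → just p ∈ G → just q ∈ G → ∃ λ r → r ⊴ p × r ⊴ q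
      directed p q p∈ q∈ with Poset.IsFilter.directed G-filter (just p) (just q) p∈ q∈
      ... | just r , _ , r⊴p , r⊴q = r , r⊴p , r⊴q

      open Glue (λ p → just p ∈ G) directed

      cover : ∀ ξ → Covered ξ
      cover ξ with p , p∈G , p∈D ← meets ξ with q , refl , ξ≤ ← ∈⁻ (Long ξ) p∈D = q , p∈G , ξ≤

      generic-sequence : CoherentSequence
      generic-sequence = glue-z , glue-f
        , (λ α s₀ → proj₁ (good (suc α) λ ξ _ → cover ξ) α s₀ <suc)
        , (λ γ s₁ → proj₂ (good (suc γ) λ ξ _ → cover ξ) γ s₁ <suc)

  MA-for⇒CoherentSequence : MA-for ω₂ poset → CoherentSequence
  MA-for⇒CoherentSequence ma =
    let G , G-filter , meets = ma ∣ ω₂ ∣ (mk↣ id) (λ ξ → ⟦ Long ξ ⟧) Long-dense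
    in generic-sequence G-filter meets

-- The two cycles of equivalences

module Equivalences (em : ∀ ℓ → ExcludedMiddle ℓ) (ext : ∀ a b → Extensionality a b)
                    (ω₁ ω₂ : WellOrder)
                    (ω₁-succ : IsCardinalSuccessor ω ω₁)
                    (ω₂-succ : IsCardinalSuccessor ω₁ ω₂) where

  open Classical em ext
  open Ordinals em ext ω₁ ω₂ ω₁-succ ω₂-succ
  open Games em ext ω₁ ω₂ ω₁-succ ω₂-succ
  open Climbing em ext ω₁ ω₂ ω₁-succ ω₂-succ
  module Indexed   = ConditionPosets em ext ω₁ ω₂ ω₁-succ ω₂-succ ∣ ω₁ ∣ id
  module Unindexed = ConditionPosets em ext ω₁ ω₂ ω₁-succ ω₂-succ ⊤ (λ _ → tt)

  -- The classical fact on increasing maps of ordinals, stated for a relation because the maps it is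
  -- applied to are known only through surjectivity. If `x` had a value `y < x`, then a value of `y`
  -- would be below `y`, against the induction hypothesis.
  increasing⇒inflationary : (R : Rel ∣ ω₁ ∣ 0ℓ) → ∀ n → (∀ x → x O₁.< n → ∃ (R x)) →
    (∀ {x x′ y y′} → x O₁.< x′ → R x y → R x′ y′ → y O₁.< y′) →
    ∀ x → x O₁.< n → ∀ {y} → R x y → x O₁.≤ y
  increasing⇒inflationary R n total mono = O₁.wf-induction _ λ x ih x<n {y} r →
    O₁.≮⇒≥ λ y<x →
      let y′ , r′ = total y (O₁.<-trans y<x x<n)
      in O₁.≤⇒≯ (ih y y<x (O₁.<-trans y<x x<n) r′) (mono y<x r′ r)

  module _ {z f β C} (coh : CoherentClub ω₁ ω₂ z f β C) where
    open CoherentClub coh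
    open CoherentClub⁻ coherent⁻

    open Enumeration orderType renaming (e∈ to e∈C)

    -- `e` maps the segment below `i` isomorphically onto `C` below `e i`, so `i` and `f (e i)` are
    -- isomorphic segments of `ω₁`. If they differed, the longer would map increasingly into the
    -- shorter, and such a map cannot be inflationary.
    index-≡ : ∀ i → f (e i) ≡ i
    index-≡ i = from-isomorphism (f (e i)) (index (e i) (e∈C i))
      where
      from-isomorphism : ∀ j →
        SameOrderType ω₁ ω₂ (O₁._< j) (λ α → α ∈ C × α O₂.< e i) → j ≡ i
      from-isomorphism j (h , h∈ , h-mono , h-onto) with O₁.compare j i
      ... | tri≈ _ j≡i _ = j≡i
      ... | tri< j<i _ _ =
        let y , y<j , eq = h-onto (e j) (e∈C j , e-mono j<i)
        in contradiction y<j (O₁.≤⇒≯ (increasing⇒inflationary R i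
             (λ x x<i → let y , y<j , eq = h-onto (e x) (e∈C x , e-mono x<i) in y , y<j , eq)
             R-mono j j<i (y<j , eq)))
        where
        R : Rel ∣ ω₁ ∣ 0ℓ
        R x y = y O₁.< j × h y ≡ e x

        R-mono : ∀ {x x′ y y′} → x O₁.< x′ → R x y → R x′ y′ → y O₁.< y′
        R-mono {x} {x′} {y} {y′} x<x′ (y<j , hy) (y′<j , hy′) with O₁.<-or-≥ y y′
        ... | inj₁ y<y′ = y<y′
        ... | inj₂ (inj₁ y′<y) = contradiction
          (O₂.<-trans (e-mono x<x′) (subst (O₂._< e x) hy′ (subst (h y′ O₂.<_) hy (h-mono _ _ y′<j y<j y′<y))))
          O₂.<-irrefl
        ... | inj₂ (inj₂ refl) = contradiction
          (subst (e x O₂.<_) (trans (sym hy′) hy) (e-mono x<x′)) O₂.<-irrefl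
      ... | tri> _ _ i<j =
        let hi∈ , hi< = h∈ i i<j
            x , ex≡ = e-onto (h i) hi∈
        in contradiction (e-reflect (subst (O₂._< e i) (sym ex≡) hi<))
             (O₁.≤⇒≯ (increasing⇒inflationary R j
               (λ y y<j → let x , ex≡ = e-onto (h y) (proj₁ (h∈ y y<j)) in x , y<j , ex≡)
               (λ {y} {y′} y<y′ (y<j , ex) (y′<j , ex′) → e-reflect
                 (subst (O₂._< _) (sym ex) (subst (h y O₂.<_) (sym ex′) (h-mono y y′ y<j y′<j y<y′))))
               i i<j (i<j , ex≡)))
        where
        R : Rel ∣ ω₁ ∣ 0ℓ
        R y x = y O₁.< j × e x ≡ h y

    CoherentClub⇒Coherent : Indexed.Coherent z f β C
    CoherentClub⇒Coherent = record { coherent⁻ = coherent⁻ ; f-index = index-≡ }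

  Coherent⇒CoherentClub : ∀ {z f β C} → Indexed.Coherent z f β C → CoherentClub ω₁ ω₂ z f β C
  Coherent⇒CoherentClub {z} {f} {β} {C} coh = record
    { coherent⁻ = coherent⁻
    ; index     = λ α α∈ → let i , eq = e-onto α α∈ in index i α eq
    }
    where
    open Indexed.Coherent coh
    open Enumeration orderType

    index : ∀ i α → e i ≡ α → SameOrderType ω₁ ω₂ (O₁._< f α) (λ ξ → ξ ∈ C × ξ O₂.< α)
    index i _ refl = subst (λ j → SameOrderType ω₁ ω₂ (O₁._< j) (λ ξ → ξ ∈ C × ξ O₂.< e i))
      (sym (f-index i))
      ( e
      , (λ j j<i → e∈ j , e-mono j<i)
      , (λ j k _ _ → e-mono)
      , λ ξ (ξ∈ , ξ<) → let j , eq = e-onto ξ ξ∈ in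
          j , e-reflect (subst (O₂._< e i) (sym eq) ξ<) , eq)

  indexed : Indexed.ConditionPoset
  indexed = record
    { Condition′ = Condition ω₁ ω₂
    ; β          = Condition.β
    ; z          = Condition.z
    ; f          = Condition.f
    ; β∈S₀       = Condition.β∈S²₀
    ; cofinal    = Condition.cofinal
    ; coherent   = λ p γ s₁ γ<β → let C , coh = Condition.coherent p γ s₁ γ<β in
                     C , CoherentClub⇒Coherent coh
    ; make       = λ b y g s₀ cof coh → record
                     { β = b ; z = y ; f = g ; β∈S²₀ = s₀ ; cofinal = cof
                     ; coherent = λ γ s₁ γ<b → let C , coh-C = coh γ s₁ γ<b in
                         C , Coherent⇒CoherentClub coh-C
                     } , refl , refl , refl
    ; _⊴_        = _≼_ ω₁ ω₂
    ; ⊴-refl     = ≼-refl ω₁ ω₂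
    ; ⊴-trans    = ≼-trans ω₁ ω₂
    ; ⊴-intro    = λ β≤ z≡ f≡ → β≤ , z≡ , f≡
    ; ⊴-β        = proj₁
    ; ⊴-z        = proj₁ ∘ proj₂
    ; ⊴-f        = proj₂ ∘ proj₂
    }

  unindexed : Unindexed.ConditionPoset
  unindexed = record
    { Condition′ = Condition⁻ ω₁ ω₂
    ; β          = Condition⁻.β
    ; z          = Condition⁻.z
    ; f          = λ _ _ → tt
    ; β∈S₀       = Condition⁻.β∈S²₀
    ; cofinal    = Condition⁻.cofinal
    ; coherent   = λ p γ s₁ γ<β → let C , coh = Condition⁻.coherent p γ s₁ γ<β in
                     C , record { coherent⁻ = coh ; f-index = λ _ → refl }
    ; make       = λ b y _ s₀ cof coh → record
                     { β = b ; z = y ; β∈S²₀ = s₀ ; cofinal = cof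
                     ; coherent = λ γ s₁ γ<b → let C , coh-C = coh γ s₁ γ<b in
                         C , Unindexed.Coherent.coherent⁻ coh-C
                     } , refl , refl , refl
    ; _⊴_        = _≼⁻_ ω₁ ω₂
    ; ⊴-refl     = ≼⁻-refl ω₁ ω₂
    ; ⊴-trans    = ≼⁻-trans ω₁ ω₂
    ; ⊴-intro    = λ β≤ z≡ _ → β≤ , z≡
    ; ⊴-β        = proj₁
    ; ⊴-z        = proj₂
    ; ⊴-f        = λ _ _ _ → refl
    }

  module SCP-game  = ConditionGame em ext ω₁ ω₂ ω₁-succ ω₂-succ ∣ ω₁ ∣ id indexed
  module SCP⁻-game = ConditionGame em ext ω₁ ω₂ ω₁-succ ω₂-succ ⊤ (λ _ → tt) unindexed

  -- Each of the other four statements yields MA for the single poset `ℙ`, because `ℙ` is separative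
  -- and belongs to `Γ`; MA for `ℙ` gives back `S`.
  equivalences : {S : Set} {Γ : Poset → Set} {ℙ : Poset} → Separative ℙ → Γ ℙ →
    (S → ∀ P → Γ P → StrategicallyClosed ω₂ P) → (MA-for ω₂ ℙ → S) →
      (S ⇔ ((P : Poset) → Separative P → Γ P → StrategicallyClosed ω₂ P))
    × (S ⇔ StrategicallyClosed ω₂ ℙ)
    × (S ⇔ MA ω₂ Γ)
    × (S ⇔ MA-for ω₂ ℙ)
  equivalences {ℙ = ℙ} ℙ-sep ℙ∈Γ closed from-MA =
      mk⇔ (λ s P _ → closed s P) (λ closed → from-closed (closed ℙ ℙ-sep ℙ∈Γ))
    , mk⇔ (λ s → closed s ℙ ℙ∈Γ) from-closed
    , mk⇔ (λ s P _ P∈Γ → StrategicallyClosed⇒MA-for P (closed s P P∈Γ))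
          (λ ma → from-MA (ma ℙ ℙ-sep ℙ∈Γ))
    , mk⇔ (λ s → StrategicallyClosed⇒MA-for ℙ (closed s ℙ ℙ∈Γ)) from-MA
    where
    from-closed = from-MA ∘ StrategicallyClosed⇒MA-for ℙ

  SCP⇒StrategicallyClosed : SCP ω₁ ω₂ → ∀ P → *-OperationallyClosed ω₁ P → StrategicallyClosed ω₂ P
  SCP⇒StrategicallyClosed (z , f , z-cofinal , coherent) P (τ , win) =
    coherence⇒StrategicallyClosed P win z f z-cofinal λ β s₁ →
      let C , coh = coherent β s₁
      in C , CoherentClub.coherent⁻ coh , λ i A → cong (λ j → τ j A) (index-≡ coh i)

  SCP⁻⇒StrategicallyClosed : SCP⁻ ω₁ ω₂ → ∀ P → *-TacticallyClosed ω₁ P → StrategicallyClosed ω₂ P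
  SCP⁻⇒StrategicallyClosed (z , z-cofinal , coherent) P (τ , constant , win) =
    coherence⇒StrategicallyClosed P win z (λ _ → O₁.zero) z-cofinal λ β s₁ →
      let C , coh = coherent β s₁ in C , coh , λ i A → constant O₁.zero i A

  MA-for⇒SCP : MA-for ω₂ (ℙ-SCP ω₁ ω₂) → SCP ω₁ ω₂
  MA-for⇒SCP ma =
    let z , f , z-cofinal , coherent = SCP-game.MA-for⇒CoherentSequence ma
    in z , f , z-cofinal , λ β s₁ →
         let C , coh = coherent β s₁ in C , Coherent⇒CoherentClub coh

  MA-for⇒SCP⁻ : MA-for ω₂ (ℙ-SCP⁻ ω₁ ω₂) → SCP⁻ ω₁ ω₂
  MA-for⇒SCP⁻ ma =
    let z , _ , z-cofinal , coherent = SCP⁻-game.MA-for⇒CoherentSequence ma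
    in z , z-cofinal , λ β s₁ →
         let C , coh = coherent β s₁ in C , Unindexed.Coherent.coherent⁻ coh

  SCP-equivalences :
      (SCP ω₁ ω₂ ⇔ ((P : Poset) → Separative P → *-OperationallyClosed ω₁ P → StrategicallyClosed ω₂ P))
    × (SCP ω₁ ω₂ ⇔ StrategicallyClosed ω₂ (ℙ-SCP ω₁ ω₂))
    × (SCP ω₁ ω₂ ⇔ MA ω₂ (*-OperationallyClosed ω₁))
    × (SCP ω₁ ω₂ ⇔ MA-for ω₂ (ℙ-SCP ω₁ ω₂))
  SCP-equivalences = equivalences {ℙ = ℙ-SCP ω₁ ω₂} (Indexed.ConditionTheory.separative indexed)
    (SCP-game.τ , SCP-game.*-closed) SCP⇒StrategicallyClosed MA-for⇒SCP

  SCP⁻-equivalences :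
      (SCP⁻ ω₁ ω₂ ⇔ ((P : Poset) → Separative P → *-TacticallyClosed ω₁ P → StrategicallyClosed ω₂ P))
    × (SCP⁻ ω₁ ω₂ ⇔ StrategicallyClosed ω₂ (ℙ-SCP⁻ ω₁ ω₂))
    × (SCP⁻ ω₁ ω₂ ⇔ MA ω₂ (*-TacticallyClosed ω₁))
    × (SCP⁻ ω₁ ω₂ ⇔ MA-for ω₂ (ℙ-SCP⁻ ω₁ ω₂))
  SCP⁻-equivalences = equivalences {ℙ = ℙ-SCP⁻ ω₁ ω₂} (Unindexed.ConditionTheory.separative unindexed)
    (SCP⁻-game.τ , (λ _ _ _ → refl) , SCP⁻-game.*-closed) SCP⁻⇒StrategicallyClosed MA-for⇒SCP⁻

theorem4p6 : (∀ ℓ → ExcludedMiddle ℓ) →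
    (∀ a b → Extensionality a b) →
    (ω₁ ω₂ : WellOrder) →
    IsCardinalSuccessor ω ω₁ →
    IsCardinalSuccessor ω₁ ω₂ →
    ( (SCP ω₁ ω₂ ⇔ ((P : Poset) → Separative P → *-OperationallyClosed ω₁ P → StrategicallyClosed ω₂ P))
    × (SCP ω₁ ω₂ ⇔ StrategicallyClosed ω₂ (ℙ-SCP ω₁ ω₂))
    × (SCP ω₁ ω₂ ⇔ MA ω₂ (*-OperationallyClosed ω₁))
    × (SCP ω₁ ω₂ ⇔ MA-for ω₂ (ℙ-SCP ω₁ ω₂)) )
    ×
    ( (SCP⁻ ω₁ ω₂ ⇔ ((P : Poset) → Separative P → *-TacticallyClosed ω₁ P → StrategicallyClosed ω₂ P))
    × (SCP⁻ ω₁ ω₂ ⇔ StrategicallyClosed ω₂ (ℙ-SCP⁻ ω₁ ω₂))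
    × (SCP⁻ ω₁ ω₂ ⇔ MA ω₂ (*-TacticallyClosed ω₁))
    × (SCP⁻ ω₁ ω₂ ⇔ MA-for ω₂ (ℙ-SCP⁻ ω₁ ω₂)) )
theorem4p6 em ext ω₁ ω₂ ω₁-succ ω₂-succ = SCP-equivalences , SCP⁻-equivalences
  where open Equivalences em ext ω₁ ω₂ ω₁-succ ω₂-succ
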